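{- For a pair $(a,b)\in\mathbb{Z}^2$ let $H(a,b)=\max\{|a|^{1/3},|b|^{1/4}\}$. Then the limit $$\lim_{X\to\infty}\frac{\#\{(a,b)\in\mathbb{Z}^2\colon H(a,b)<X,\ \mathrm{disc}(x^4+ax+b)\text{ is squarefree}\}}{\#\{(a,b)\in\mathbb{Z}^2\colon H(a,b)<X\}}$$ exists and equals $$\frac13\prod_{p\geq5}\Bigl(1 - \frac{2}{p^2} + \frac{1}{p^3}\Bigr),$$ the product taken over primes $p\ge 5$ (this is approximately $28.03\%$).
   Context: The discriminant of $x^4+ax+b$ is $256b^3-27a^4$. An integer is squarefree if it is nonzero and not divisible by $p^2$ for any prime $p$. -}

module Defs where

open import Data.Nat as ℕ using (ℕ; zero; suc; _∸_)
import Data.Nat.Properties as ℕP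
import Data.Nat.Divisibility as ℕD
open import Data.Nat.Primality using (Prime; prime?)
open import Data.Integer as ℤ using (ℤ; +_; -[1+_]; ∣_∣)
open import Data.Integer.Divisibility using (_∣_)
open import Data.Rational as ℚ using (ℚ; _/_; 1ℚ)
import Data.Rational.Properties as ℚP
open import Data.List using (List; []; _∷_; _++_; map; reverse; filter; length; concatMap; upTo)
open import Data.Product using (_×_; _,_; ∃; ∃-syntax)
open import Relation.Nullary using (¬_; Dec; yes; no)
open import Relation.Nullary.Decidable using (_×-dec_; ¬?)
open import Relation.Binary.PropositionalEquality using (_≡_; _≢_; refl)
open import Data.Empty using (⊥-elim)

Squarefree : ℤ → Set
Squarefree d = (d ≢ + 0) × (∀ (p : ℕ) → Prime p → ¬ (+ (p ℕ.* p) ∣ d))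

private
  bound : ∀ {p n} → Prime p → n ≢ 0 → p ℕ.* p ℕD.∣ n → p ℕ.< suc n
  bound {p} {n} pr n≢0 div =
    ℕ.s≤s (ℕD.∣⇒≤ {{ℕ.≢-nonZero n≢0}} (ℕD.∣-trans (ℕD.m∣m*n p) div))

squarefree? : (d : ℤ) → Dec (Squarefree d)
squarefree? (+ zero) = no λ (h , _) → h refl
squarefree? d@(+ suc n) with ℕP.anyUpTo? (λ p → prime? p ×-dec (p ℕ.* p ℕD.∣? suc n)) (suc (suc n))
... | yes (p , _ , pr , dv) = no λ (_ , h) → h p pr dv
... | no ¬e = yes ((λ ()) , λ p pr dv → ¬e (p , bound pr (λ ()) dv , pr , dv))
squarefree? d@(-[1+ n ]) with ℕP.anyUpTo? (λ p → prime? p ×-dec (p ℕ.* p ℕD.∣? suc n)) (suc (suc n))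
... | yes (p , _ , pr , dv) = no λ (_ , h) → h p pr dv
... | no ¬e = yes ((λ ()) , λ p pr dv → ¬e (p , bound pr (λ ()) dv , pr , dv))

-- Discriminant of x⁴ + a x + b :  256 b³ − 27 a⁴.

disc : ℤ → ℤ → ℤ
disc a b = + 256 ℤ.* (b ℤ.* b ℤ.* b) ℤ.- + 27 ℤ.* (a ℤ.* a ℤ.* a ℤ.* a)

-- Height condition  H(a,b) < X,  H(a,b) = max(|a|^{1/3}, |b|^{1/4}),
-- for X ≥ 0 rational. Since t ↦ t³, t ↦ t⁴ are strictly increasing on
-- [0,∞):  H(a,b) < X  ⇔  |a| < X³ and |b| < X⁴.

toℚ : ℤ → ℚ
toℚ z = z / 1

HeightBelow : ℚ → ℤ → ℤ → Set
HeightBelow X a b = (toℚ (+ ∣ a ∣) ℚ.< X ℚ.* X ℚ.* X) × (toℚ (+ ∣ b ∣) ℚ.< X ℚ.* X ℚ.* X ℚ.* X)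

heightBelow? : ∀ X a b → Dec (HeightBelow X a b)
heightBelow? X a b = (toℚ (+ ∣ a ∣) ℚP.<? X ℚ.* X ℚ.* X) ×-dec (toℚ (+ ∣ b ∣) ℚP.<? X ℚ.* X ℚ.* X ℚ.* X)

intRange : ℕ → List ℤ
intRange B = map (λ k → ℤ.- (+ k)) (reverse (upTo (suc B))) ++ map (λ k → + suc k) (upTo B)

-- A box [-B,B]² guaranteed to contain all (a,b) with H(a,b) < X (for X ≥ 0):
-- |a|, |b| < X⁴ ≤ ⌈X⌉⁴ when X ≥ 1, and < 1 when X < 1.
boxBound : ℚ → ℕ
boxBound X = let c = ∣ ℚ.ceiling X ∣ in suc (c ℕ.* c ℕ.* c ℕ.* c)

pairsInBox : ℕ → List (ℤ × ℤ)
pairsInBox B = concatMap (λ a → map (λ b → (a , b)) (intRange B)) (intRange B)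

countAll : ℚ → ℕ
countAll X = length (filter (λ (ab : ℤ × ℤ) → let (a , b) = ab in heightBelow? X a b)
                            (pairsInBox (boxBound X)))

countSqfree : ℚ → ℕ
countSqfree X = length (filter (λ (ab : ℤ × ℤ) → let (a , b) = ab in
                                  heightBelow? X a b ×-dec squarefree? (disc a b))
                               (pairsInBox (boxBound X)))

-- Euler factor 1 − 2/p² + 1/p³ = (p³ − 2p + 1)/p³  (for p ≥ 1; only used for p ≥ 5)

eulerFactor : ℕ → ℚ
eulerFactor zero = 1ℚ
eulerFactor (suc k) = let p = suc k in
  (+ (p ℕ.* p ℕ.* p) ℤ.- + (2 ℕ.* p) ℤ.+ + 1) / (p ℕ.* p ℕ.* p)

partialProduct : ℕ → ℚ
partialProduct zero = 1ℚ
partialProduct (suc n) with 5 ℕ.≤? suc n | prime? (suc n)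
... | yes _ | yes _ = partialProduct n ℚ.* eulerFactor (suc n)
... | _     | _     = partialProduct n

constantApprox : ℕ → ℚ
constantApprox N = (+ 1 / 3) ℚ.* partialProduct N

{-# OPTIONS --safe #-}

-- Sieve by the squares p² for p ≤ M. Modulo p², p ≥ 5, the pairs with p² ∣ disc are those with p ∣ a and p ∣ b
-- together with the p² − p pairs (−4t³ , 3t⁴), t a unit; this gives the Euler factor. It remains to see that few pairs
-- (a , b) with |a| ≤ n³, |b| ≤ n⁴ have p² ∣ disc for a prime p > M.
-- If p ∣ a and p ∣ b, sum over p. If p ∤ a and p ≤ n⁴/M, each a leaves at most three classes of b modulo p².
-- If p is larger, put β = 4b, α = a² and consider the cubic resolvent x³ − βx − α, whose discriminant is disc. Choosing r
-- with p ∣ 3r² − β and p² ∣ r³ − βr − α, the form ((px + ry)³ − β(px + ry)y² − αy³)/p² is an integral binary cubic form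
-- of discriminant disc/p² which represents p at (1 , 0). After Gauss reduction of the lattice of the vectors
-- (n²y , px + ry) its coefficients and the vector (u , v) representing p satisfy |f₀f₁f₂f₃uv| ≪ n¹⁰/p ≪ M n⁶, and (a , b)
-- is recovered from them up to sign through the Hessian and Jacobian covariants. Hence there are only
-- O(n⁶ (log n)⁶) such pairs, apart from O(n⁶) pairs for which the resolvent has an integer root.
module Submission where

-- The difficulty is the range of `p`. The discriminant has size `n¹²`, so `p` can reach size `n⁶`,
-- while a congruence modulo `p²` on `b` alone costs O(1) for every `a`; summed over `p` much beyond
-- `n⁴`, these boundary terms exceed the `n⁷` pairs. Hence the cut at `n⁴/M`, where they still cost
-- only O(`n⁷/M`). Above the cut no classes of cubic forms are counted. The vector representing `p`
-- is kept instead, since the values of the two covariants there are exactly `12b` and `27a²`. A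
-- reduced basis can be very skew, so single coefficients have no good bound; but in the product of
-- the six integers both norms occur to the same power, the seventh, and the determinant controls
-- the product of the norms. Counting sextuples by their product costs logarithms, which the gap
-- between `n⁶` and `n⁷` absorbs. Zeros would make the product useless: this is why a form with a
-- vanishing outer coefficient is handled through roots, and why every integer is measured by max(1,
-- |c|).

module Sums where

  open import Data.Nat
  open import Data.Nat.Properties
  open import Data.Integer as ℤ using (ℤ; +_; -[1+_])
  import Data.Integer.Properties as ℤP
  import Data.Integer.Tactic.RingSolver as ℤR
  open import Data.List using (List; []; _∷_; _++_; map; reverse; filter; length; concatMap; upTo; _∷ʳ_)
  open import Data.Nat.ListAction using (sum)
  import Data.List.Properties as LP
  open import Data.Product using (_×_; _,_)
  open import Data.Sum using (_⊎_; inj₁; inj₂)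
  open import Function using (_∘_)
  open import Relation.Nullary using (¬_; Dec; yes; no; contradiction)
  open import Relation.Nullary.Decidable using (_×-dec_; ¬?)
  open import Relation.Binary.PropositionalEquality
  open import Data.Nat.Tactic.RingSolver using (solve-∀)
  open import Algebra.Properties.CommutativeSemigroup +-commutativeSemigroup using (interchange)
  open import Defs using (intRange; pairsInBox)

  -- Finite sums and indicators

  Σ< : ℕ → (ℕ → ℕ) → ℕ
  Σ< zero f = 0
  Σ< (suc n) f = Σ< n f + f n

  Σ-cong : ∀ n {f g} → (∀ i → i < n → f i ≡ g i) → Σ< n f ≡ Σ< n g
  Σ-cong zero h = refl
  Σ-cong (suc n) h = cong₂ _+_ (Σ-cong n λ i i<n → h i (m<n⇒m<1+n i<n)) (h n ≤-refl)

  Σ-mono : ∀ n {f g} → (∀ i → i < n → f i ≤ g i) → Σ< n f ≤ Σ< n g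
  Σ-mono zero h = z≤n
  Σ-mono (suc n) h = +-mono-≤ (Σ-mono n λ i i<n → h i (m<n⇒m<1+n i<n)) (h n ≤-refl)

  Σ-const : ∀ n c → Σ< n (λ _ → c) ≡ n * c
  Σ-const zero c = refl
  Σ-const (suc n) c = trans (cong (_+ c) (Σ-const n c)) (+-comm (n * c) c)

  Σ-zero : ∀ n → Σ< n (λ _ → 0) ≡ 0
  Σ-zero n = trans (Σ-const n 0) (*-zeroʳ n)

  Σ-≤const : ∀ n c {f} → (∀ i → i < n → f i ≤ c) → Σ< n f ≤ n * c
  Σ-≤const n c h = ≤-trans (Σ-mono n h) (≤-reflexive (Σ-const n c))

  Σ-+ : ∀ n f g → Σ< n (λ i → f i + g i) ≡ Σ< n f + Σ< n g
  Σ-+ zero f g = refl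
  Σ-+ (suc n) f g = trans (cong (_+ (f n + g n)) (Σ-+ n f g)) (interchange (Σ< n f) (Σ< n g) (f n) (g n))

  Σ-* : ∀ n c f → Σ< n (λ i → c * f i) ≡ c * Σ< n f
  Σ-* zero c f = sym (*-zeroʳ c)
  Σ-* (suc n) c f = trans (cong (_+ c * f n) (Σ-* n c f)) (sym (*-distribˡ-+ c (Σ< n f) (f n)))

  Σ-*ʳ : ∀ n c f → Σ< n (λ i → f i * c) ≡ Σ< n f * c
  Σ-*ʳ n c f = trans (Σ-cong n λ i _ → *-comm (f i) c) (trans (Σ-* n c f) (*-comm c (Σ< n f)))

  Σ-swap : ∀ m n (f : ℕ → ℕ → ℕ) → Σ< m (λ i → Σ< n (f i)) ≡ Σ< n (λ j → Σ< m (λ i → f i j))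
  Σ-swap zero n f = sym (Σ-zero n)
  Σ-swap (suc m) n f = trans (cong (_+ Σ< n (f m)) (Σ-swap m n f)) (sym (Σ-+ n _ (f m)))

  Σ-split : ∀ m n f → Σ< (m + n) f ≡ Σ< m f + Σ< n (λ i → f (m + i))
  Σ-split m zero f rewrite +-identityʳ m = sym (+-identityʳ _)
  Σ-split m (suc n) f rewrite +-suc m n =
    trans (cong (_+ f (m + n)) (Σ-split m n f)) (+-assoc (Σ< m f) _ _)

  Σ-suc : ∀ n f → Σ< (suc n) f ≡ f 0 + Σ< n (f ∘ suc)
  Σ-suc n f = Σ-split 1 n f

  Σ-term : ∀ n f i → i < n → f i ≤ Σ< n f
  Σ-term (suc n) f i i<1+n with m≤n⇒m<n∨m≡n (≤-pred i<1+n)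
  ... | inj₁ i<n = ≤-trans (Σ-term n f i i<n) (m≤m+n _ _)
  ... | inj₂ refl = m≤n+m _ _

  Σ-extend : ∀ {m n} f → m ≤ n → Σ< m f ≤ Σ< n f
  Σ-extend {m} {n} f m≤n = subst (λ k → Σ< m f ≤ Σ< k f) (m+[n∸m]≡n m≤n)
    (≤-trans (m≤m+n _ _) (≤-reflexive (sym (Σ-split m (n ∸ m) f))))

  ⟦_⟧ : ∀ {p} {P : Set p} → Dec P → ℕ
  ⟦ yes _ ⟧ = 1
  ⟦ no _ ⟧ = 0

  ⟦⟧≤1 : ∀ {p} {P : Set p} (d : Dec P) → ⟦ d ⟧ ≤ 1
  ⟦⟧≤1 (yes _) = ≤-refl
  ⟦⟧≤1 (no _) = z≤n

  ⟦⟧-yes : ∀ {p} {P : Set p} (d : Dec P) → P → ⟦ d ⟧ ≡ 1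
  ⟦⟧-yes (yes _) p = refl
  ⟦⟧-yes (no ¬p) p = contradiction p ¬p

  ⟦⟧-no : ∀ {p} {P : Set p} (d : Dec P) → ¬ P → ⟦ d ⟧ ≡ 0
  ⟦⟧-no (yes p) ¬p = contradiction p ¬p
  ⟦⟧-no (no _) ¬p = refl

  ⟦⟧-mono : ∀ {p q} {P : Set p} {Q : Set q} (d : Dec P) (e : Dec Q) → (P → Q) → ⟦ d ⟧ ≤ ⟦ e ⟧
  ⟦⟧-mono (yes p) e h = ≤-reflexive (sym (⟦⟧-yes e (h p)))
  ⟦⟧-mono (no _) e h = z≤n

  ⟦⟧-cong : ∀ {p q} {P : Set p} {Q : Set q} (d : Dec P) (e : Dec Q) → (P → Q) → (Q → P) → ⟦ d ⟧ ≡ ⟦ e ⟧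
  ⟦⟧-cong d e f g = ≤-antisym (⟦⟧-mono d e f) (⟦⟧-mono e d g)

  ⟦⟧-× : ∀ {p q} {P : Set p} {Q : Set q} (d : Dec P) (e : Dec Q) → ⟦ d ×-dec e ⟧ ≡ ⟦ d ⟧ * ⟦ e ⟧
  ⟦⟧-× (yes _) (yes _) = refl
  ⟦⟧-× (yes _) (no _) = refl
  ⟦⟧-× (no _) _ = refl

  ⟦⟧-¬ : ∀ {p} {P : Set p} (d : Dec P) → ⟦ d ⟧ + ⟦ ¬? d ⟧ ≡ 1
  ⟦⟧-¬ (yes _) = refl
  ⟦⟧-¬ (no _) = refl

  Σ-≡0 : ∀ n {f} → (∀ i → i < n → f i ≡ 0) → Σ< n f ≡ 0
  Σ-≡0 n h = trans (Σ-cong n h) (Σ-zero n)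

  Σ-atMostOne : ∀ n {P : ℕ → Set} (P? : ∀ i → Dec (P i)) →
    (∀ i j → i < n → j < n → P i → P j → i ≡ j) → Σ< n (λ i → ⟦ P? i ⟧) ≤ 1
  Σ-atMostOne zero P? h = z≤n
  Σ-atMostOne (suc n) P? h with P? n
  ... | no _ = subst (_≤ 1) (sym (+-identityʳ _))
                  (Σ-atMostOne n P? λ i j i<n j<n → h i j (m<n⇒m<1+n i<n) (m<n⇒m<1+n j<n))
  ... | yes p = ≤-reflexive (cong (_+ 1) (Σ-≡0 n λ i i<n →
                  ⟦⟧-no (P? i) λ pi → <⇒≢ i<n (h i n (m<n⇒m<1+n i<n) ≤-refl pi p)))

  Σ-exactlyOne : ∀ n {P : ℕ → Set} (P? : ∀ i → Dec (P i)) →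
    (∀ i j → i < n → j < n → P i → P j → i ≡ j) → ∀ k → k < n → P k → Σ< n (λ i → ⟦ P? i ⟧) ≡ 1
  Σ-exactlyOne n P? h k k<n pk = ≤-antisym (Σ-atMostOne n P? h)
    (≤-trans (≤-reflexive (sym (⟦⟧-yes (P? k) pk))) (Σ-term n (λ i → ⟦ P? i ⟧) k k<n))

  -- Sums over windows and symmetric intervals of integers

  W : ℤ → ℕ → (ℤ → ℕ) → ℕ
  W s L f = Σ< L (λ i → f (s ℤ.+ + i))

  W-front : ∀ s L f → W s (suc L) f ≡ f s + W (s ℤ.+ + 1) L f
  W-front s L f = trans (Σ-suc L _) (cong₂ _+_ (cong f (ℤP.+-identityʳ s))
    (Σ-cong L λ i _ → cong f (sym (ℤP.+-assoc s (+ 1) (+ i)))))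

  -- The symmetric interval is encoded as a window with a shifted start, so that estimates for
  -- periodic functions on arbitrary windows apply to it directly.
  Box : ℕ → (ℤ → ℕ) → ℕ
  Box B f = W (ℤ.- (+ B)) (suc (B + B)) f

  Box-suc : ∀ B f → Box (suc B) f ≡ f -[1+ B ] + Box B f + f (+ suc B)
  Box-suc B f = begin
    W s (suc (suc B + suc B)) f ≡⟨ cong (λ k → W s (suc k) f) (cong suc (+-suc B B)) ⟩
    W s (suc (suc (suc (B + B)))) f ≡⟨ W-front s (suc (suc (B + B))) f ⟩
    f s + (W (s ℤ.+ + 1) (suc (B + B)) f + f (s ℤ.+ + 1 ℤ.+ + suc (B + B)))
      ≡⟨ cong (_+_ (f s)) (cong₂ (λ u v → W u (suc (B + B)) f + f v) (e₁ (+ B)) (e₂ (+ B))) ⟩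
    f s + (Box B f + f (+ suc B)) ≡⟨ sym (+-assoc (f s) _ _) ⟩
    f s + Box B f + f (+ suc B) ∎
    where
    open ≡-Reasoning
    s : ℤ
    s = ℤ.- (+ suc B)
    e₁ : ∀ b → ℤ.- (+ 1 ℤ.+ b) ℤ.+ + 1 ≡ ℤ.- b
    e₁ = ℤR.solve-∀
    e₂ : ∀ b → ℤ.- (+ 1 ℤ.+ b) ℤ.+ + 1 ℤ.+ (+ 1 ℤ.+ (b ℤ.+ b)) ≡ + 1 ℤ.+ b
    e₂ = ℤR.solve-∀

  Box-cong : ∀ B {f g} → (∀ a → f a ≡ g a) → Box B f ≡ Box B g
  Box-cong B h = Σ-cong (suc (B + B)) λ i _ → h _

  Box-abs : ∀ B i → i < suc (B + B) → ℤ.∣ ℤ.- (+ B) ℤ.+ + i ∣ ≤ B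
  Box-abs B i (s≤s i≤2B) = subst (λ x → ℤ.∣ x ∣ ≤ B) (ℤP.+-comm (+ i) (ℤ.- (+ B)))
    (subst (λ x → ℤ.∣ x ∣ ≤ B) (sym (ℤP.m-n≡m⊖n i B)) (go (≤-total i B)))
    where
    go : i ≤ B ⊎ B ≤ i → ℤ.∣ i ℤ.⊖ B ∣ ≤ B
    go (inj₁ i≤B) rewrite ℤP.∣⊖∣-≤ i≤B = m∸n≤m B i
    go (inj₂ B≤i) rewrite ℤP.⊖-≥ B≤i = ≤-trans (∸-monoˡ-≤ B i≤2B) (≤-reflexive (m+n∸n≡m B B))

  Box-mono : ∀ B {f g} → (∀ a → ℤ.∣ a ∣ ≤ B → f a ≤ g a) → Box B f ≤ Box B g
  Box-mono B h = Σ-mono (suc (B + B)) λ i i< → h _ (Box-abs B i i<)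

  Box-term : ∀ B f a → ℤ.∣ a ∣ ≤ B → f a ≤ Box B f
  Box-term B f a ∣a∣≤B = subst (_≤ Box B f) (cong f (eq a ∣a∣≤B)) (Σ-term (suc (B + B)) (λ i → f (ℤ.- (+ B) ℤ.+ + i)) (idx a) (s≤s (idx≤ a ∣a∣≤B)))
    where
    idx : ℤ → ℕ
    idx (+ k) = B + k
    idx -[1+ k ] = B ∸ suc k
    idx≤ : ∀ a → ℤ.∣ a ∣ ≤ B → idx a ≤ B + B
    idx≤ (+ k) h = +-monoʳ-≤ B h
    idx≤ -[1+ k ] h = ≤-trans (m∸n≤m B (suc k)) (m≤m+n B B)
    cancel : ∀ b k → ℤ.- b ℤ.+ (b ℤ.+ k) ≡ k
    cancel = ℤR.solve-∀
    eq : ∀ a → ℤ.∣ a ∣ ≤ B → ℤ.- (+ B) ℤ.+ + idx a ≡ a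
    eq (+ k) h = cancel (+ B) (+ k)
    eq -[1+ k ] h = trans (cong (ℤ._+_ (ℤ.- (+ B))) (trans (sym (ℤP.⊖-≥ h)) (sym (ℤP.m-n≡m⊖n B (suc k))))) (cancel (+ B) -[1+ k ])

  +ℤ-cancelˡ : ∀ i {j k} → i ℤ.+ j ≡ i ℤ.+ k → j ≡ k
  +ℤ-cancelˡ i {j} {k} eq = trans (sym (cancel i j)) (trans (cong (ℤ._+_ (ℤ.- i)) eq) (cancel i k))
    where
    cancel : ∀ i j → ℤ.- i ℤ.+ (i ℤ.+ j) ≡ j
    cancel = ℤR.solve-∀

  Box-atMostOne : ∀ B {P : ℤ → Set} (P? : ∀ a → Dec (P a)) →
    (∀ a a′ → P a → P a′ → a ≡ a′) → Box B (λ a → ⟦ P? a ⟧) ≤ 1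
  Box-atMostOne B P? h = Σ-atMostOne (suc (B + B)) (λ i → P? _) λ i j _ _ pi pj →
    ℤP.+-injective (+ℤ-cancelˡ (ℤ.- (+ B)) (h _ _ pi pj))

  -- Each layer outside the smaller interval contributes 0. This is how the height condition cuts
  -- the generous enumerated box down to its true sides.
  Box-restrict : ∀ {A B} f → A ≤ B → Box B (λ a → ⟦ ℤ.∣ a ∣ ≤? A ⟧ * f a) ≡ Box A f
  Box-restrict {A} {B} f A≤B = go B A≤B
    where
    g : ℤ → ℕ
    g a = ⟦ ℤ.∣ a ∣ ≤? A ⟧ * f a
    inside : Box A g ≡ Box A f
    inside = Σ-cong (suc (A + A)) λ i i< →
      trans (cong (_* f (ℤ.- (+ A) ℤ.+ + i)) (⟦⟧-yes (ℤ.∣ ℤ.- (+ A) ℤ.+ + i ∣ ≤? A) (Box-abs A i i<))) (*-identityˡ _)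
    go : ∀ B → A ≤ B → Box B g ≡ Box A f
    go B A≤B with m≤n⇒m<n∨m≡n A≤B
    go B _ | inj₂ refl = inside
    go (suc B) _ | inj₁ (s≤s A≤B) = begin
      Box (suc B) g ≡⟨ Box-suc B g ⟩
      g -[1+ B ] + Box B g + g (+ suc B) ≡⟨ cong₂ (λ u v → u * f -[1+ B ] + Box B g + v * f (+ suc B)) out out ⟩
      Box B g + 0 ≡⟨ +-identityʳ _ ⟩
      Box B g ≡⟨ go B A≤B ⟩
      Box A f ∎
      where
      open ≡-Reasoning
      out : ⟦ suc B ≤? A ⟧ ≡ 0
      out = ⟦⟧-no (suc B ≤? A) (<⇒≱ (s≤s A≤B))

  -- From lengths of filtered lists to sums

  ΣL : ∀ {A : Set} → List A → (A → ℕ) → ℕ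
  ΣL l f = sum (map f l)

  ΣL-++ : ∀ {A : Set} (l m : List A) f → ΣL (l ++ m) f ≡ ΣL l f + ΣL m f
  ΣL-++ [] m f = refl
  ΣL-++ (x ∷ l) m f = trans (cong (_+_ (f x)) (ΣL-++ l m f)) (sym (+-assoc (f x) _ _))

  ΣL-map : ∀ {A B : Set} (g : A → B) (l : List A) f → ΣL (map g l) f ≡ ΣL l (f ∘ g)
  ΣL-map g l f = cong sum (sym (LP.map-∘ l))

  ΣL-concatMap : ∀ {A B : Set} (g : A → List B) (l : List A) f →
    ΣL (concatMap g l) f ≡ ΣL l (λ a → ΣL (g a) f)
  ΣL-concatMap g [] f = refl
  ΣL-concatMap g (x ∷ l) f = trans (ΣL-++ (g x) (concatMap g l) f) (cong (_+_ (ΣL (g x) f)) (ΣL-concatMap g l f))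

  ΣL-reverse : ∀ {A : Set} (l : List A) f → ΣL (reverse l) f ≡ ΣL l f
  ΣL-reverse [] f = refl
  ΣL-reverse (x ∷ l) f = trans (cong (λ m → ΣL m f) (LP.unfold-reverse x l))
    (trans (ΣL-++ (reverse l) (x ∷ []) f)
      (trans (cong₂ _+_ (ΣL-reverse l f) (+-identityʳ (f x))) (+-comm _ (f x))))

  ΣL-upTo : ∀ n f → ΣL (upTo n) f ≡ Σ< n f
  ΣL-upTo zero f = refl
  ΣL-upTo (suc n) f = trans (cong (λ m → ΣL m f) (sym (LP.upTo-∷ʳ n)))
    (trans (ΣL-++ (upTo n) (n ∷ []) f) (cong₂ _+_ (ΣL-upTo n f) (+-identityʳ (f n))))

  length-filter : ∀ {A : Set} {P : A → Set} (P? : ∀ x → Dec (P x)) (l : List A) →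
    length (filter P? l) ≡ ΣL l (λ x → ⟦ P? x ⟧)
  length-filter P? [] = refl
  length-filter P? (x ∷ l) with P? x
  ... | yes _ = cong suc (length-filter P? l)
  ... | no _ = length-filter P? l

  ΣL-intRange : ∀ B f → ΣL (intRange B) f ≡ Box B f
  ΣL-intRange B f = trans (ΣL-++ (map _ (reverse (upTo (suc B)))) _ f)
    (trans (cong₂ _+_
        (trans (ΣL-map _ (reverse (upTo (suc B))) f) (trans (ΣL-reverse (upTo (suc B)) _) (ΣL-upTo (suc B) _)))
        (trans (ΣL-map _ (upTo B) f) (ΣL-upTo B _)))
      (halves B))
    where
    arrange : ∀ a b c d → (a + b) + (c + d) ≡ b + (a + c) + d
    arrange = solve-∀
    halves : ∀ B → Σ< (suc B) (λ i → f (ℤ.- (+ i))) + Σ< B (λ i → f (+ suc i)) ≡ Box B f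
    halves zero = +-identityʳ _
    halves (suc B) = trans (arrange (Σ< (suc B) (λ i → f (ℤ.- (+ i)))) (f -[1+ B ]) _ (f (+ suc B)))
      (trans (cong (λ x → f -[1+ B ] + x + f (+ suc B)) (halves B)) (sym (Box-suc B f)))

  length-filter-pairs : ∀ B {P : ℤ × ℤ → Set} (P? : ∀ x → Dec (P x)) →
    length (filter P? (pairsInBox B)) ≡ Box B (λ a → Box B (λ b → ⟦ P? (a , b) ⟧))
  length-filter-pairs B P? = trans (length-filter P? (pairsInBox B))
    (trans (ΣL-concatMap _ (intRange B) _)
      (trans (ΣL-intRange B _) (Box-cong B λ a → trans (ΣL-map (a ,_) (intRange B) _) (ΣL-intRange B _))))

-- Divisibility and congruences modulo p²

module Divs where

  open import Data.Nat as ℕ using (ℕ; zero; suc)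
  import Data.Nat.Properties as ℕP
  import Data.Nat.Divisibility as ℕD
  import Data.Nat.Coprimality as ℕC
  open ℕC using (Coprime)
  open import Data.Nat.GCD using (module Bézout)
  open import Data.Nat.Primality using (Prime; prime⇒irreducible; euclidsLemma)
  open import Data.Integer hiding (suc)
  open import Data.Integer.Properties hiding (_≟_)
  open import Data.Integer.DivMod using (_%ℕ_; _/ℕ_; n%ℕd<d; a≡a%ℕn+[a/ℕn]*n)
  open import Data.Integer.Divisibility.Signed
  open import Data.Integer.Tactic.RingSolver using (solve-∀)
  open import Data.Product using (_×_; _,_; ∃-syntax)
  open import Data.Sum using (_⊎_; inj₁; inj₂; map)
  open import Relation.Nullary using (¬_; contradiction)
  open import Relation.Binary.PropositionalEquality using (_≡_; refl; sym; trans; cong; subst)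

  ∣-lin : ∀ {d x z} k → d ∣ x → z ≡ k * x → d ∣ z
  ∣-lin k d∣x refl = ∣n⇒∣m*n k d∣x

  ∣-lin₂ : ∀ {d x y z} k l → d ∣ x → d ∣ y → z ≡ k * x + l * y → d ∣ z
  ∣-lin₂ k l d∣x d∣y refl = ∣m∣n⇒∣m+n (∣n⇒∣m*n k d∣x) (∣n⇒∣m*n l d∣y)

  ∣-square : ∀ {p x} → + (p ℕ.* p) ∣ x → + p ∣ x
  ∣-square {p} = ∣-trans (divides (+ p) (pos-* p p))

  prime-∣* : ∀ {p} → Prime p → ∀ x y → + p ∣ x * y → (+ p ∣ x) ⊎ (+ p ∣ y)
  prime-∣* {p} pr x y h = map ∣ᵤ⇒∣ ∣ᵤ⇒∣ (euclidsLemma ∣ x ∣ ∣ y ∣ pr (subst (p ℕD.∣_) (abs-* x y) (∣⇒∣ᵤ h)))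

  prime-∣-square : ∀ {p} → Prime p → ∀ x → + p ∣ x * x → + p ∣ x
  prime-∣-square pr x h with prime-∣* pr x x h
  ... | inj₁ d = d
  ... | inj₂ d = d

  prime-coprime : ∀ {p n} → Prime p → ¬ p ℕD.∣ n → Coprime p n
  prime-coprime pr p∤n {d} (d∣p , d∣n) with prime⇒irreducible pr d∣p
  ... | inj₁ d≡1 = d≡1
  ... | inj₂ refl = contradiction d∣n p∤n

  -- A common divisor `d` of `p²` and `n` is prime to `p`, because `p` does not divide `n`. So `d`
  -- divides `p`, and `prime-coprime` applies.
  prime²-coprime : ∀ {p n} → Prime p → ¬ p ℕD.∣ n → Coprime (p ℕ.* p) n
  prime²-coprime {p} pr p∤n {d} (d∣pp , d∣n) = prime-coprime pr p∤n (ℕC.coprime-divisor d⊥p d∣pp , d∣n)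
    where
    d⊥p : Coprime d p
    d⊥p (e∣d , e∣p) = prime-coprime pr p∤n (e∣p , ℕD.∣-trans e∣d d∣n)

  coprime-cancel : ∀ {m k x} → Coprime m ∣ k ∣ → + m ∣ k * x → + m ∣ x
  coprime-cancel {m} {k} {x} c h = ∣ᵤ⇒∣ (ℕC.coprime-divisor c (subst (m ℕD.∣_) (abs-* k x) (∣⇒∣ᵤ h)))

  prime²-coprimeℤ : ∀ {p k} → Prime p → ¬ + p ∣ k → Coprime (p ℕ.* p) ∣ k ∣
  prime²-coprimeℤ pr p∤k = prime²-coprime pr λ d → p∤k (∣ᵤ⇒∣ d)

  prime²-cancel : ∀ {p} → Prime p → ∀ {k x} → ¬ + p ∣ k → + (p ℕ.* p) ∣ k * x → + (p ℕ.* p) ∣ x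
  prime²-cancel pr {k} {x} p∤k = coprime-cancel {k = k} {x} (prime²-coprimeℤ pr p∤k)

  inverseℕ : ∀ {m n} → Coprime m n → ∃[ t ] + n ∣ + m * t - + 1
  inverseℕ {m} {n} c with ℕC.coprime-Bézout c
  ... | Bézout.+- x y eq = + x , divides (+ y) (trans (cong (_- + 1) (trans (*-comm (+ m) (+ x)) (trans (sym (pos-* x m)) (trans (cong +_ (sym eq)) (cong (_+_ (+ 1)) (pos-* y n)))))) (e (+ y * + n)))
    where
    e : ∀ z → + 1 + z - + 1 ≡ z
    e = solve-∀
  ... | Bézout.-+ x y eq = - + x , divides (- + y)
          (trans (e₁ (+ m) (+ x)) (trans (cong -_ (trans (cong (_+_ (+ 1)) (sym (pos-* x m))) (trans (cong +_ eq) (pos-* y n)))) (neg-distribˡ-* (+ y) (+ n))))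
    where
    e₁ : ∀ m x → m * (- x) - + 1 ≡ - (+ 1 + x * m)
    e₁ = solve-∀

  inverse : ∀ {k n} → Coprime ∣ k ∣ n → ∃[ t ] + n ∣ k * t - + 1
  inverse {+ m} c = inverseℕ c
  inverse { -[1+ m ]} c with inverseℕ c
  ... | t , d = - t , subst (λ z → _ ∣ z - + 1) (e (+ suc m) t) d
    where
    e : ∀ k t → k * t ≡ (- k) * (- t)
    e = solve-∀

  residue : ∀ n .{{_ : ℕ.NonZero n}} x → ∃[ c ] (c ℕ.< n × + n ∣ x - + c)
  residue n x = x %ℕ n , n%ℕd<d x n , divides (x /ℕ n) (trans (cong (_- + (x %ℕ n)) (a≡a%ℕn+[a/ℕn]*n x n)) (e (+ (x %ℕ n)) _))
    where
    e : ∀ r z → r + z - r ≡ z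
    e = solve-∀

  linear-congruence : ∀ {k n} .{{_ : ℕ.NonZero n}} → Coprime ∣ k ∣ n → ∀ s → ∃[ c ] (c ℕ.< n × + n ∣ k * + c + s)
  linear-congruence {k} {n} cop s with inverse {k} cop
  ... | t , d with residue n (- s * t)
  ... | c , c<n , d′ = c , c<n , ∣-lin₂ (- s) (- k) d d′ (e k s t (+ c))
    where
    e : ∀ k s t c → k * c + s ≡ (- s) * (k * t - + 1) + (- k) * (- s * t - c)
    e = solve-∀

  ∣small⇒≡ : ∀ {n i j} → i ℕ.< n → j ℕ.< n → + n ∣ + i - + j → i ≡ j
  ∣small⇒≡ {n} {i} {j} i<n j<n d = +-injective (i-j≡0⇒i≡j (+ i) (+ j) (∣i∣≡0⇒i≡0 (zeroℕ (∣⇒∣ᵤ d) small)))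
    where
    zeroℕ : ∀ {k} → n ℕD.∣ k → k ℕ.< n → k ≡ 0
    zeroℕ {zero} _ _ = refl
    zeroℕ {suc k} h k<n = contradiction (ℕD.∣⇒≤ h) (ℕP.<⇒≱ k<n)
    small : ∣ + i - + j ∣ ℕ.< n
    small = subst (λ z → ∣ z ∣ ℕ.< n) (sym (m-n≡m⊖n i j)) (go (ℕP.≤-total i j))
      where
      go : i ℕ.≤ j ⊎ j ℕ.≤ i → ∣ i ⊖ j ∣ ℕ.< n
      go (inj₁ i≤j) rewrite ∣⊖∣-≤ i≤j = ℕP.≤-<-trans (ℕP.m∸n≤m j i) j<n
      go (inj₂ j≤i) rewrite ⊖-≥ j≤i = ℕP.≤-<-trans (ℕP.m∸n≤m i j) i<n

  linear-unique : ∀ {k n s i j} → Coprime n ∣ k ∣ → i ℕ.< n → j ℕ.< n →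
    + n ∣ k * + i + s → + n ∣ k * + j + s → i ≡ j
  linear-unique {k} {n} {s} {i} {j} c i<n j<n di dj =
    ∣small⇒≡ i<n j<n (coprime-cancel {k = k} c (∣-lin₂ (+ 1) (- + 1) di dj (e k s (+ i) (+ j))))
    where
    e : ∀ k s i j → k * (i - j) ≡ + 1 * (k * i + s) + - + 1 * (k * j + s)
    e = solve-∀

-- Periodic functions and the Chinese remainder theorem

module Periodic where

  open Sums
  open Divs
  open import Data.Nat
  open import Data.Nat.Properties
  open import Data.Nat.Coprimality using (Coprime) renaming (sym to coprime-sym)
  open import Data.Nat.DivMod using (_/_; _%_; m≡m%n+[m/n]*n; m%n≤n)
  open import Data.Integer as ℤ using (ℤ; +_; -[1+_])
  import Data.Integer.Properties as ℤP
  open import Data.Integer.Divisibility.Signed using (_∣_; _∣?_; divides)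
  import Data.Integer.Tactic.RingSolver as ℤR
  open import Data.Nat.Tactic.RingSolver using (solve-∀)
  open import Data.Product using (_×_; _,_; proj₁; proj₂)
  open import Relation.Binary.PropositionalEquality

  Periodic : ℕ → (ℤ → ℕ) → Set
  Periodic Q f = ∀ a → f (a ℤ.+ + Q) ≡ f a

  W-split : ∀ s m n f → W s (m + n) f ≡ W s m f + W (s ℤ.+ + m) n f
  W-split s m n f = trans (Σ-split m n _) (cong (_+_ (W s m f)) (Σ-cong n λ i _ → cong f (sym (ℤP.+-assoc s (+ m) (+ i)))))

  -- From a window of length `Q + 1` either the first or the last term can be split off, and
  -- periodicity makes these two terms equal.
  W-shift : ∀ {Q f} → Periodic Q f → ∀ s → W (s ℤ.+ + 1) Q f ≡ W s Q f
  W-shift {Q} {f} per s = +-cancelˡ-≡ (f s) _ _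
    (trans (sym (W-front s Q f)) (trans (cong (_+_ (W s Q f)) (per s)) (+-comm _ (f s))))

  Per : ℕ → (ℤ → ℕ) → ℕ
  Per Q f = W (+ 0) Q f

  W-period : ∀ {Q f} → Periodic Q f → ∀ s → W s Q f ≡ Per Q f
  W-period per (+ zero) = refl
  W-period {Q} {f} per (+ suc n) = trans (cong (λ k → W (+ k) Q f) (+-comm 1 n)) (trans (W-shift per (+ n)) (W-period per (+ n)))
  W-period per -[1+ zero ] = sym (W-shift per -[1+ 0 ])
  W-period per -[1+ suc n ] = trans (sym (W-shift per -[1+ suc n ])) (W-period per -[1+ n ])

  W-blocks : ∀ {Q f} → Periodic Q f → ∀ s m → W s (m * Q) f ≡ m * Per Q f
  W-blocks {Q} {f} per s zero = refl
  W-blocks {Q} {f} per s (suc m) = trans (W-split s Q (m * Q) f) (cong₂ _+_ (W-period per s) (W-blocks per (s ℤ.+ + Q) m))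

  -- The window consists of `L / Q` full periods and a rest shorter than `Q`. As the terms are
  -- natural numbers, the rest contributes between 0 and one full period.
  W-quot : ∀ {Q f} .{{_ : NonZero Q}} → Periodic Q f → ∀ s L →
    (L / Q) * Per Q f ≤ W s L f × W s L f ≤ (L / Q) * Per Q f + Per Q f
  W-quot {Q} {f} per s L =
    subst (_ ≤_) (sym eq) (m≤m+n _ _) ,
    subst (_≤ _) (sym eq) (+-monoʳ-≤ ((L / Q) * Per Q f)
      (≤-trans (Σ-extend _ (m%n≤n L Q)) (≤-reflexive (W-period per (s ℤ.+ + (L / Q * Q))))))
    where
    eq : W s L f ≡ (L / Q) * Per Q f + W (s ℤ.+ + (L / Q * Q)) (L % Q) f
    eq = trans (cong (λ l → W s l f) (trans (m≡m%n+[m/n]*n L Q) (+-comm (L % Q) _)))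
      (trans (W-split s (L / Q * Q) (L % Q) f) (cong (_+ W (s ℤ.+ + (L / Q * Q)) (L % Q) f) (W-blocks per s (L / Q))))

  W-upper : ∀ {Q f} .{{_ : NonZero Q}} → Periodic Q f → ∀ s L → Q * W s L f ≤ (L + Q) * Per Q f
  W-upper {Q} {f} per s L = begin
    Q * W s L f ≤⟨ *-monoʳ-≤ Q (proj₂ (W-quot per s L)) ⟩
    Q * ((L / Q) * c + c) ≡⟨ e Q (L / Q) c ⟩
    (L / Q * Q + Q) * c ≤⟨ *-monoˡ-≤ c (+-monoˡ-≤ Q (≤-trans (m≤n+m _ (L % Q)) (≤-reflexive (sym (m≡m%n+[m/n]*n L Q))))) ⟩
    (L + Q) * c ∎
    where
    open ≤-Reasoning
    c = Per Q f
    e : ∀ Q m c → Q * (m * c + c) ≡ (m * Q + Q) * c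
    e = solve-∀

  W-lower : ∀ {Q f} .{{_ : NonZero Q}} → Periodic Q f → ∀ s L → L * Per Q f ≤ Q * W s L f + Q * Per Q f
  W-lower {Q} {f} per s L = begin
    L * c ≡⟨ cong (_* c) (m≡m%n+[m/n]*n L Q) ⟩
    (L % Q + L / Q * Q) * c ≤⟨ *-monoˡ-≤ c (+-monoˡ-≤ (L / Q * Q) (m%n≤n L Q)) ⟩
    (Q + L / Q * Q) * c ≡⟨ e Q (L / Q) c ⟩
    Q * ((L / Q) * c) + Q * c ≤⟨ +-monoˡ-≤ (Q * c) (*-monoʳ-≤ Q (proj₁ (W-quot per s L))) ⟩
    Q * W s L f + Q * c ∎
    where
    open ≤-Reasoning
    c = Per Q f
    e : ∀ Q m c → (Q + m * Q) * c ≡ Q * (m * c) + Q * c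
    e = solve-∀

  Periodic-multiple : ∀ {Q f} → Periodic Q f → ∀ a k → f (a ℤ.+ + (k * Q)) ≡ f a
  Periodic-multiple {Q} {f} per a zero = cong f (ℤP.+-identityʳ a)
  Periodic-multiple {Q} {f} per a (suc k) =
    trans (cong f (sym (ℤP.+-assoc a (+ Q) (+ (k * Q))))) (trans (Periodic-multiple per _ k) (per a))

  Periodic-∣ : ∀ {Q f} → Periodic Q f → ∀ {a b} → + Q ∣ a ℤ.- b → f a ≡ f b
  Periodic-∣ {Q} {f} per {a} {b} (divides (+ k) eq) =
    trans (cong f (trans (e a b) (cong (ℤ._+_ b) (trans eq (sym (ℤP.pos-* k Q)))))) (Periodic-multiple per b k)
    where
    e : ∀ a b → a ≡ b ℤ.+ (a ℤ.- b)
    e = ℤR.solve-∀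
  Periodic-∣ {Q} {f} per {a} {b} (divides -[1+ k ] eq) =
    sym (trans (cong f (trans (e a b) (cong (ℤ._+_ a) (trans (cong ℤ.-_ eq) (trans (e′ (+ suc k) (+ Q)) (sym (ℤP.pos-* (suc k) Q))))))) (Periodic-multiple per a (suc k)))
    where
    e : ∀ a b → b ≡ a ℤ.+ (ℤ.- (a ℤ.- b))
    e = ℤR.solve-∀
    e′ : ∀ k q → ℤ.- (ℤ.- k ℤ.* q) ≡ k ℤ.* q
    e′ = ℤR.solve-∀

  -- Sorting `x` by its residue class separates the argument from the value, which lets `stride` sum
  -- over the arguments first.
  expand : ∀ {m g} .{{_ : NonZero m}} → Periodic m g → ∀ x → g x ≡ Σ< m (λ c → ⟦ + m ∣? (x ℤ.- + c) ⟧ * g (+ c))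
  expand {m} {g} per x = let (c₀ , c₀<m , d₀) = residue m x in sym (trans (Σ-cong m λ c c<m → step c)
      (trans (Σ-*ʳ m (g x) _) (trans (cong (_* g x) (Σ-exactlyOne m (λ c → + m ∣? (x ℤ.- + c)) uniq c₀ c₀<m d₀)) (*-identityˡ (g x)))))
    where
    open import Relation.Nullary using (yes; no)
    step : ∀ c → ⟦ + m ∣? (x ℤ.- + c) ⟧ * g (+ c) ≡ ⟦ + m ∣? (x ℤ.- + c) ⟧ * g x
    step c with + m ∣? (x ℤ.- + c)
    ... | yes d = cong (λ u → u + 0) (sym (Periodic-∣ {f = g} per d))
    ... | no _ = refl
    e : ∀ x i j → i ℤ.- j ≡ + 1 ℤ.* (x ℤ.- j) ℤ.+ ℤ.- (+ 1) ℤ.* (x ℤ.- i)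
    e = ℤR.solve-∀
    uniq : ∀ i j → i < m → j < m → + m ∣ (x ℤ.- + i) → + m ∣ (x ℤ.- + j) → i ≡ j
    uniq i j i<m j<m di dj = ∣small⇒≡ i<m j<m (∣-lin₂ (+ 1) (ℤ.- (+ 1)) dj di (e x (+ i) (+ j)))

  -- As `Q` is invertible modulo `m`, the progression `kQ + j` meets each residue class modulo `m`
  -- exactly once.
  stride : ∀ {Q m g} .{{_ : NonZero m}} → Coprime Q m → Periodic m g → ∀ j →
    Σ< m (λ k → g (+ (k * Q + j))) ≡ Per m g
  stride {Q} {m} {g} cop per j = begin
    Σ< m (λ k → g (+ (k * Q + j)))
      ≡⟨ Σ-cong m (λ k _ → expand per (+ (k * Q + j))) ⟩
    Σ< m (λ k → Σ< m (λ c → ⟦ + m ∣? (+ (k * Q + j) ℤ.- + c) ⟧ * g (+ c)))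
      ≡⟨ Σ-swap m m _ ⟩
    Σ< m (λ c → Σ< m (λ k → ⟦ + m ∣? (+ (k * Q + j) ℤ.- + c) ⟧ * g (+ c)))
      ≡⟨ Σ-cong m (λ c _ → trans (Σ-*ʳ m (g (+ c)) _) (trans (cong (_* g (+ c)) (one c)) (*-identityˡ _))) ⟩
    Per m g ∎
    where
    open ≡-Reasoning
    e : ∀ q k j c → k ℤ.* q ℤ.+ j ℤ.- c ≡ q ℤ.* k ℤ.+ (j ℤ.- c)
    e = ℤR.solve-∀
    conv : ∀ k c → + (k * Q + j) ℤ.- + c ≡ + Q ℤ.* + k ℤ.+ (+ j ℤ.- + c)
    conv k c = trans (cong (λ u → u ℤ.+ + j ℤ.- + c) (ℤP.pos-* k Q)) (e (+ Q) (+ k) (+ j) (+ c))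
    one : ∀ c → Σ< m (λ k → ⟦ + m ∣? (+ (k * Q + j) ℤ.- + c) ⟧) ≡ 1
    one c = let (k₀ , k₀<m , d₀) = linear-congruence {+ Q} cop (+ j ℤ.- + c) in Σ-exactlyOne m (λ k → + m ∣? (+ (k * Q + j) ℤ.- + c))
      (λ i i′ i< i′< d d′ → linear-unique {+ Q} {m} {+ j ℤ.- + c} (coprime-sym cop) i< i′<
        (subst (+ m ∣_) (conv i c) d) (subst (+ m ∣_) (conv i′ c) d′))
      k₀ k₀<m (subst (+ m ∣_) (sym (conv k₀ c)) d₀)

  Σ-blocks : ∀ m Q f → Σ< (m * Q) f ≡ Σ< m (λ k → Σ< Q (λ j → f (k * Q + j)))
  Σ-blocks zero Q f = refl
  Σ-blocks (suc m) Q f = trans (cong (λ l → Σ< l f) (+-comm Q (m * Q)))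
    (trans (Σ-split (m * Q) Q f) (cong (_+ Σ< Q (λ j → f (m * Q + j))) (Σ-blocks m Q f)))

  -- With `i = kQ + j` the factor `f` sees only `j`, and for fixed `j` the sum of `g` over `k` is a
  -- full period by `stride`.
  Per-* : ∀ {Q m f g} .{{_ : NonZero m}} → Coprime Q m → Periodic Q f → Periodic m g →
    Per (m * Q) (λ a → f a * g a) ≡ Per Q f * Per m g
  Per-* {Q} {m} {f} {g} cop pf pg = begin
    Σ< (m * Q) (λ i → f (+ i) * g (+ i)) ≡⟨ Σ-blocks m Q _ ⟩
    Σ< m (λ k → Σ< Q (λ j → f (+ (k * Q + j)) * g (+ (k * Q + j))))
      ≡⟨ Σ-cong m (λ k _ → Σ-cong Q (λ j _ → cong (_* g (+ (k * Q + j)))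
           (trans (cong (λ i → f (+ i)) (+-comm (k * Q) j)) (Periodic-multiple pf (+ j) k)))) ⟩
    Σ< m (λ k → Σ< Q (λ j → f (+ j) * g (+ (k * Q + j)))) ≡⟨ Σ-swap m Q _ ⟩
    Σ< Q (λ j → Σ< m (λ k → f (+ j) * g (+ (k * Q + j))))
      ≡⟨ Σ-cong Q (λ j _ → trans (Σ-* m (f (+ j)) _) (cong (f (+ j) *_) (stride cop pg j))) ⟩
    Σ< Q (λ j → f (+ j) * Per m g) ≡⟨ Σ-*ʳ Q (Per m g) _ ⟩
    Per Q f * Per m g ∎
    where open ≡-Reasoning

  Periodic₂ : ℕ → (ℤ → ℤ → ℕ) → Set
  Periodic₂ Q f = (∀ a b → f (a ℤ.+ + Q) b ≡ f a b) × (∀ a → Periodic Q (f a))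

  Per₂ : ℕ → (ℤ → ℤ → ℕ) → ℕ
  Per₂ Q f = Per Q (λ a → Per Q (f a))

  Per-periodic : ∀ {Q R} {f : ℤ → ℤ → ℕ} → (∀ a b → f (a ℤ.+ + Q) b ≡ f a b) → Periodic Q (λ a → Per R (f a))
  Per-periodic {Q} {R} h a = Σ-cong R λ i _ → h a (+ i)

  Per₂-* : ∀ {Q m f g} .{{_ : NonZero m}} → Coprime Q m → Periodic₂ Q f → Periodic₂ m g →
    Per₂ (m * Q) (λ a b → f a b * g a b) ≡ Per₂ Q f * Per₂ m g
  Per₂-* {Q} {m} {f} {g} cop (pf , pf′) (pg , pg′) =
    trans (Σ-cong (m * Q) λ i _ → Per-* cop (pf′ (+ i)) (pg′ (+ i)))
      (Per-* {f = λ a → Per Q (f a)} {g = λ a → Per m (g a)} cop (Per-periodic {R = Q} pf) (Per-periodic {R = m} pg))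

  module _ {Q : ℕ} {f : ℤ → ℤ → ℕ} .{{_ : NonZero Q}} (per : Periodic₂ Q f) (s t : ℤ) (L K : ℕ) where
    private
      C = Per₂ Q f
      c = λ a → Per Q (f a)
      perC : Periodic Q c
      perC = Per-periodic {R = Q} (proj₁ per)

    W₂-upper : Q * Q * W s L (λ a → W t K (f a)) ≤ (L + Q) * (K + Q) * C
    W₂-upper = begin
      Q * Q * W s L (λ a → W t K (f a)) ≡⟨ *-assoc Q Q _ ⟩
      Q * (Q * W s L (λ a → W t K (f a))) ≡⟨ cong (Q *_) (sym (Σ-* L Q _)) ⟩
      Q * W s L (λ a → Q * W t K (f a)) ≤⟨ *-monoʳ-≤ Q (Σ-mono L λ i _ → W-upper (proj₂ per _) t K) ⟩
      Q * W s L (λ a → (K + Q) * c a) ≡⟨ cong (Q *_) (Σ-* L (K + Q) _) ⟩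
      Q * ((K + Q) * W s L c) ≡⟨ e Q (K + Q) _ ⟩
      (K + Q) * (Q * W s L c) ≤⟨ *-monoʳ-≤ (K + Q) (W-upper perC s L) ⟩
      (K + Q) * ((L + Q) * C) ≡⟨ e′ (K + Q) (L + Q) C ⟩
      (L + Q) * (K + Q) * C ∎
      where
      open ≤-Reasoning
      e : ∀ a b c → a * (b * c) ≡ b * (a * c)
      e = solve-∀
      e′ : ∀ a b c → a * (b * c) ≡ b * a * c
      e′ = solve-∀

    -- The one-dimensional bound is used once in each variable. The bound by 1 gives `c a ≤ Q` and
    -- `C ≤ Q²`, which turn the two boundary losses into `Q³L` and `Q³K`.
    W₂-lower : (∀ a b → f a b ≤ 1) →
      L * K * C ≤ Q * Q * W s L (λ a → W t K (f a)) + Q * Q * Q * (L + K)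
    W₂-lower f≤1 = begin
      L * K * C ≡⟨ e₁ L K C ⟩
      K * (L * C) ≤⟨ *-monoʳ-≤ K (W-lower perC s L) ⟩
      K * (Q * W s L c + Q * C) ≡⟨ e₂ K Q (W s L c) C ⟩
      Q * (K * W s L c) + K * Q * C
        ≤⟨ +-mono-≤ (*-monoʳ-≤ Q (≤-trans (≤-reflexive (sym (Σ-* L K _))) (Σ-mono L λ i _ → W-lower (proj₂ per _) t K)))
             (*-monoʳ-≤ (K * Q) (Σ-≤const Q (Q * 1) λ i _ → c≤ (+ i))) ⟩
      Q * W s L (λ a → Q * W t K (f a) + Q * c a) + K * Q * (Q * (Q * 1))
        ≡⟨ cong (λ u → Q * u + K * Q * (Q * (Q * 1))) (Σ-+ L _ _) ⟩
      Q * (W s L (λ a → Q * W t K (f a)) + W s L (λ a → Q * c a)) + K * Q * (Q * (Q * 1))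
        ≤⟨ +-monoˡ-≤ _ (*-monoʳ-≤ Q (+-mono-≤ (≤-reflexive (Σ-* L Q _)) (Σ-≤const L (Q * (Q * 1)) λ i _ → *-monoʳ-≤ Q (c≤ _)))) ⟩
      Q * (Q * W s L (λ a → W t K (f a)) + L * (Q * (Q * 1))) + K * Q * (Q * (Q * 1))
        ≡⟨ e₃ Q (W s L (λ a → W t K (f a))) L K ⟩
      Q * Q * W s L (λ a → W t K (f a)) + Q * Q * Q * (L + K) ∎
      where
      open ≤-Reasoning
      c≤ : ∀ a → c a ≤ Q * 1
      c≤ a = Σ-≤const Q 1 λ i _ → f≤1 a (+ i)
      e₁ : ∀ L K C → L * K * C ≡ K * (L * C)
      e₁ = solve-∀
      e₂ : ∀ K Q w C → K * (Q * w + Q * C) ≡ Q * (K * w) + K * Q * C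
      e₂ = solve-∀
      e₃ : ∀ Q w L K → Q * (Q * w + L * (Q * (Q * 1))) + K * Q * (Q * (Q * 1)) ≡ Q * Q * w + Q * Q * Q * (L + K)
      e₃ = solve-∀

-- The discriminant modulo p²

module Local where

  open Sums
  open Divs
  open Periodic
  open import Defs using (disc)
  open import Data.Nat as ℕ using (ℕ; suc; s≤s; z≤n; _≤_; _<_)
  import Data.Nat.Properties as ℕP
  import Data.Nat.Divisibility as ℕD
  open import Data.Nat.Coprimality using () renaming (sym to coprime-sym)
  open import Data.Nat.Primality using (Prime; prime⇒nonZero)
  open import Data.Integer using (ℤ; +_; _+_; _*_; _-_; -_; ∣_∣)
  import Data.Integer.Properties as ℤP
  open import Data.Integer.Divisibility.Signed
  open import Data.Integer.Tactic.RingSolver using (solve-∀)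
  import Data.Nat.Tactic.RingSolver as ℕR
  open import Data.Product using (_×_; _,_; ∃-syntax; proj₁; proj₂)
  open import Data.Sum using (_⊎_; inj₁; inj₂; [_,_]′)
  open import Relation.Nullary using (¬_; Dec; yes; no; contradiction)
  open import Relation.Nullary.Decidable using (_×-dec_; ¬?)
  open import Relation.Binary.PropositionalEquality using (_≡_; refl; sym; trans; cong; cong₂; subst; module ≡-Reasoning)

  ∣-disc-cong : ∀ m a a′ b b′ → m ∣ a - a′ → m ∣ b - b′ → m ∣ disc a b - disc a′ b′
  ∣-disc-cong m a a′ b b′ da db =
    ∣-lin₂ (+ 256 * (b * b + b * b′ + b′ * b′)) (- + 27 * (a + a′) * (a * a + a′ * a′)) db da (e a a′ b b′)
    where
    e : ∀ a a′ b b′ →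
      (+ 256 * (b * b * b) - + 27 * (a * a * a * a)) - (+ 256 * (b′ * b′ * b′) - + 27 * (a′ * a′ * a′ * a′))
      ≡ (+ 256 * (b * b + b * b′ + b′ * b′)) * (b - b′) + (- + 27 * (a + a′) * (a * a + a′ * a′)) * (a - a′)
    e = solve-∀

  ∣-resp-- : ∀ {m} x y → m ∣ x - y → m ∣ y → m ∣ x
  ∣-resp-- x y d dy = ∣-lin₂ (+ 1) (+ 1) d dy (e x y)
    where
    e : ∀ x y → x ≡ + 1 * (x - y) + + 1 * y
    e = solve-∀

  ∣-sub-comm : ∀ {m} x y → m ∣ x - y → m ∣ y - x
  ∣-sub-comm x y d = ∣-lin (- + 1) d (e x y)
    where
    e : ∀ x y → y - x ≡ - + 1 * (x - y)
    e = solve-∀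

  ∣-shift : ∀ m a → + m ∣ (a + + m) - a
  ∣-shift m a = divides (+ 1) (e a (+ m))
    where
    e : ∀ a m → a + m - a ≡ + 1 * m
    e = solve-∀

  ∣-self- : ∀ m a → m ∣ a - a
  ∣-self- m a = divides (+ 0) (ℤP.+-inverseʳ a)

  divDisc : ℕ → ℤ → ℤ → ℕ
  divDisc m a b = ⟦ + m ∣? disc a b ⟧

  notDivDisc : ℕ → ℤ → ℤ → ℕ
  notDivDisc m a b = ⟦ ¬? (+ m ∣? disc a b) ⟧

  ∣disc-resp : ∀ m a a′ b b′ → + m ∣ a - a′ → + m ∣ b - b′ → + m ∣ disc a b → + m ∣ disc a′ b′
  ∣disc-resp m a a′ b b′ da db = ∣-resp-- (disc a′ b′) (disc a b) (∣-disc-cong (+ m) a′ a b′ b (∣-sub-comm a a′ da) (∣-sub-comm b b′ db))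

  divDisc-cong : ∀ m a a′ b b′ → + m ∣ a - a′ → + m ∣ b - b′ → divDisc m a b ≡ divDisc m a′ b′
  divDisc-cong m a a′ b b′ da db = ⟦⟧-cong (+ m ∣? disc a b) (+ m ∣? disc a′ b′)
    (∣disc-resp m a a′ b b′ da db) (∣disc-resp m a′ a b′ b (∣-sub-comm a a′ da) (∣-sub-comm b b′ db))

  divDisc-periodic : ∀ m → Periodic₂ m (divDisc m)
  divDisc-periodic m =
    (λ a b → divDisc-cong m (a + + m) a b b (∣-shift m a) (∣-self- (+ m) b)) ,
    (λ a b → divDisc-cong m a a (b + + m) b (∣-self- (+ m) a) (∣-shift m b))

  divDisc+notDivDisc : ∀ m a b → divDisc m a b ℕ.+ notDivDisc m a b ≡ 1
  divDisc+notDivDisc m a b = ⟦⟧-¬ (+ m ∣? disc a b)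

  notDivDisc-periodic : ∀ m → Periodic₂ m (notDivDisc m)
  notDivDisc-periodic m =
    (λ a b → comp (a + + m) b a b (proj₁ (divDisc-periodic m) a b)) ,
    (λ a b → comp a (b + + m) a b (proj₂ (divDisc-periodic m) a b))
    where
    comp : ∀ a b a′ b′ → divDisc m a b ≡ divDisc m a′ b′ → notDivDisc m a b ≡ notDivDisc m a′ b′
    comp a b a′ b′ eq = ℕP.+-cancelˡ-≡ (divDisc m a b) _ _
      (trans (divDisc+notDivDisc m a b) (sym (trans (cong (ℕ._+ notDivDisc m a′ b′) eq) (divDisc+notDivDisc m a′ b′))))

  Per-congruent : ∀ n .{{_ : ℕ.NonZero n}} s → Per n (λ a → ⟦ + n ∣? a + s ⟧) ≡ 1
  Per-congruent n s =
    let (c , c<n , d) = residue n (- s) in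
    Σ-exactlyOne n (λ i → + n ∣? + i + s)
      (λ i j i<n j<n di dj → ∣small⇒≡ i<n j<n (∣-lin₂ (+ 1) (- + 1) di dj (e (+ i) (+ j) s)))
      c c<n (∣-lin (- + 1) d (e′ s (+ c)))
    where
    e : ∀ i j s → i - j ≡ + 1 * (i + s) + - + 1 * (j + s)
    e = solve-∀
    e′ : ∀ s c → c + s ≡ - + 1 * (- s - c)
    e′ = solve-∀

  ∣-indicator-periodic : ∀ p → Periodic p (λ a → ⟦ + p ∣? a ⟧)
  ∣-indicator-periodic p a = ⟦⟧-cong (+ p ∣? a + + p) (+ p ∣? a) (λ d → ∣m+n∣n⇒∣m d ∣-refl) (λ d → ∣m∣n⇒∣m+n d ∣-refl)

  Per-∣-indicator : ∀ p .{{_ : ℕ.NonZero p}} → Per p (λ a → ⟦ + p ∣? a ⟧) ≡ 1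
  Per-∣-indicator p = trans (Σ-cong p λ i _ → cong (λ z → ⟦ + p ∣? z ⟧) (sym (ℤP.+-identityʳ (+ i)))) (Per-congruent p (+ 0))

  module _ {p : ℕ} (pr : Prime p) (5≤p : 5 ≤ p) where

    private
      q = p ℕ.* p
      instance
        p≢0 : ℕ.NonZero p
        p≢0 = prime⇒nonZero pr
        q≢0 : ℕ.NonZero q
        q≢0 = ℕP.m*n≢0 p p

    ∤-* : ∀ x y → ¬ (+ p ∣ x) → ¬ (+ p ∣ y) → ¬ (+ p ∣ x * y)
    ∤-* x y p∤x p∤y d = [ p∤x , p∤y ]′ (prime-∣* pr x y d)

    ∤-small : ∀ k → .{{_ : ℕ.NonZero k}} → k < 5 → ¬ (+ p ∣ + k)
    ∤-small k k<5 d = ℕP.<⇒≱ (ℕP.<-≤-trans k<5 5≤p) (ℕD.∣⇒≤ (∣⇒∣ᵤ d))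

    ∤4 : ¬ (+ p ∣ + 4)
    ∤4 = ∤-small 4 (s≤s (s≤s (s≤s (s≤s (s≤s z≤n)))))

    ∤3 : ¬ (+ p ∣ + 3)
    ∤3 = ∤-small 3 (s≤s (s≤s (s≤s (s≤s z≤n))))

    ∤256 : ¬ (+ p ∣ + 256)
    ∤256 = ∤-* (+ 16) (+ 16) ∤16 ∤16
      where
      ∤16 : ¬ (+ p ∣ + 16)
      ∤16 = ∤-* (+ 4) (+ 4) ∤4 ∤4

    ∤27 : ¬ (+ p ∣ + 27)
    ∤27 = ∤-* (+ 9) (+ 3) (∤-* (+ 3) (+ 3) ∤3 ∤3) ∤3

    ∣-cancelConst : ∀ k {x} → ¬ (+ p ∣ k) → + p ∣ k * x → + p ∣ x
    ∣-cancelConst k {x} p∤k d = [ (λ h → contradiction h p∤k) , (λ h → h) ]′ (prime-∣* pr k x d)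

    ∣-cube : ∀ x → + p ∣ x * x * x → + p ∣ x
    ∣-cube x d = [ prime-∣-square pr x , (λ h → h) ]′ (prime-∣* pr (x * x) x d)

    ∣-fourth : ∀ x → + p ∣ x * x * x * x → + p ∣ x
    ∣-fourth x d = [ ∣-cube x , (λ h → h) ]′ (prime-∣* pr (x * x * x) x d)

    ∣disc∧∣a⇒∣b : ∀ a b → + p ∣ disc a b → + p ∣ a → + p ∣ b
    ∣disc∧∣a⇒∣b a b d da = ∣-cube b (∣-cancelConst (+ 256) ∤256 (∣-lin₂ (+ 1) (+ 27 * a * a * a) d da (e a b)))
      where
      e : ∀ a b → + 256 * (b * b * b) ≡ + 1 * (+ 256 * (b * b * b) - + 27 * (a * a * a * a)) + (+ 27 * a * a * a) * a
      e = solve-∀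

    ∣disc∧∣b⇒∣a : ∀ a b → + p ∣ disc a b → + p ∣ b → + p ∣ a
    ∣disc∧∣b⇒∣a a b d db = ∣-fourth a (∣-cancelConst (+ 27) ∤27 (∣-lin₂ (- + 1) (+ 256 * b * b) d db (e a b)))
      where
      e : ∀ a b → + 27 * (a * a * a * a) ≡ - + 1 * (+ 256 * (b * b * b) - + 27 * (a * a * a * a)) + (+ 256 * b * b) * b
      e = solve-∀

    ∣a∧∣b⇒²∣disc : ∀ a b → + p ∣ a → + p ∣ b → + q ∣ disc a b
    ∣a∧∣b⇒²∣disc a b (divides k refl) (divides l refl) =
      divides (+ 256 * l * l * (l * + p) - + 27 * k * k * (k * + p) * (k * + p))
        (trans (e k l (+ p)) (cong (_*_ (+ 256 * l * l * (l * + p) - + 27 * k * k * (k * + p) * (k * + p))) (sym (ℤP.pos-* p p))))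
      where
      e : ∀ k l p → + 256 * (l * p * (l * p) * (l * p)) - + 27 * (k * p * (k * p) * (k * p) * (k * p))
        ≡ (+ 256 * l * l * (l * p) - + 27 * k * k * (k * p) * (k * p)) * (p * p)
      e = solve-∀

    -- The solutions of p² ∣ 256b³ − 27a⁴ with p ∤ a are (a , b) = (−4t³ , 3t⁴): x⁴ + ax + b then has the double root t.
    Param : ℤ → ℤ → ℕ → Set
    Param a b t = ¬ (+ p ∣ + t) × (+ q ∣ a + + 4 * (+ t * + t * + t)) × (+ q ∣ b + - + 3 * (+ t * + t * + t * + t))

    param? : ∀ a b t → Dec (Param a b t)
    param? a b t = ¬? (+ p ∣? + t) ×-dec ((+ q ∣? a + + 4 * (+ t * + t * + t)) ×-dec (+ q ∣? b + - + 3 * (+ t * + t * + t * + t)))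

    param⇒∣disc : ∀ a b t → Param a b t → + q ∣ disc a b
    param⇒∣disc a b t (_ , da , db) = ∣-resp-- (disc a b) (disc (- + 4 * (T * T * T)) (+ 3 * (T * T * T * T)))
      (∣-disc-cong (+ q) a (- + 4 * (T * T * T)) b (+ 3 * (T * T * T * T)) (subst (+ q ∣_) (e₁ a T) da) (subst (+ q ∣_) (e₂ b T) db))
      (divides (+ 0) (trans (e₃ (T * T * T) T) (trans (cong (_*_ (+ 6912 * (T * T * T) * (T * T * T) * (T * T * T))) (ℤP.+-inverseʳ (T * T * T))) (ℤP.*-zeroʳ (+ 6912 * (T * T * T) * (T * T * T) * (T * T * T))))))
      where
      T = + t
      e₁ : ∀ a T → a + + 4 * (T * T * T) ≡ a - - + 4 * (T * T * T)
      e₁ = solve-∀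
      e₂ : ∀ b T → b + - + 3 * (T * T * T * T) ≡ b - + 3 * (T * T * T * T)
      e₂ = solve-∀
      e₃ : ∀ u T → + 256 * ((+ 3 * (u * T)) * (+ 3 * (u * T)) * (+ 3 * (u * T)))
        - + 27 * ((- + 4 * u) * (- + 4 * u) * (- + 4 * u) * (- + 4 * u)) ≡ + 6912 * u * u * u * (T * T * T - u)
      e₃ = solve-∀

    param⇒∤a : ∀ a b t → Param a b t → ¬ (+ p ∣ a)
    param⇒∤a a b t (p∤t , da , _) d = p∤t (∣-cube (+ t) (∣-cancelConst (+ 4) ∤4
      (∣-lin₂ (+ 1) (- + 1) (∣-square da) d (e a (+ 4 * (+ t * + t * + t))))))
      where
      e : ∀ a x → x ≡ + 1 * (a + x) + - + 1 * a
      e = solve-∀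

    -- For a double root `t` the relations `4t³ + a = 0` and `t⁴ + at + b = 0` combine to one that
    -- is linear in `t`. When `p ∤ a`, the coefficient `3a` is a unit, so `t` is determined by the
    -- pair.
    param-linear : ∀ a b t → Param a b t → + q ∣ + 3 * a * + t + + 4 * b
    param-linear a b t (_ , da , db) = ∣-lin₂ (+ 3 * + t) (+ 4) da db (e a b (+ t))
      where
      e : ∀ a b t → + 3 * a * t + + 4 * b ≡ + 3 * t * (a + + 4 * (t * t * t)) + + 4 * (b + - + 3 * (t * t * t * t))
      e = solve-∀

    -- The candidate is forced: `t = −4b/(3a)` modulo `p²`. Multiplied by `(3a)³` and `(3a)⁴`, the
    -- two required congruences become combinations of the discriminant and of the linear form `X`.
    param-exists : ∀ a b → ¬ (+ p ∣ a) → + q ∣ disc a b → ∃[ t ] (t < q × Param a b t)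
    param-exists a b p∤a d =
      let (t , t<q , lin) = linear-congruence {+ 3 * a} {q} (coprime-sym (prime²-coprimeℤ {k = + 3 * a} pr p∤3a)) (+ 4 * b)
          T = + t
          X = + 3 * a * T + + 4 * b
      in t , t<q ,
        -- If `p ∣ t`, the linear relation gives `p ∣ b`, and the discriminant then gives `p ∣ a`.
        ( (λ p∣t → p∤a (∣disc∧∣b⇒∣a a b (∣-square d) (∣-cancelConst (+ 4) ∤4
              (∣-lin₂ (+ 1) (- (+ 3 * a)) (∣-square lin) p∣t (e₀ a b T)))))
        , prime²-cancel pr {(+ 3 * a) * (+ 3 * a) * (+ 3 * a)}
            (∤-* (+ 3 * a * (+ 3 * a)) (+ 3 * a) (∤-* (+ 3 * a) (+ 3 * a) p∤3a p∤3a) p∤3a)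
            (∣-lin₂ (- + 1) (+ 4 * (X * X - + 12 * b * X + + 48 * b * b)) d lin (e₁ a b T))
        , prime²-cancel pr {(+ 3 * a) * (+ 3 * a) * (+ 3 * a) * (+ 3 * a)}
            (∤-* (+ 3 * a * (+ 3 * a) * (+ 3 * a)) (+ 3 * a)
              (∤-* (+ 3 * a * (+ 3 * a)) (+ 3 * a) (∤-* (+ 3 * a) (+ 3 * a) p∤3a p∤3a) p∤3a) p∤3a)
            (∣-lin₂ (- + 3 * b) (- + 3 * (X * X * X - + 16 * b * X * X + + 96 * b * b * X - + 256 * b * b * b)) d lin (e₂ a b T)) )
      where
      p∤3a : ¬ (+ p ∣ + 3 * a)
      p∤3a = ∤-* (+ 3) a ∤3 p∤a
      e₀ : ∀ a b T → + 4 * b ≡ + 1 * (+ 3 * a * T + + 4 * b) + - (+ 3 * a) * T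
      e₀ = solve-∀
      e₁ : ∀ a b T → let X = + 3 * a * T + + 4 * b in
        (+ 3 * a) * (+ 3 * a) * (+ 3 * a) * (a + + 4 * (T * T * T))
        ≡ - + 1 * (+ 256 * (b * b * b) - + 27 * (a * a * a * a)) + + 4 * (X * X - + 12 * b * X + + 48 * b * b) * X
      e₁ = solve-∀
      e₂ : ∀ a b T → let X = + 3 * a * T + + 4 * b in
        (+ 3 * a) * (+ 3 * a) * (+ 3 * a) * (+ 3 * a) * (b + - + 3 * (T * T * T * T))
        ≡ - + 3 * b * (+ 256 * (b * b * b) - + 27 * (a * a * a * a))
          + - + 3 * (X * X * X - + 16 * b * X * X + + 96 * b * b * X - + 256 * b * b * b) * X
      e₂ = solve-∀

    param-unique : ∀ a b i j → ¬ (+ p ∣ a) → i < q → j < q → Param a b i → Param a b j → i ≡ j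
    param-unique a b i j p∤a i<q j<q pi pj =
      linear-unique {+ 3 * a} {q} {+ 4 * b} (prime²-coprimeℤ {k = + 3 * a} pr (∤-* (+ 3) a ∤3 p∤a)) i<q j<q (param-linear a b i pi) (param-linear a b j pj)

    -- If `p ∣ a`, then `p ∣ disc` forces `p ∣ b`, and conversely divisibility of both gives
    -- `p² ∣ disc`. If `p ∤ a`, the sum over `t` has one nonzero term or none. The summands never
    -- overlap, since a parametrised `a` is prime to `p`.
    divDisc-split : ∀ a b → divDisc q a b ≡ ⟦ + p ∣? a ⟧ ℕ.* ⟦ + p ∣? b ⟧ ℕ.+ Σ< q (λ t → ⟦ param? a b t ⟧)
    divDisc-split a b = go (+ p ∣? a) (+ p ∣? b) (+ q ∣? disc a b)
      where
      none : (∀ t → ¬ Param a b t) → Σ< q (λ t → ⟦ param? a b t ⟧) ≡ 0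
      none h = Σ-≡0 q λ t _ → ⟦⟧-no (param? a b t) (h t)
      go : (da : Dec (+ p ∣ a)) (db : Dec (+ p ∣ b)) (dd : Dec (+ q ∣ disc a b)) →
        ⟦ dd ⟧ ≡ ⟦ da ⟧ ℕ.* ⟦ db ⟧ ℕ.+ Σ< q (λ t → ⟦ param? a b t ⟧)
      go (yes p∣a) (yes p∣b) dd = trans (⟦⟧-yes dd (∣a∧∣b⇒²∣disc a b p∣a p∣b)) (cong suc (sym (none λ t π → param⇒∤a a b t π p∣a)))
      go (yes p∣a) (no p∤b) dd = trans (⟦⟧-no dd λ d → p∤b (∣disc∧∣a⇒∣b a b (∣-square d) p∣a)) (sym (none λ t π → param⇒∤a a b t π p∣a))
      go (no p∤a) db (yes d) = let (t , t<q , π) = param-exists a b p∤a d in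
        sym (Σ-exactlyOne q (param? a b) (λ i j i<q j<q → param-unique a b i j p∤a i<q j<q) t t<q π)
      go (no p∤a) db (no ¬d) = sym (none λ t π → ¬d (param⇒∣disc a b t π))

    private
      Per²-∣ : Per q (λ a → ⟦ + p ∣? a ⟧) ≡ p
      Per²-∣ = trans (W-blocks (∣-indicator-periodic p) (+ 0) p) (trans (cong (p ℕ.*_) (Per-∣-indicator p)) (ℕP.*-identityʳ p))

      units : Σ< q (λ t → ⟦ ¬? (+ p ∣? + t) ⟧) ℕ.+ p ≡ q
      units = trans (ℕP.+-comm _ p) (trans (cong (ℕ._+ Σ< q (λ t → ⟦ ¬? (+ p ∣? + t) ⟧)) (sym Per²-∣))
        (trans (sym (Σ-+ q _ _)) (trans (Σ-cong q λ t _ → ⟦⟧-¬ (+ p ∣? + t)) (trans (Σ-const q 1) (ℕP.*-identityʳ q)))))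

      f₁ : ℕ → ℤ → ℕ
      f₁ t a = ⟦ + q ∣? a + + 4 * (+ t * + t * + t) ⟧
      f₂ : ℕ → ℤ → ℕ
      f₂ t b = ⟦ + q ∣? b + - + 3 * (+ t * + t * + t * + t) ⟧
      f₀ : ℕ → ℕ
      f₀ t = ⟦ ¬? (+ p ∣? + t) ⟧

      param-factor : ∀ a b t → ⟦ param? a b t ⟧ ≡ f₀ t ℕ.* (f₁ t a ℕ.* f₂ t b)
      param-factor a b t = trans (⟦⟧-× (¬? (+ p ∣? + t)) ((+ q ∣? a + + 4 * (+ t * + t * + t)) ×-dec (+ q ∣? b + - + 3 * (+ t * + t * + t * + t))))
        (cong (f₀ t ℕ.*_) (⟦⟧-× (+ q ∣? a + + 4 * (+ t * + t * + t)) (+ q ∣? b + - + 3 * (+ t * + t * + t * + t))))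

      inner : ∀ t → Per q (λ a → Per q (λ b → f₁ t a ℕ.* f₂ t b)) ≡ 1
      inner t = begin
        Per q (λ a → Per q (λ b → f₁ t a ℕ.* f₂ t b)) ≡⟨ Σ-cong q (λ i _ → Σ-* q (f₁ t (+ i)) _) ⟩
        Per q (λ a → f₁ t a ℕ.* Per q (f₂ t)) ≡⟨ Σ-*ʳ q (Per q (f₂ t)) _ ⟩
        Per q (f₁ t) ℕ.* Per q (f₂ t) ≡⟨ cong₂ ℕ._*_ (Per-congruent q (+ 4 * (+ t * + t * + t))) (Per-congruent q (- + 3 * (+ t * + t * + t * + t))) ⟩
        1 ∎
        where open ≡-Reasoning

      parametrised : Per q (λ a → Per q (λ b → Σ< q (λ t → ⟦ param? a b t ⟧))) ≡ Σ< q f₀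
      parametrised = begin
        Per q (λ a → Per q (λ b → Σ< q (λ t → ⟦ param? a b t ⟧)))
          ≡⟨ Σ-cong q (λ i _ → Σ-cong q (λ j _ → Σ-cong q (λ t _ → param-factor (+ i) (+ j) t))) ⟩
        Per q (λ a → Per q (λ b → Σ< q (λ t → f₀ t ℕ.* (f₁ t a ℕ.* f₂ t b))))
          ≡⟨ Σ-cong q (λ i _ → trans (Σ-swap q q _) (Σ-cong q (λ t _ → Σ-* q (f₀ t) _))) ⟩
        Per q (λ a → Σ< q (λ t → f₀ t ℕ.* Per q (λ b → f₁ t a ℕ.* f₂ t b)))
          ≡⟨ trans (Σ-swap q q _) (Σ-cong q (λ t _ → Σ-* q (f₀ t) _)) ⟩
        Σ< q (λ t → f₀ t ℕ.* Per q (λ a → Per q (λ b → f₁ t a ℕ.* f₂ t b)))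
          ≡⟨ Σ-cong q (λ t _ → trans (cong (f₀ t ℕ.*_) (inner t)) (ℕP.*-identityʳ (f₀ t))) ⟩
        Σ< q f₀ ∎
        where open ≡-Reasoning

      nonunits : Per q (λ a → Per q (λ b → ⟦ + p ∣? a ⟧ ℕ.* ⟦ + p ∣? b ⟧)) ≡ q
      nonunits = trans (Σ-cong q λ i _ → Σ-* q ⟦ + p ∣? + i ⟧ _)
        (trans (Σ-*ʳ q (Per q (λ b → ⟦ + p ∣? b ⟧)) _) (cong₂ ℕ._*_ Per²-∣ Per²-∣))

    -- There are `p²` pairs with both entries divisible by `p`, and one pair for each of the
    -- `p² − p` units `t`. The term `p` stands on the left to avoid subtraction.
    local-count : Per₂ q (divDisc q) ℕ.+ p ≡ q ℕ.+ q
    local-count = begin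
      Per₂ q (divDisc q) ℕ.+ p
        ≡⟨ cong (ℕ._+ p) (Σ-cong q (λ i _ → trans (Σ-cong q (λ j _ → divDisc-split (+ i) (+ j))) (Σ-+ q _ _))) ⟩
      Per q (λ a → Per q (λ b → ⟦ + p ∣? a ⟧ ℕ.* ⟦ + p ∣? b ⟧) ℕ.+ Per q (λ b → Σ< q (λ t → ⟦ param? a b t ⟧))) ℕ.+ p
        ≡⟨ cong (ℕ._+ p) (Σ-+ q _ _) ⟩
      Per q (λ a → Per q (λ b → ⟦ + p ∣? a ⟧ ℕ.* ⟦ + p ∣? b ⟧)) ℕ.+ Per q (λ a → Per q (λ b → Σ< q (λ t → ⟦ param? a b t ⟧))) ℕ.+ p
        ≡⟨ cong₂ (λ u v → u ℕ.+ v ℕ.+ p) nonunits parametrised ⟩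
      q ℕ.+ Σ< q f₀ ℕ.+ p ≡⟨ ℕP.+-assoc q _ p ⟩
      q ℕ.+ (Σ< q f₀ ℕ.+ p) ≡⟨ cong (q ℕ.+_) units ⟩
      q ℕ.+ q ∎
      where open ≡-Reasoning

    local-count′ : Per₂ q (notDivDisc q) ℕ.+ (q ℕ.+ q) ≡ q ℕ.* q ℕ.+ p
    local-count′ = begin
      Per₂ q (notDivDisc q) ℕ.+ (q ℕ.+ q) ≡⟨ cong (Per₂ q (notDivDisc q) ℕ.+_) (sym local-count) ⟩
      Per₂ q (notDivDisc q) ℕ.+ (Per₂ q (divDisc q) ℕ.+ p) ≡⟨ e (Per₂ q (notDivDisc q)) (Per₂ q (divDisc q)) p ⟩
      (Per₂ q (divDisc q) ℕ.+ Per₂ q (notDivDisc q)) ℕ.+ p ≡⟨ cong (ℕ._+ p) total ⟩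
      q ℕ.* q ℕ.+ p ∎
      where
      open ≡-Reasoning
      e : ∀ a b c → a ℕ.+ (b ℕ.+ c) ≡ b ℕ.+ a ℕ.+ c
      e = ℕR.solve-∀
      total : Per₂ q (divDisc q) ℕ.+ Per₂ q (notDivDisc q) ≡ q ℕ.* q
      total = trans (sym (Σ-+ q _ _)) (trans (Σ-cong q λ i _ → trans (sym (Σ-+ q _ _))
        (trans (Σ-cong q λ j _ → divDisc+notDivDisc q (+ i) (+ j)) (trans (Σ-const q 1) (ℕP.*-identityʳ q)))) (Σ-const q q))

    module _ {a : ℤ} (p∤a : ¬ (+ p ∣ a)) where

      private
        Root : ℤ → Set
        Root b = + q ∣ disc a b

      root∤ : ∀ {b} → Root b → ¬ (+ p ∣ b)
      root∤ {b} r d = p∤a (∣disc∧∣b⇒∣a a b (∣-square r) d)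

      root-cubes : ∀ {b c} → Root b → Root c → + q ∣ b * b * b - c * c * c
      root-cubes {b} {c} rb rc = prime²-cancel pr {+ 256} ∤256 (∣-lin₂ (+ 1) (- + 1) rb rc (e a b c))
        where
        e : ∀ a b c → + 256 * (b * b * b - c * c * c)
          ≡ + 1 * (+ 256 * (b * b * b) - + 27 * (a * a * a * a)) + - + 1 * (+ 256 * (c * c * c) - + 27 * (a * a * a * a))
        e = solve-∀

      -- Uniqueness as in Hensel's lemma: if `b ≡ c` modulo `p`, the cofactor `b² + bc + c²` of
      -- `b − c` in `b³ − c³` is congruent to `3c²`, a unit.
      root-lift : ∀ {b c} → Root b → Root c → + p ∣ b - c → + q ∣ b - c
      root-lift {b} {c} rb rc d = prime²-cancel pr {b * b + b * c + c * c}
        (λ h → ∤-* (+ 3) (c * c) ∤3 (∤-* c c (root∤ {c} rc) (root∤ {c} rc)) (∣-lin₂ (+ 1) (- (b + + 2 * c)) h d (e₁ b c)))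
        (subst (+ q ∣_) (e₂ b c) (root-cubes {b} {c} rb rc))
        where
        e₁ : ∀ b c → + 3 * (c * c) ≡ + 1 * (b * b + b * c + c * c) + - (b + + 2 * c) * (b - c)
        e₁ = solve-∀
        e₂ : ∀ b c → b * b * b - c * c * c ≡ (b * b + b * c + c * c) * (b - c)
        e₂ = solve-∀

      root-quadratic : ∀ {b c} → Root b → Root c → ¬ (+ p ∣ b - c) → + q ∣ b * b + b * c + c * c
      root-quadratic {b} {c} rb rc ¬d = prime²-cancel pr {b - c} ¬d (subst (+ q ∣_) (e b c) (root-cubes {b} {c} rb rc))
        where
        e : ∀ b c → b * b * b - c * c * c ≡ (b - c) * (b * b + b * c + c * c)
        e = solve-∀

      -- Three cube roots of one number sum to zero: the difference of the quadratic relations of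
      -- `b` and of `b₂` with `b₁` is `(b − b₂)(b + b₁ + b₂)`.
      root-third : ∀ {b₁ b₂ b} → Root b₁ → Root b₂ → Root b → ¬ (+ p ∣ b₂ - b₁) → ¬ (+ p ∣ b - b₁) →
        (+ q ∣ b - b₂) ⊎ (+ q ∣ b + (b₁ + b₂))
      root-third {b₁} {b₂} {b} r₁ r₂ r n₂ n = go (+ p ∣? b - b₂)
        where
        e : ∀ b b₁ b₂ → (b - b₂) * (b + (b₁ + b₂)) ≡ + 1 * (b * b + b * b₁ + b₁ * b₁) + - + 1 * (b₂ * b₂ + b₂ * b₁ + b₁ * b₁)
        e = solve-∀
        go : Dec (+ p ∣ b - b₂) → (+ q ∣ b - b₂) ⊎ (+ q ∣ b + (b₁ + b₂))
        go (yes d) = inj₁ (root-lift {b} {b₂} r r₂ d)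
        go (no ¬d) = inj₂ (prime²-cancel pr {b - b₂} ¬d
          (∣-lin₂ (+ 1) (- + 1) (root-quadratic {b} {b₁} r r₁ n) (root-quadratic {b₂} {b₁} r₂ r₁ n₂) (e b b₁ b₂)))

      -- A cubic congruence modulo `p²` may in general have more than three roots. Here roots that
      -- agree modulo `p` agree modulo `p²`, so two roots `i`, `j` distinct modulo `p` leave only
      -- the classes of `i`, `j` and `−i − j`, and otherwise there is a single class.
      atMostThreeRoots : Per q (divDisc q a) ≤ 3
      atMostThreeRoots = first (ℕP.anyUpTo? (λ i → + q ∣? disc a (+ i)) q)
        where
        module Second (i : ℕ) (r₁ : Root (+ i)) where
          second : Dec (∃[ j ] (j < q × Root (+ j) × ¬ (+ p ∣ + j - + i))) → Per q (divDisc q a) ≤ 3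
          second (no none) = ℕP.≤-trans (Σ-atMostOne q (λ j → + q ∣? disc a (+ j))
            (λ j k j<q k<q rj rk → trans (onlyᵢ j j<q rj) (sym (onlyᵢ k k<q rk)))) (s≤s z≤n)
            where
            -- The module does not record `i < q`, hence the comparison with the remainder of `i`.
            onlyᵢ : ∀ j → j < q → Root (+ j) → j ≡ i ℕ.% q
            onlyᵢ j j<q rj = go (+ p ∣? + j - + i)
              where
              open import Data.Nat.DivMod using (m%n<n; m≡m%n+[m/n]*n)
              e : ∀ j r x → j - r ≡ + 1 * (j - (r + x)) + + 1 * x
              e = solve-∀
              go : Dec (+ p ∣ + j - + i) → j ≡ i ℕ.% q
              go (no ¬d) = contradiction (j , j<q , rj , ¬d) none
              go (yes d) = ∣small⇒≡ j<q (m%n<n i q) (∣-lin₂ (+ 1) (+ 1)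
                (subst (λ z → + q ∣ + j - z) (trans (cong +_ (m≡m%n+[m/n]*n i q)) (ℤP.pos-+ (i ℕ.% q) _)) (root-lift {+ j} {+ i} rj r₁ d))
                (divides (+ (i ℕ./ q)) (ℤP.pos-* (i ℕ./ q) q)) (e (+ j) (+ (i ℕ.% q)) (+ (i ℕ./ q ℕ.* q))))
          second (yes (j , _ , r₂ , n₂)) = begin
            Per q (divDisc q a)
              ≤⟨ Σ-mono q (λ k _ → bound k (+ q ∣? disc a (+ k)) (+ p ∣? + k - + i)) ⟩
            Per q (λ b → c₁ b ℕ.+ (c₂ b ℕ.+ c₃ b))
              ≡⟨ trans (Σ-+ q _ _) (cong (Per q c₁ ℕ.+_) (Σ-+ q _ _)) ⟩
            Per q c₁ ℕ.+ (Per q c₂ ℕ.+ Per q c₃)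
              ≡⟨ cong₂ ℕ._+_ (Per-congruent q (- + i)) (cong₂ ℕ._+_ (Per-congruent q (- + j)) (Per-congruent q (+ i + + j))) ⟩
            3 ∎
            where
            open ℕP.≤-Reasoning
            c₁ c₂ c₃ : ℤ → ℕ
            c₁ b = ⟦ + q ∣? b + - + i ⟧
            c₂ b = ⟦ + q ∣? b + - + j ⟧
            c₃ b = ⟦ + q ∣? b + (+ i + + j) ⟧
            bound : ∀ k (d : Dec (Root (+ k))) → Dec (+ p ∣ + k - + i) → ⟦ d ⟧ ≤ c₁ (+ k) ℕ.+ (c₂ (+ k) ℕ.+ c₃ (+ k))
            bound k (no _) _ = z≤n
            bound k (yes r) (yes d) = ℕP.≤-trans (ℕP.≤-reflexive (sym (⟦⟧-yes (+ q ∣? + k + - + i) (root-lift {+ k} {+ i} r r₁ d)))) (ℕP.m≤m+n _ _)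
            bound k (yes r) (no ¬d) = ℕP.≤-trans
              ([ (λ h → ℕP.≤-trans (ℕP.≤-reflexive (sym (⟦⟧-yes (+ q ∣? + k + - + j) h))) (ℕP.m≤m+n _ _))
               , (λ h → ℕP.≤-trans (ℕP.≤-reflexive (sym (⟦⟧-yes (+ q ∣? + k + (+ i + + j)) h))) (ℕP.m≤n+m _ (c₂ (+ k)))) ]′
                (root-third {+ i} {+ j} {+ k} r₁ r₂ r n₂ ¬d))
              (ℕP.m≤n+m _ (c₁ (+ k)))
        first : Dec (∃[ i ] (i < q × Root (+ i))) → Per q (divDisc q a) ≤ 3
        first (no none) = ℕP.≤-trans (ℕP.≤-reflexive (Σ-≡0 q λ i i<q → ⟦⟧-no (+ q ∣? disc a (+ i)) λ r → none (i , i<q , r))) z≤n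
        first (yes (i , _ , r)) = Second.second i r
          (ℕP.anyUpTo? (λ j → (+ q ∣? disc a (+ j)) ×-dec ¬? (+ p ∣? + j - + i)) q)

-- Integers inside the rational numbers

module Rat where

  open import Defs using (toℚ)
  open import Data.Nat as ℕ using (ℕ; suc)
  open import Data.Integer as ℤ using (ℤ; +_)
  import Data.Integer.Properties as ℤP
  open import Data.Rational
  open import Data.Rational.Properties
  import Data.Rational.Unnormalised as ℚᵘ
  import Data.Rational.Unnormalised.Properties as ℚᵘP
  import Data.Integer.Tactic.RingSolver as ℤR
  open import Relation.Binary.PropositionalEquality

  toℚᵘ-/ : ∀ i d .{{_ : ℕ.NonZero d}} → toℚᵘ (i / d) ℚᵘ.≃ (i ℚᵘ./ d)
  toℚᵘ-/ i (suc d) = toℚᵘ-fromℚᵘ (ℚᵘ.mkℚᵘ i d)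

  toℚ-+ : ∀ i j → toℚ (i ℤ.+ j) ≡ toℚ i + toℚ j
  toℚ-+ i j = toℚᵘ-injective (begin
    toℚᵘ (toℚ (i ℤ.+ j)) ≈⟨ toℚᵘ-/ (i ℤ.+ j) 1 ⟩
    ((i ℤ.+ j) ℚᵘ./ 1) ≈⟨ ℚᵘ.*≡* (e i j) ⟩
    (i ℚᵘ./ 1) ℚᵘ.+ (j ℚᵘ./ 1) ≈⟨ ℚᵘP.+-cong (toℚᵘ-/ i 1) (toℚᵘ-/ j 1) ⟨
    toℚᵘ (toℚ i) ℚᵘ.+ toℚᵘ (toℚ j) ≈⟨ toℚᵘ-homo-+ (toℚ i) (toℚ j) ⟨
    toℚᵘ (toℚ i + toℚ j) ∎)
    where
    open ℚᵘP.≃-Reasoning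
    e : ∀ i j → (i ℤ.+ j) ℤ.* + 1 ≡ (i ℤ.* + 1 ℤ.+ j ℤ.* + 1) ℤ.* + 1
    e = ℤR.solve-∀

  toℚ-* : ∀ i j → toℚ (i ℤ.* j) ≡ toℚ i * toℚ j
  toℚ-* i j = toℚᵘ-injective (begin
    toℚᵘ (toℚ (i ℤ.* j)) ≈⟨ toℚᵘ-/ (i ℤ.* j) 1 ⟩
    ((i ℤ.* j) ℚᵘ./ 1) ≈⟨ ℚᵘ.*≡* refl ⟩
    (i ℚᵘ./ 1) ℚᵘ.* (j ℚᵘ./ 1) ≈⟨ ℚᵘP.*-cong (toℚᵘ-/ i 1) (toℚᵘ-/ j 1) ⟨
    toℚᵘ (toℚ i) ℚᵘ.* toℚᵘ (toℚ j) ≈⟨ toℚᵘ-homo-* (toℚ i) (toℚ j) ⟨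
    toℚᵘ (toℚ i * toℚ j) ∎)
    where open ℚᵘP.≃-Reasoning

  /-*-cancel : ∀ i d .{{_ : ℕ.NonZero d}} → (i / d) * toℚ (+ d) ≡ toℚ i
  /-*-cancel i d@(suc d-1) = toℚᵘ-injective (begin
    toℚᵘ ((i / d) * toℚ (+ d)) ≈⟨ toℚᵘ-homo-* (i / d) (toℚ (+ d)) ⟩
    toℚᵘ (i / d) ℚᵘ.* toℚᵘ (toℚ (+ d)) ≈⟨ ℚᵘP.*-cong (toℚᵘ-/ i d) (toℚᵘ-/ (+ d) 1) ⟩
    (i ℚᵘ./ d) ℚᵘ.* (+ d ℚᵘ./ 1) ≈⟨ ℚᵘ.*≡* (e i (+ d)) ⟩
    (i ℚᵘ./ 1) ≈⟨ toℚᵘ-/ i 1 ⟨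
    toℚᵘ (toℚ i) ∎)
    where
    open ℚᵘP.≃-Reasoning
    e : ∀ i d → i ℤ.* d ℤ.* + 1 ≡ i ℤ.* (d ℤ.* + 1)
    e = ℤR.solve-∀

  toℚ-mono-≤ : ∀ {i j} → i ℤ.≤ j → toℚ i ≤ toℚ j
  toℚ-mono-≤ {i} {j} i≤j = toℚᵘ-cancel-≤ (ℚᵘP.≤-respˡ-≃ (ℚᵘP.≃-sym (toℚᵘ-/ i 1)) (ℚᵘP.≤-respʳ-≃ (ℚᵘP.≃-sym (toℚᵘ-/ j 1))
    (ℚᵘ.*≤* (ℤP.*-monoʳ-≤-nonNeg (+ 1) i≤j))))

  toℚ-cancel-≤ : ∀ {i j} → toℚ i ≤ toℚ j → i ℤ.≤ j
  toℚ-cancel-≤ {i} {j} h with ℚᵘP.≤-respˡ-≃ (toℚᵘ-/ i 1) (ℚᵘP.≤-respʳ-≃ (toℚᵘ-/ j 1) (toℚᵘ-mono-≤ h))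
  ... | ℚᵘ.*≤* le = subst₂ ℤ._≤_ (ℤP.*-identityʳ i) (ℤP.*-identityʳ j) le

  toℚ-mono-< : ∀ {i j} → i ℤ.< j → toℚ i < toℚ j
  toℚ-mono-< {i} {j} i<j = ≰⇒> λ h → ℤP.<⇒≱ i<j (toℚ-cancel-≤ h)

  toℚ-cancel-< : ∀ {i j} → toℚ i < toℚ j → i ℤ.< j
  toℚ-cancel-< h = ℤP.≰⇒> λ j≤i → <-irrefl refl (<-≤-trans h (toℚ-mono-≤ j≤i))

-- Bounds for the Euler product

module Euler where

  open Rat
  open import Defs using (eulerFactor; partialProduct)
  open import Data.Nat as ℕ using (ℕ; zero; suc; z≤n)
  import Data.Nat.Properties as ℕP
  open import Data.Nat.Primality using (Prime; prime?)
  open import Data.Integer as ℤ using (ℤ; +_)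
  import Data.Integer.Properties as ℤP
  open import Data.Rational
  open import Data.Rational.Properties
  import Data.Rational.Unnormalised as ℚᵘ
  import Data.Rational.Unnormalised.Properties as ℚᵘP
  import Data.Integer.Tactic.RingSolver as ℤR
  open import Data.Product using (_×_; _,_; proj₁; proj₂)
  open import Relation.Nullary using (¬_; Dec; yes; no; contradiction)
  open import Relation.Nullary.Decidable using (_×-dec_)
  open import Relation.Binary.PropositionalEquality

  partialProduct-factor : ∀ n → 5 ℕ.≤ suc n → Prime (suc n) → partialProduct (suc n) ≡ partialProduct n * eulerFactor (suc n)
  partialProduct-factor n h pr with 5 ℕ.≤? suc n | prime? (suc n)
  ... | yes _ | yes _ = refl
  ... | yes _ | no ¬pr = contradiction pr ¬pr
  ... | no ¬h | _ = contradiction h ¬h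

  partialProduct-skip : ∀ n → ¬ (5 ℕ.≤ suc n × Prime (suc n)) → partialProduct (suc n) ≡ partialProduct n
  partialProduct-skip n h with 5 ℕ.≤? suc n | prime? (suc n)
  ... | yes a | yes b = contradiction (a , b) h
  ... | yes _ | no _ = refl
  ... | no _ | yes _ = refl
  ... | no _ | no _ = refl

  ≤-by : ∀ {i j} k → j ≡ i ℤ.+ + k → i ℤ.≤ j
  ≤-by {i} k refl = ℤP.i≤i+j i (+ k)

  module _ (m : ℕ) where
    private
      p = suc (suc m)
      e = eulerFactor p
      x = + m
      pZ = + 2 ℤ.+ x
      c = + (p ℕ.* p ℕ.* p)
      i = c ℤ.- + (2 ℕ.* p) ℤ.+ + 1

      c≡ : c ≡ pZ ℤ.* pZ ℤ.* pZ
      c≡ = trans (ℤP.pos-* (p ℕ.* p) p) (cong (ℤ._* + p) (ℤP.pos-* p p))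
      i≡ : i ≡ pZ ℤ.* pZ ℤ.* pZ ℤ.- + 2 ℤ.* pZ ℤ.+ + 1
      i≡ = cong₂ (λ u v → u ℤ.- v ℤ.+ + 1) c≡ (ℤP.pos-* 2 p)

    0≤eulerFactor : 0ℚ ≤ e
    0≤eulerFactor = toℚᵘ-cancel-≤ (ℚᵘP.≤-respʳ-≃ (ℚᵘP.≃-sym (toℚᵘ-/ i (p ℕ.* p ℕ.* p)))
      -- The witness is `p³ − 2p + 1` expanded at `p = m + 2`.
      (ℚᵘ.*≤* (≤-by (m ℕ.* m ℕ.* m ℕ.+ 6 ℕ.* (m ℕ.* m) ℕ.+ 10 ℕ.* m ℕ.+ 5)
        (trans (cong (ℤ._* + 1) i≡) (trans (pf x) (cong (ℤ._+_ (+ 0)) (sym nat)))))))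
      where
      nat : + (m ℕ.* m ℕ.* m ℕ.+ 6 ℕ.* (m ℕ.* m) ℕ.+ 10 ℕ.* m ℕ.+ 5) ≡ x ℤ.* x ℤ.* x ℤ.+ + 6 ℤ.* (x ℤ.* x) ℤ.+ + 10 ℤ.* x ℤ.+ + 5
      nat = trans
        (cong₂ (λ u v → u ℤ.+ v ℤ.+ + (10 ℕ.* m) ℤ.+ + 5)
          (trans (ℤP.pos-* (m ℕ.* m) m) (cong (ℤ._* x) (ℤP.pos-* m m)))
          (trans (ℤP.pos-* 6 (m ℕ.* m)) (cong (+ 6 ℤ.*_) (ℤP.pos-* m m))))
        (cong (λ w → x ℤ.* x ℤ.* x ℤ.+ + 6 ℤ.* (x ℤ.* x) ℤ.+ w ℤ.+ + 5) (ℤP.pos-* 10 m))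
      pf : ∀ x → (((+ 2 ℤ.+ x) ℤ.* (+ 2 ℤ.+ x) ℤ.* (+ 2 ℤ.+ x)) ℤ.- + 2 ℤ.* (+ 2 ℤ.+ x) ℤ.+ + 1) ℤ.* + 1
        ≡ + 0 ℤ.+ (x ℤ.* x ℤ.* x ℤ.+ + 6 ℤ.* (x ℤ.* x) ℤ.+ + 10 ℤ.* x ℤ.+ + 5)
      pf = ℤR.solve-∀

    eulerFactor≤1 : e ≤ 1ℚ
    eulerFactor≤1 = toℚᵘ-cancel-≤ (ℚᵘP.≤-respˡ-≃ (ℚᵘP.≃-sym (toℚᵘ-/ i (p ℕ.* p ℕ.* p)))
      (ℚᵘ.*≤* (≤-by (m ℕ.+ m ℕ.+ 3) (pf c x))))
      where
      pf : ∀ c x → + 1 ℤ.* c ≡ (c ℤ.- (+ 2 ℤ.+ x ℤ.+ (+ 2 ℤ.+ x ℤ.+ + 0)) ℤ.+ + 1) ℤ.* + 1 ℤ.+ (x ℤ.+ x ℤ.+ + 3)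
      pf = ℤR.solve-∀

    -- 1 − e = 2/p² − 1/p³ ≤ 2/(p − 1) − 2/p
    eulerFactor-defect : 1ℚ + (+ 2 / p) ≤ e + (+ 2 / suc m)
    eulerFactor-defect = toℚᵘ-cancel-≤ (ℚᵘP.≤-respˡ-≃ (ℚᵘP.≃-sym l) (ℚᵘP.≤-respʳ-≃ (ℚᵘP.≃-sym r)
      -- The witness is `p(3p − 1)`, the difference of the two sides after cross multiplication.
      (ℚᵘ.*≤* (≤-by ((2 ℕ.+ m) ℕ.* (5 ℕ.+ 3 ℕ.* m)) eq))))
      where
      l : toℚᵘ (1ℚ + (+ 2 / p)) ℚᵘ.≃ ℚᵘ.1ℚᵘ ℚᵘ.+ (+ 2 ℚᵘ./ p)
      l = ℚᵘP.≃-trans (toℚᵘ-homo-+ 1ℚ (+ 2 / p)) (ℚᵘP.+-cong {toℚᵘ 1ℚ} ℚᵘP.≃-refl (toℚᵘ-/ (+ 2) p))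
      r : toℚᵘ (e + (+ 2 / suc m)) ℚᵘ.≃ (i ℚᵘ./ (p ℕ.* p ℕ.* p)) ℚᵘ.+ (+ 2 ℚᵘ./ suc m)
      r = ℚᵘP.≃-trans (toℚᵘ-homo-+ e (+ 2 / suc m)) (ℚᵘP.+-cong (toℚᵘ-/ i (p ℕ.* p ℕ.* p)) (toℚᵘ-/ (+ 2) (suc m)))
      eq : (i ℤ.* + suc m ℤ.+ + 2 ℤ.* c) ℤ.* (+ 1 ℤ.* + p)
        ≡ (+ 1 ℤ.* + p ℤ.+ + 2 ℤ.* + 1) ℤ.* (c ℤ.* + suc m) ℤ.+ + ((2 ℕ.+ m) ℕ.* (5 ℕ.+ 3 ℕ.* m))
      eq = trans (cong₂ (λ u v → (v ℤ.* + suc m ℤ.+ + 2 ℤ.* u) ℤ.* (+ 1 ℤ.* + p)) c≡ i≡)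
        (trans (pf x) (cong₂ (λ u v → (+ 1 ℤ.* + p ℤ.+ + 2 ℤ.* + 1) ℤ.* (u ℤ.* + suc m) ℤ.+ v) (sym c≡)
          (sym (trans (ℤP.pos-* (2 ℕ.+ m) (5 ℕ.+ 3 ℕ.* m)) (cong (λ z → (+ 2 ℤ.+ x) ℤ.* (+ 5 ℤ.+ z)) (ℤP.pos-* 3 m))))))
        where
        pf : ∀ x → let p = + 2 ℤ.+ x ; s = + 1 ℤ.+ x ; c = p ℤ.* p ℤ.* p ; i = c ℤ.- + 2 ℤ.* p ℤ.+ + 1 in
          (i ℤ.* s ℤ.+ + 2 ℤ.* c) ℤ.* (+ 1 ℤ.* p)
          ≡ (+ 1 ℤ.* p ℤ.+ + 2 ℤ.* + 1) ℤ.* (c ℤ.* s) ℤ.+ (+ 2 ℤ.+ x) ℤ.* (+ 5 ℤ.+ + 3 ℤ.* x)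
        pf = ℤR.solve-∀

    2/-antitone : (+ 2 / p) ≤ (+ 2 / suc m)
    2/-antitone = toℚᵘ-cancel-≤ (ℚᵘP.≤-respˡ-≃ (ℚᵘP.≃-sym (toℚᵘ-/ (+ 2) p)) (ℚᵘP.≤-respʳ-≃ (ℚᵘP.≃-sym (toℚᵘ-/ (+ 2) (suc m)))
      (ℚᵘ.*≤* (≤-by 2 (pf x)))))
      where
      pf : ∀ x → + 2 ℤ.* (+ 2 ℤ.+ x) ≡ + 2 ℤ.* (+ 1 ℤ.+ x) ℤ.+ + 2
      pf = ℤR.solve-∀

  Factor : ℕ → Set
  Factor p = 5 ℕ.≤ p × Prime p

  factor? : ∀ p → Dec (Factor p)
  factor? p = (5 ℕ.≤? p) ×-dec prime? p

  private
    *-mono-unit : ∀ {x y} → 0ℚ ≤ x → x ≤ 1ℚ → 0ℚ ≤ y → y ≤ 1ℚ → (0ℚ ≤ x * y) × (x * y ≤ x)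
    *-mono-unit {x} {y} 0≤x x≤1 0≤y y≤1 =
      subst (_≤ x * y) (*-zeroʳ x) (*-monoˡ-≤-nonNeg x {{nonNegative 0≤x}} 0≤y) ,
      subst (x * y ≤_) (*-identityʳ x) (*-monoˡ-≤-nonNeg x {{nonNegative 0≤x}} y≤1)

  partialProduct-bounds : ∀ n → (0ℚ ≤ partialProduct n) × (partialProduct n ≤ 1ℚ)
  partialProduct-bounds zero = toℚ-mono-≤ {+ 0} {+ 1} (ℤ.+≤+ z≤n) , ≤-refl
  partialProduct-bounds (suc n) with partialProduct-bounds n
  partialProduct-bounds (suc zero) | ih = ih
  partialProduct-bounds (suc (suc m)) | 0≤ , ≤1 = go (factor? (suc (suc m)))
    where
    n = suc m
    go : Dec (Factor (suc n)) → (0ℚ ≤ partialProduct (suc n)) × (partialProduct (suc n) ≤ 1ℚ)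
    go (no ¬f) rewrite partialProduct-skip n ¬f = 0≤ , ≤1
    go (yes (h , pr)) rewrite partialProduct-factor n h pr =
      let (a , b) = *-mono-unit 0≤ ≤1 (0≤eulerFactor m) (eulerFactor≤1 m) in a , ≤-trans b ≤1

  -- A factor `E` lowers `P ≤ 1` by at most `1 − E ≤ 2/n − 2/(n + 1)`. Thus the products do not
  -- increase, while the products minus `2/n` do not decrease.
  partialProduct-step : ∀ m → let n = suc m in
    (partialProduct (suc n) ≤ partialProduct n) × (partialProduct n + (+ 2 / suc n) ≤ partialProduct (suc n) + (+ 2 / n))
  partialProduct-step m = go (factor? (suc n))
    where
    n = suc m
    P = partialProduct n
    E = eulerFactor (suc n)
    0≤P = proj₁ (partialProduct-bounds n)
    P≤1 = proj₂ (partialProduct-bounds n)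
    D = (+ 2 / n) - (+ 2 / suc n)
    0≤D : 0ℚ ≤ D
    0≤D = subst (_≤ D) (+-inverseʳ (+ 2 / suc n)) (+-monoˡ-≤ (- (+ 2 / suc n)) (2/-antitone m))
    1≤E+D : 1ℚ ≤ E + D
    1≤E+D = subst₂ _≤_ (trans (+-assoc 1ℚ (+ 2 / suc n) _) (trans (cong (_+_ 1ℚ) (+-inverseʳ (+ 2 / suc n))) (+-identityʳ 1ℚ)))
      (+-assoc E (+ 2 / n) _) (+-monoˡ-≤ (- (+ 2 / suc n)) (eulerFactor-defect m))
    PE+D : P ≤ P * E + D
    PE+D = begin
      P ≡⟨ *-identityʳ P ⟨
      P * 1ℚ ≤⟨ *-monoˡ-≤-nonNeg P {{nonNegative 0≤P}} 1≤E+D ⟩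
      P * (E + D) ≡⟨ *-distribˡ-+ P E D ⟩
      P * E + P * D ≤⟨ +-monoʳ-≤ (P * E) (*-monoʳ-≤-nonNeg D {{nonNegative 0≤D}} P≤1) ⟩
      P * E + 1ℚ * D ≡⟨ cong (_+_ (P * E)) (*-identityˡ D) ⟩
      P * E + D ∎
      where open ≤-Reasoning
    undo : (P * E + D) + (+ 2 / suc n) ≡ P * E + (+ 2 / n)
    undo = trans (+-assoc (P * E) D _) (cong (_+_ (P * E)) (trans (+-assoc (+ 2 / n) (- (+ 2 / suc n)) (+ 2 / suc n))
      (trans (cong (_+_ (+ 2 / n)) (+-inverseˡ (+ 2 / suc n))) (+-identityʳ (+ 2 / n)))))
    go : Dec (Factor (suc n)) → (partialProduct (suc n) ≤ P) × (P + (+ 2 / suc n) ≤ partialProduct (suc n) + (+ 2 / n))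
    go (no ¬f) rewrite partialProduct-skip n ¬f = ≤-refl , +-monoʳ-≤ P (2/-antitone m)
    go (yes (h , pr)) rewrite partialProduct-factor n h pr =
      proj₂ (*-mono-unit 0≤P P≤1 (0≤eulerFactor m) (eulerFactor≤1 m)) ,
      subst (P + (+ 2 / suc n) ≤_) undo (+-monoˡ-≤ (+ 2 / suc n) PE+D)

  -- Telescoping of `partialProduct-step`: beyond `M` the product loses at most `2/M`, uniformly in
  -- `k`. This effective Cauchy bound stands in for the value of the infinite product.
  partialProduct-tail : ∀ m k → let M = suc m in
    (partialProduct (k ℕ.+ M) ≤ partialProduct M) × (partialProduct M + (+ 2 / suc (k ℕ.+ m)) ≤ partialProduct (k ℕ.+ M) + (+ 2 / M))
  partialProduct-tail m zero = ≤-refl , ≤-refl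
  partialProduct-tail m (suc k) = ≤-trans (proj₁ step) (proj₁ ih) , (begin
    P + (+ 2 / suc (suc k ℕ.+ m)) ≡⟨ add P Z _ ⟩
    (P + (+ 2 / suc (k ℕ.+ m))) + (Y - Z) ≤⟨ +-monoˡ-≤ (Y - Z) (proj₂ ih) ⟩
    (P′ + (+ 2 / M)) + (Y - Z) ≡⟨ swp P′ (+ 2 / M) (Y - Z) ⟩
    (P′ + Y) - Z + (+ 2 / M) ≤⟨ +-monoˡ-≤ (+ 2 / M) (+-monoˡ-≤ (- Z) step′) ⟩
    (P″ + Z) - Z + (+ 2 / M) ≡⟨ cong (_+ (+ 2 / M)) (trans (+-assoc P″ Z (- Z)) (trans (cong (_+_ P″) (+-inverseʳ Z)) (+-identityʳ P″))) ⟩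
    P″ + (+ 2 / M) ∎)
    where
    open ≤-Reasoning
    M = suc m
    ih = partialProduct-tail m k
    step : (partialProduct (suc k ℕ.+ M) ≤ partialProduct (k ℕ.+ M)) × (partialProduct (k ℕ.+ M) + (+ 2 / suc (suc (k ℕ.+ m))) ≤ partialProduct (suc k ℕ.+ M) + (+ 2 / suc (k ℕ.+ m)))
    step = subst (λ n → (partialProduct (suc n) ≤ partialProduct n) × (partialProduct n + (+ 2 / suc (suc (k ℕ.+ m))) ≤ partialProduct (suc n) + (+ 2 / suc (k ℕ.+ m))))
      (sym (ℕP.+-suc k m)) (partialProduct-step (k ℕ.+ m))
    P = partialProduct M
    P′ = partialProduct (k ℕ.+ M)
    P″ = partialProduct (suc k ℕ.+ M)
    Y = + 2 / suc (suc (k ℕ.+ m))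
    Z = + 2 / suc (k ℕ.+ m)
    step′ : P′ + Y ≤ P″ + Z
    step′ = proj₂ step
    add : ∀ P Z Y → P + Y ≡ (P + Z) + (Y - Z)
    add P Z Y = sym (trans (+-assoc P Z (Y - Z)) (cong (_+_ P) (trans (+-comm Z (Y - Z)) (trans (+-assoc Y (- Z) Z) (trans (cong (_+_ Y) (+-inverseˡ Z)) (+-identityʳ Y))))))
    swp : ∀ P T U → (P + T) + (Y - Z) ≡ (P + Y) - Z + T
    swp P T U = trans (+-assoc P T (Y - Z)) (trans (cong (_+_ P) (+-comm T (Y - Z))) (trans (sym (+-assoc P (Y - Z) T)) (cong (_+ T) (sym (+-assoc P Y (- Z))))))

-- The sieve by squares of primes up to M

module Density where

  open Sums
  open Divs
  open Periodic
  open Local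
  open Rat
  open Euler
  open import Defs using (disc; toℚ; eulerFactor; partialProduct; constantApprox)
  open import Data.Nat as ℕ using (ℕ; zero; suc; s≤s; _≤_; _<_)
  import Data.Nat.Properties as ℕP
  import Data.Nat.Divisibility as ℕD
  open import Data.Nat.Coprimality using (Coprime; coprime?) renaming (sym to coprime-sym)
  open import Data.Nat.Primality using (Prime; prime[2])
  open import Data.Integer as ℤ using (ℤ; +_)
  import Data.Integer.Properties as ℤP
  open import Data.Integer.Divisibility.Signed
  open import Data.Rational as ℚ using (ℚ; _/_)
  import Data.Rational.Properties as ℚP
  import Data.Integer.Tactic.RingSolver as ℤR
  import Data.Nat.Tactic.RingSolver as ℕR
  open import Data.Product using (_×_; _,_)
  open import Data.Sum using (_⊎_; inj₁; inj₂)
  open import Relation.Nullary using (¬_; Dec; yes; no; contradiction)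
  open import Relation.Nullary.Decidable using (¬?; toWitness)
  open import Relation.Binary.PropositionalEquality

  ⟦⟧≡1⇒ : ∀ {P : Set} (d : Dec P) → ⟦ d ⟧ ≡ 1 → P
  ⟦⟧≡1⇒ (yes p) _ = p

  *≡1 : ∀ m n → m ℕ.* n ≡ 1 → m ≡ 1 × n ≡ 1
  *≡1 m n h = ℕP.m*n≡1⇒m≡1 m n h , ℕP.m*n≡1⇒n≡1 m n h

  Periodic₂-multiple : ∀ {Q f} → Periodic₂ Q f → ∀ m → Periodic₂ (m ℕ.* Q) f
  Periodic₂-multiple {Q} {f} (p₁ , p₂) m =
    (λ a b → Periodic-multiple {Q} {λ x → f x b} (λ x → p₁ x b) a m) , (λ a b → Periodic-multiple (p₂ a) b m)

  Periodic₂-* : ∀ {Q f g} → Periodic₂ Q f → Periodic₂ Q g → Periodic₂ Q (λ a b → f a b ℕ.* g a b)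
  Periodic₂-* (f₁ , f₂) (g₁ , g₂) = (λ a b → cong₂ ℕ._*_ (f₁ a b) (g₁ a b)) , (λ a b → cong₂ ℕ._*_ (f₂ a b) (g₂ a b))

  ι : ℕ → ℚ
  ι n = toℚ (+ n)

  ι-* : ∀ m n → ι (m ℕ.* n) ≡ ι m ℚ.* ι n
  ι-* m n = trans (cong toℚ (ℤP.pos-* m n)) (toℚ-* (+ m) (+ n))

  -- The hypothesis is the local count `N = p⁴ − 2p² + p` written without subtraction; its quotient
  -- by `p⁴` is the Euler factor.
  eulerFactor-scale : ∀ k N → let p = suc k ; q = p ℕ.* p in
    N ℕ.+ (q ℕ.+ q) ≡ q ℕ.* q ℕ.+ p → eulerFactor p ℚ.* ι (q ℕ.* q) ≡ ι N
  eulerFactor-scale k N hN = begin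
    e ℚ.* ι (q ℕ.* q) ≡⟨ cong (λ n → e ℚ.* ι n) (assoc p) ⟩
    e ℚ.* ι (p ℕ.* p ℕ.* p ℕ.* p) ≡⟨ cong (e ℚ.*_) (ι-* (p ℕ.* p ℕ.* p) p) ⟩
    e ℚ.* (ι c ℚ.* ι p) ≡⟨ ℚP.*-assoc e (ι c) (ι p) ⟨
    e ℚ.* ι c ℚ.* ι p ≡⟨ cong (ℚ._* ι p) (/-*-cancel i c) ⟩
    toℚ i ℚ.* ι p ≡⟨ toℚ-* i (+ p) ⟨
    toℚ (i ℤ.* + p) ≡⟨ cong toℚ count ⟩
    ι N ∎
    where
    open ≡-Reasoning
    p = suc k
    q = p ℕ.* p
    c = p ℕ.* p ℕ.* p
    e = eulerFactor p
    i = + c ℤ.- + (2 ℕ.* p) ℤ.+ + 1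
    assoc : ∀ p → p ℕ.* p ℕ.* (p ℕ.* p) ≡ p ℕ.* p ℕ.* p ℕ.* p
    assoc = ℕR.solve-∀
    two : ∀ p → p ℕ.* p ℕ.+ p ℕ.* p ≡ 2 ℕ.* p ℕ.* p
    two = ℕR.solve-∀
    inℤ : + N ℤ.+ + (2 ℕ.* p) ℤ.* + p ≡ + c ℤ.* + p ℤ.+ + p
    inℤ = trans (cong (ℤ._+_ (+ N)) (sym (trans (cong +_ (two p)) (ℤP.pos-* (2 ℕ.* p) p))))
      (trans (cong +_ (trans hN (cong (ℕ._+ p) (assoc p)))) (cong (ℤ._+ + p) (ℤP.pos-* c p)))
    lhs : ∀ c t p → (c ℤ.- t ℤ.+ + 1) ℤ.* p ≡ (c ℤ.* p ℤ.+ p) ℤ.- t ℤ.* p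
    lhs = ℤR.solve-∀
    rhs : ∀ n x → (n ℤ.+ x) ℤ.- x ≡ n
    rhs = ℤR.solve-∀
    count : i ℤ.* + p ≡ + N
    count = trans (lhs (+ c) (+ (2 ℕ.* p)) (+ p)) (trans (cong (ℤ._- (+ (2 ℕ.* p) ℤ.* + p)) (sym inℤ)) (rhs (+ N) (+ (2 ℕ.* p) ℤ.* + p)))

  -- The finite sieve as the later estimates see it: a 0/1 function modulo `Q` whose mean is the
  -- truncated constant. The primes 2 and 3 belong to it from the start and account for the factor
  -- 1/3. The field `coprime` lets the square of the next prime be adjoined. Completeness makes the
  -- sieved count an upper bound for the squarefree count, and soundness leaves only primes above
  -- `M` as obstructions.
  record Sieve (M : ℕ) : Set where
    field
      Q : ℕ
      Q≢0 : ℕ.NonZero Q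
      ind : ℤ → ℤ → ℕ
      periodic : Periodic₂ Q ind
      ind≤1 : ∀ a b → ind a b ≤ 1
      coprime : ∀ {p} → Prime p → 5 ≤ p → M < p → ¬ (+ p ∣ + Q)
      density : constantApprox M ℚ.* ι (Q ℕ.* Q) ≡ ι (Per₂ Q ind)
      sound : ∀ a b → ind a b ≡ 1 → ¬ (+ 4 ∣ disc a b) × ¬ (+ 9 ∣ disc a b) ×
                   (∀ p → Prime p → 5 ≤ p → p ≤ M → ¬ (+ (p ℕ.* p) ∣ disc a b))
      complete : ∀ a b → (∀ p → Prime p → ¬ (+ (p ℕ.* p) ∣ disc a b)) → ind a b ≡ 1

  *-≤1 : ∀ {m n} → m ≤ 1 → n ≤ 1 → m ℕ.* n ≤ 1
  *-≤1 = ℕP.*-mono-≤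

  private
    prime[3] : Prime 3
    prime[3] = toWitness {a? = prime? 3} _
      where open import Data.Nat.Primality using (prime?)

    coprime-4-9 : Coprime 4 9
    coprime-4-9 = toWitness {a? = coprime? 4 9} _

  private
    Q₀ : ℕ
    Q₀ = 9 ℕ.* 4

    ind₀ : ℤ → ℤ → ℕ
    ind₀ a b = notDivDisc 4 a b ℕ.* notDivDisc 9 a b

    periodic₀ : Periodic₂ Q₀ ind₀
    periodic₀ = Periodic₂-* {Q₀} {notDivDisc 4} {notDivDisc 9}
      (subst (λ m → Periodic₂ m (notDivDisc 4)) {9 ℕ.* 4} {Q₀} refl (Periodic₂-multiple {4} {notDivDisc 4} (notDivDisc-periodic 4) 9))
      (subst (λ m → Periodic₂ m (notDivDisc 9)) {4 ℕ.* 9} {Q₀} refl (Periodic₂-multiple {9} {notDivDisc 9} (notDivDisc-periodic 9) 4))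

    scale₀ : constantApprox 0 ℚ.* ι (Q₀ ℕ.* Q₀) ≡ ι 432
    scale₀ = refl

    -- Modulo 4 only the parity of `a` matters, and modulo 9 only whether 3 divides `b`. The
    -- proportions 1/2 and 2/3 multiply to 1/3.
    count₄ : Per₂ 4 (notDivDisc 4) ≡ 8
    count₄ = refl

    count₉ : Per₂ 9 (notDivDisc 9) ≡ 54
    count₉ = refl

    count₀ : Per₂ Q₀ ind₀ ≡ 432
    count₀ = trans (Per₂-* {Q = 4} {m = 9} {f = notDivDisc 4} {g = notDivDisc 9} coprime-4-9 (notDivDisc-periodic 4) (notDivDisc-periodic 9))
      (cong₂ ℕ._*_ count₄ count₉)

    density₀ : constantApprox 0 ℚ.* ι (Q₀ ℕ.* Q₀) ≡ ι (Per₂ Q₀ ind₀)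
    density₀ = trans scale₀ (cong ι (sym count₀))

    sound₀ : ∀ a b → ind₀ a b ≡ 1 → ¬ (+ 4 ∣ disc a b) × ¬ (+ 9 ∣ disc a b) ×
      (∀ p → Prime p → 5 ≤ p → p ≤ 0 → ¬ (+ (p ℕ.* p) ∣ disc a b))
    sound₀ a b h = let (h₄ , h₉) = *≡1 (notDivDisc 4 a b) (notDivDisc 9 a b) h in
        ⟦⟧≡1⇒ (¬? (+ 4 ∣? disc a b)) h₄ , ⟦⟧≡1⇒ (¬? (+ 9 ∣? disc a b)) h₉ ,
        λ p _ 5≤p p≤0 → contradiction (ℕP.≤-trans 5≤p p≤0) λ ()

    complete₀ : ∀ a b → (∀ p → Prime p → ¬ (+ (p ℕ.* p) ∣ disc a b)) → ind₀ a b ≡ 1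
    complete₀ a b h = cong₂ ℕ._*_ (⟦⟧-yes (¬? (+ 4 ∣? disc a b)) (h 2 prime[2])) (⟦⟧-yes (¬? (+ 9 ∣? disc a b)) (h 3 prime[3]))

    coprime₀ : ∀ {p} → Prime p → 5 ≤ p → 0 < p → ¬ (+ p ∣ + Q₀)
    coprime₀ pr 5≤p _ = ∤-* pr 5≤p (+ 9) (+ 4) (∤-* pr 5≤p (+ 3) (+ 3) (∤3 pr 5≤p) (∤3 pr 5≤p)) (∤4 pr 5≤p)

  sieve₀ : Sieve 0
  sieve₀ = record
    { Q = Q₀
    ; Q≢0 = _
    ; ind = ind₀
    ; periodic = periodic₀
    ; ind≤1 = λ a b → *-≤1 (⟦⟧≤1 (¬? (+ 4 ∣? disc a b))) (⟦⟧≤1 (¬? (+ 9 ∣? disc a b)))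
    ; coprime = coprime₀
    ; density = density₀
    ; sound = sound₀
    ; complete = complete₀
    }

  module _ {M : ℕ} (S : Sieve M) where
    open Sieve S

    module _ (5≤p : 5 ≤ suc M) (pr : Prime (suc M)) where
      private
        p q Q′ N : ℕ
        p = suc M
        q = p ℕ.* p
        Q′ = q ℕ.* Q
        N = Per₂ q (notDivDisc q)

        ind′ : ℤ → ℤ → ℕ
        ind′ a b = ind a b ℕ.* notDivDisc q a b

        Q⊥q : Coprime Q q
        Q⊥q = coprime-sym (prime²-coprime pr λ d → coprime pr 5≤p ℕP.≤-refl (∣ᵤ⇒∣ d))

        periodic′ : Periodic₂ Q′ ind′
        periodic′ = Periodic₂-* {Q′} {ind} {notDivDisc q}
          (Periodic₂-multiple {Q} {ind} periodic q)
          (subst (λ m → Periodic₂ m (notDivDisc q)) (ℕP.*-comm Q q) (Periodic₂-multiple {q} {notDivDisc q} (notDivDisc-periodic q) Q))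

        coprime′ : ∀ {r} → Prime r → 5 ≤ r → p < r → ¬ (+ r ∣ + Q′)
        coprime′ {r} prr 5≤r p<r = subst (λ z → ¬ (+ r ∣ z)) (sym (ℤP.pos-* q Q))
          (∤-* prr 5≤r (+ q) (+ Q)
            (λ d → ℕP.<⇒≱ p<r (ℕD.∣⇒≤ (∣⇒∣ᵤ (prime-∣-square prr (+ p) (subst (+ r ∣_) (ℤP.pos-* p p) d)))))
            (coprime prr 5≤r (ℕP.<-trans (ℕP.n<1+n M) p<r)))

        count′ : Per₂ Q′ ind′ ≡ Per₂ Q ind ℕ.* N
        count′ = Per₂-* {Q = Q} {m = q} {f = ind} {g = notDivDisc q} Q⊥q periodic (notDivDisc-periodic q)

        sq : ∀ q Q → q ℕ.* Q ℕ.* (q ℕ.* Q) ≡ Q ℕ.* Q ℕ.* (q ℕ.* q)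
        sq = ℕR.solve-∀
        rearrange : ∀ t P e x y → t ℚ.* (P ℚ.* e) ℚ.* (x ℚ.* y) ≡ (t ℚ.* P ℚ.* x) ℚ.* (e ℚ.* y)
        rearrange = solve 5 (λ t P e x y → (t :* (P :* e)) :* (x :* y) := (t :* P :* x) :* (e :* y)) refl
          where
          open import Data.Rational.Solver
          open +-*-Solver

        density′ : constantApprox (suc M) ℚ.* ι (Q′ ℕ.* Q′) ≡ ι (Per₂ Q′ ind′)
        density′ = begin
          third ℚ.* partialProduct (suc M) ℚ.* ι (Q′ ℕ.* Q′)
            ≡⟨ cong₂ (λ u v → third ℚ.* u ℚ.* v) (partialProduct-factor M 5≤p pr) (trans (cong ι (sq q Q)) (ι-* (Q ℕ.* Q) (q ℕ.* q))) ⟩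
          third ℚ.* (P ℚ.* e) ℚ.* (ι (Q ℕ.* Q) ℚ.* ι (q ℕ.* q))
            ≡⟨ rearrange third P e (ι (Q ℕ.* Q)) (ι (q ℕ.* q)) ⟩
          (third ℚ.* P ℚ.* ι (Q ℕ.* Q)) ℚ.* (e ℚ.* ι (q ℕ.* q))
            ≡⟨ cong₂ ℚ._*_ density (eulerFactor-scale M N (local-count′ pr 5≤p)) ⟩
          ι (Per₂ Q ind) ℚ.* ι N
            ≡⟨ ι-* (Per₂ Q ind) N ⟨
          ι (Per₂ Q ind ℕ.* N)
            ≡⟨ cong ι count′ ⟨
          ι (Per₂ Q′ ind′) ∎
          where
          open ≡-Reasoning
          e = eulerFactor p
          third = + 1 / 3
          P = partialProduct M

        last : ∀ a b → notDivDisc q a b ≡ 1 → (∀ r → Prime r → 5 ≤ r → r ≤ M → ¬ (+ (r ℕ.* r) ∣ disc a b)) →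
          ∀ r → Prime r → 5 ≤ r → r < suc M ⊎ r ≡ suc M → ¬ (+ (r ℕ.* r) ∣ disc a b)
        last a b h s r prr 5≤r (inj₁ (s≤s r≤M)) = s r prr 5≤r r≤M
        last a b h s r prr 5≤r (inj₂ refl) = ⟦⟧≡1⇒ (¬? (+ q ∣? disc a b)) h

        sound′ : ∀ a b → ind′ a b ≡ 1 → ¬ (+ 4 ∣ disc a b) × ¬ (+ 9 ∣ disc a b) ×
          (∀ r → Prime r → 5 ≤ r → r ≤ p → ¬ (+ (r ℕ.* r) ∣ disc a b))
        sound′ a b h = let (h₁ , h₂) = *≡1 (ind a b) (notDivDisc q a b) h
                           (s₄ , s₉ , s) = sound a b h₁ in
          s₄ , s₉ , λ r prr 5≤r r≤p → last a b h₂ s r prr 5≤r (ℕP.m≤n⇒m<n∨m≡n r≤p)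

      -- Since `p` does not divide `Q`, the counts over a period multiply, and the density gains
      -- exactly one Euler factor.
      sieve-factor : Sieve (suc M)
      sieve-factor = record
        { Q = Q′
        ; Q≢0 = ℕP.m*n≢0 q Q {{ℕP.m*n≢0 p p}} {{Q≢0}}
        ; ind = ind′
        ; periodic = periodic′
        ; ind≤1 = λ a b → *-≤1 (ind≤1 a b) (⟦⟧≤1 (¬? (+ q ∣? disc a b)))
        ; coprime = coprime′
        ; density = density′
        ; sound = sound′
        ; complete = λ a b h → cong₂ ℕ._*_ (complete a b h) (⟦⟧-yes (¬? (+ q ∣? disc a b)) (h p pr))
        }

    sieve-skip : ¬ Factor (suc M) → Sieve (suc M)
    sieve-skip ¬f = record
      { Q = Q
      ; Q≢0 = Q≢0
      ; ind = ind
      ; periodic = periodic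
      ; ind≤1 = ind≤1
      ; coprime = λ pr 5≤p M<p → coprime pr 5≤p (ℕP.<-trans (ℕP.n<1+n M) M<p)
      ; density = trans (cong (λ P → (+ 1 / 3) ℚ.* P ℚ.* ι (Q ℕ.* Q)) (partialProduct-skip M ¬f)) density
      ; sound = λ a b h → let (s₄ , s₉ , s) = sound a b h in
          s₄ , s₉ , λ r prr 5≤r r≤p → last a b s r prr 5≤r (ℕP.m≤n⇒m<n∨m≡n r≤p)
      ; complete = complete
      }
      where
      last : ∀ a b → (∀ r → Prime r → 5 ≤ r → r ≤ M → ¬ (+ (r ℕ.* r) ∣ disc a b)) →
        ∀ r → Prime r → 5 ≤ r → r < suc M ⊎ r ≡ suc M → ¬ (+ (r ℕ.* r) ∣ disc a b)
      last a b s r prr 5≤r (inj₁ (s≤s r≤M)) = s r prr 5≤r r≤M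
      last a b s r prr 5≤r (inj₂ refl) = contradiction (5≤r , prr) ¬f

  sieve : ∀ M → Sieve M
  sieve zero = sieve₀
  sieve (suc M) = go (factor? (suc M))
    where
    go : Dec (Factor (suc M)) → Sieve (suc M)
    go (yes (5≤p , pr)) = sieve-factor (sieve M) 5≤p pr
    go (no ¬f) = sieve-skip (sieve M) ¬f

-- Reduction of plane lattices

module Gauss where

  open import Data.Nat as ℕ using (ℕ; zero; suc; z≤n; _≤_; _<_; _⊔_)
  import Data.Nat.Properties as ℕP
  open import Data.Nat.Induction using (<-wellFounded; Acc; acc)
  open import Data.Integer using (ℤ; +_; -[1+_]; _+_; _*_; _-_; -_; ∣_∣; _⊖_)
  import Data.Integer.Properties as ℤP
  open import Data.Integer.DivMod using (_%ℕ_; _/ℕ_; n%ℕd<d; a≡a%ℕn+[a/ℕn]*n)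
  open import Data.Integer.Tactic.RingSolver using (solve-∀)
  import Data.Nat.Tactic.RingSolver as ℕR
  open import Data.Product using (_,_; ∃-syntax)
  open import Data.Sum using (_⊎_; inj₁; inj₂)
  open import Relation.Nullary using (yes; no)
  open import Relation.Binary.PropositionalEquality

  private
    round⁺ : ∀ n x → ∃[ k ] 2 ℕ.* ∣ x - k * + suc n ∣ ≤ suc n
    round⁺ n x = go (ℕP.≤-total (2 ℕ.* ρ) d)
      where
      d = suc n
      ρ = x %ℕ d
      q = x /ℕ d
      x≡ : x ≡ + ρ + q * + d
      x≡ = a≡a%ℕn+[a/ℕn]*n x d
      e₁ : ∀ ρ z → ρ + z - z ≡ ρ
      e₁ = solve-∀
      e₂ : ∀ ρ q d → ρ + q * d - (+ 1 + q) * d ≡ ρ - d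
      e₂ = solve-∀
      go : 2 ℕ.* ρ ≤ d ⊎ d ≤ 2 ℕ.* ρ → ∃[ k ] 2 ℕ.* ∣ x - k * + d ∣ ≤ d
      go (inj₁ h) = q , subst (λ z → 2 ℕ.* ∣ z ∣ ≤ d) (sym (trans (cong (_- q * + d) x≡) (e₁ (+ ρ) (q * + d)))) h
      go (inj₂ h) = + 1 + q , subst (λ z → 2 ℕ.* ∣ z ∣ ≤ d)
        (sym (trans (cong (_- (+ 1 + q) * + d) x≡) (trans (e₂ (+ ρ) q (+ d)) (ℤP.m-n≡m⊖n ρ d))))
        (subst (λ z → 2 ℕ.* z ≤ d) (sym (ℤP.∣⊖∣-≤ ρ≤d)) (begin
          2 ℕ.* (d ℕ.∸ ρ) ≡⟨ ℕP.*-distribˡ-∸ 2 d ρ ⟩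
          2 ℕ.* d ℕ.∸ 2 ℕ.* ρ ≤⟨ ℕP.∸-monoʳ-≤ (2 ℕ.* d) h ⟩
          2 ℕ.* d ℕ.∸ d ≡⟨ trans (cong (λ z → d ℕ.+ z ℕ.∸ d) (ℕP.+-identityʳ d)) (ℕP.m+n∸n≡m d d) ⟩
          d ∎))
        where
        open ℕP.≤-Reasoning
        ρ≤d : ρ ≤ d
        ρ≤d = ℕP.<⇒≤ (n%ℕd<d x d)

  round : ∀ w x → w ≡ + 0 ⊎ (∃[ k ] 2 ℕ.* ∣ x - k * w ∣ ≤ ∣ w ∣)
  round (+ zero) x = inj₁ refl
  round (+ suc n) x = inj₂ (round⁺ n x)
  round -[1+ n ] x = let (k , h) = round⁺ n x in
    inj₂ (- k , subst (λ z → 2 ℕ.* ∣ z ∣ ≤ suc n) (e x k (+ suc n)) h)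
    where
    e : ∀ x k d → x - k * d ≡ x - (- k) * (- d)
    e = solve-∀

  private
    -- The variables are absolute coordinates of two vectors, `Δ` their determinant and `w₁` the
    -- norm of the first. If the second norm were `w₂`, then `2w₂ ≤ w₁ ≤ w₂` would make everything
    -- vanish. So it is `v₂`, and `2w₂v₁ ≤ w₁v₂` says that the cross term is at most half of the
    -- main term.
    product-bound : ∀ {w₁ v₁ w₂ v₂ Δ} → v₁ ≤ w₁ → 2 ℕ.* w₂ ≤ w₁ → w₁ ≤ w₂ ⊔ v₂ → w₁ ℕ.* v₂ ≤ Δ ℕ.+ w₂ ℕ.* v₁ →
      w₁ ℕ.* (w₂ ⊔ v₂) ≤ 2 ℕ.* Δ
    product-bound {w₁} {v₁} {w₂} {v₂} {Δ} v₁≤w₁ 2w₂≤w₁ w₁≤ h with ℕP.⊔-sel w₂ v₂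
    ... | inj₁ eq = ℕP.≤-trans (ℕP.≤-reflexive (cong (ℕ._* (w₂ ⊔ v₂)) w₁≡0)) z≤n
      where
      w₂≡0 : w₂ ≡ 0
      w₂≡0 = ℕP.n≤0⇒n≡0 (ℕP.+-cancelˡ-≤ w₂ _ _ (begin
        w₂ ℕ.+ w₂ ≡⟨ cong (w₂ ℕ.+_) (sym (ℕP.+-identityʳ w₂)) ⟩
        2 ℕ.* w₂ ≤⟨ 2w₂≤w₁ ⟩
        w₁ ≤⟨ w₁≤ ⟩
        w₂ ⊔ v₂ ≡⟨ eq ⟩
        w₂ ≡⟨ ℕP.+-identityʳ w₂ ⟨
        w₂ ℕ.+ 0 ∎))
        where open ℕP.≤-Reasoning
      w₁≡0 : w₁ ≡ 0
      w₁≡0 = ℕP.n≤0⇒n≡0 (ℕP.≤-trans w₁≤ (ℕP.≤-reflexive (trans eq w₂≡0)))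
    ... | inj₂ eq rewrite eq = ℕP.+-cancelʳ-≤ (w₁ ℕ.* v₂) _ _ (begin
        w₁ ℕ.* v₂ ℕ.+ w₁ ℕ.* v₂ ≡⟨ cong (w₁ ℕ.* v₂ ℕ.+_) (sym (ℕP.+-identityʳ _)) ⟩
        2 ℕ.* (w₁ ℕ.* v₂) ≤⟨ ℕP.*-monoʳ-≤ 2 h ⟩
        2 ℕ.* (Δ ℕ.+ w₂ ℕ.* v₁) ≡⟨ e Δ w₂ v₁ ⟩
        2 ℕ.* Δ ℕ.+ (2 ℕ.* w₂) ℕ.* v₁ ≤⟨ ℕP.+-monoʳ-≤ (2 ℕ.* Δ) (ℕP.*-mono-≤ 2w₂≤w₁ (ℕP.≤-trans v₁≤w₁ w₁≤)) ⟩
        2 ℕ.* Δ ℕ.+ w₁ ℕ.* v₂ ∎)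
      where
      open ℕP.≤-Reasoning
      e : ∀ Δ w v → 2 ℕ.* (Δ ℕ.+ w ℕ.* v) ≡ 2 ℕ.* Δ ℕ.+ (2 ℕ.* w) ℕ.* v
      e = ℕR.solve-∀

  -- Lagrange–Gauss reduction of the lattice { (N y , p x + r y) } for the supremum norm.

  module _ (N p : ℕ) (r : ℤ) where

    Y : ℤ → ℤ
    Y y = + N * y

    Z : ℤ → ℤ → ℤ
    Z x y = + p * x + r * y

    ν : ℤ → ℤ → ℕ
    ν x y = ∣ Y y ∣ ⊔ ∣ Z x y ∣

    record Reduced : Set where
      field
        a b c d : ℤ
        det : a * d - b * c ≡ + 1
        ordered : ν a b ≤ ν c d
        bound : ν a b ℕ.* ν c d ≤ 2 ℕ.* (N ℕ.* p)

    private
      cross : ∀ a b c d → a * d - b * c ≡ + 1 → Z a b * Y d - Y b * Z c d ≡ + (N ℕ.* p)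
      cross a b c d det = trans (e (+ N) (+ p) r a b c d) (trans (cong (+ N * + p *_) det) (trans (ℤP.*-identityʳ _) (sym (ℤP.pos-* N p))))
        where
        e : ∀ N p r a b c d → (p * a + r * b) * (N * d) - (N * b) * (p * c + r * d) ≡ N * p * (a * d - b * c)
        e = solve-∀

      -- Only the coordinate in which the first vector attains its norm is reduced, by the nearest
      -- multiple. If the resulting vector is not shorter than the first, `product-bound` applies to
      -- the new basis.
      choose : ∀ a b c d → a * d - b * c ≡ + 1 →
        ∃[ k ] (ν a b ≤ ν (c - k * a) (d - k * b) → ν a b ℕ.* ν (c - k * a) (d - k * b) ≤ 2 ℕ.* (N ℕ.* p))
      choose a b c d det = go (ℕP.≤-total ∣ Y b ∣ ∣ Z a b ∣)
        where
        det′ : ∀ k → a * (d - k * b) - b * (c - k * a) ≡ + 1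
        det′ k = trans (e a b c d k) det
          where
          e : ∀ a b c d k → a * (d - k * b) - b * (c - k * a) ≡ a * d - b * c
          e = solve-∀
        go : ∣ Y b ∣ ≤ ∣ Z a b ∣ ⊎ ∣ Z a b ∣ ≤ ∣ Y b ∣ →
          ∃[ k ] (ν a b ≤ ν (c - k * a) (d - k * b) → ν a b ℕ.* ν (c - k * a) (d - k * b) ≤ 2 ℕ.* (N ℕ.* p))
        go (inj₁ Y≤Z) with round (Z a b) (Z c d)
        -- A vanishing dominant coordinate means that the first vector has norm 0.
        ... | inj₁ Z≡0 = + 0 , λ _ → subst (λ n → n ℕ.* ν (c - + 0 * a) (d - + 0 * b) ≤ 2 ℕ.* (N ℕ.* p))
              (sym (trans (ℕP.m≤n⇒m⊔n≡n Y≤Z) (cong ∣_∣ Z≡0))) z≤n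
        ... | inj₂ (k , h) = k , λ le →
              let c′ = c - k * a ; d′ = d - k * b in
              subst₂ (λ u v → u ℕ.* v ≤ 2 ℕ.* (N ℕ.* p)) (sym ν₁) (ℕP.⊔-comm ∣ Z c′ d′ ∣ ∣ Y d′ ∣)
                (product-bound {∣ Z a b ∣} {∣ Y b ∣} {∣ Z c′ d′ ∣} {∣ Y d′ ∣} Y≤Z
                  (subst (λ z → 2 ℕ.* ∣ z ∣ ≤ ∣ Z a b ∣) (e k) h)
                  (subst₂ _≤_ ν₁ (ℕP.⊔-comm ∣ Y d′ ∣ ∣ Z c′ d′ ∣) le)
                  (subst₂ (λ u v → u ≤ N ℕ.* p ℕ.+ v) (ℤP.abs-* (Z a b) (Y d′)) (trans (ℤP.abs-* (Y b) (Z c′ d′)) (ℕP.*-comm ∣ Y b ∣ _))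
                    (triangle (Z a b * Y d′) (Y b * Z c′ d′) (cross a b c′ d′ (det′ k)))))
          where
          ν₁ : ν a b ≡ ∣ Z a b ∣
          ν₁ = ℕP.m≤n⇒m⊔n≡n Y≤Z
          e : ∀ k → Z c d - k * Z a b ≡ Z (c - k * a) (d - k * b)
          e k = e′ (+ p) r a b c d k
            where
            e′ : ∀ p r a b c d k → (p * c + r * d) - k * (p * a + r * b) ≡ p * (c - k * a) + r * (d - k * b)
            e′ = solve-∀
          triangle : ∀ x y {m} → x - y ≡ + m → ∣ x ∣ ≤ m ℕ.+ ∣ y ∣
          triangle x y {m} eq = ℕP.≤-trans (ℕP.≤-reflexive (cong ∣_∣ (trans (e′ x y) (cong (_+ y) eq)))) (ℤP.∣i+j∣≤∣i∣+∣j∣ (+ m) y)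
            where
            e′ : ∀ x y → x ≡ x - y + y
            e′ = solve-∀
        go (inj₂ Z≤Y) with round (Y b) (Y d)
        ... | inj₁ Y≡0 = + 0 , λ _ → subst (λ n → n ℕ.* ν (c - + 0 * a) (d - + 0 * b) ≤ 2 ℕ.* (N ℕ.* p))
              (sym (trans (ℕP.m≥n⇒m⊔n≡m Z≤Y) (cong ∣_∣ Y≡0))) z≤n
        ... | inj₂ (k , h) = k , λ le →
              let c′ = c - k * a ; d′ = d - k * b in
              subst (λ u → u ℕ.* ν c′ d′ ≤ 2 ℕ.* (N ℕ.* p)) (sym ν₁)
                (product-bound {∣ Y b ∣} {∣ Z a b ∣} {∣ Y d′ ∣} {∣ Z c′ d′ ∣} Z≤Y
                  (subst (λ z → 2 ℕ.* ∣ z ∣ ≤ ∣ Y b ∣) (e k) h)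
                  (subst (_≤ ν c′ d′) ν₁ le)
                  (subst₂ (λ u v → u ≤ N ℕ.* p ℕ.+ v) (ℤP.abs-* (Y b) (Z c′ d′)) (trans (ℤP.abs-* (Z a b) (Y d′)) (ℕP.*-comm ∣ Z a b ∣ _))
                    (triangle (Z a b * Y d′) (Y b * Z c′ d′) (cross a b c′ d′ (det′ k)))))
          where
          ν₁ : ν a b ≡ ∣ Y b ∣
          ν₁ = ℕP.m≥n⇒m⊔n≡m Z≤Y
          e : ∀ k → Y d - k * Y b ≡ Y (d - k * b)
          e k = e′ (+ N) b d k
            where
            e′ : ∀ N b d k → N * d - k * (N * b) ≡ N * (d - k * b)
            e′ = solve-∀
          triangle : ∀ x y {m} → x - y ≡ + m → ∣ y ∣ ≤ m ℕ.+ ∣ x ∣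
          triangle x y {m} eq = ℕP.≤-trans (ℕP.≤-reflexive (trans (cong ∣_∣ (trans (e′ x y) (cong (λ z → - z + x) eq))) refl))
            (ℕP.≤-trans (ℤP.∣i+j∣≤∣i∣+∣j∣ (- (+ m)) x) (ℕP.≤-reflexive (cong (ℕ._+ ∣ x ∣) (ℤP.∣-i∣≡∣i∣ (+ m)))))
            where
            e′ : ∀ x y → y ≡ - (x - y) + x
            e′ = solve-∀

      reduce : ∀ a b c d → a * d - b * c ≡ + 1 → Acc _<_ (ν a b) → Reduced
      reduce a b c d det (acc rec) with choose a b c d det
      ... | k , bnd with ν (c - k * a) (d - k * b) ℕP.<? ν a b
      -- The shorter vector moves to the front, so the descent is on its norm; the change of sign
      -- keeps the determinant equal to 1.
      ... | yes lt = reduce (c - k * a) (d - k * b) (- a) (- b) (trans (e a b c d k) det) (rec lt)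
        where
        e : ∀ a b c d k → (c - k * a) * (- b) - (d - k * b) * (- a) ≡ a * d - b * c
        e = solve-∀
      ... | no ≮ = record
        { a = a ; b = b ; c = c - k * a ; d = d - k * b
        ; det = trans (e a b c d k) det ; ordered = ℕP.≮⇒≥ ≮ ; bound = bnd (ℕP.≮⇒≥ ≮) }
        where
        e : ∀ a b c d k → a * (d - k * b) - b * (c - k * a) ≡ a * d - b * c
        e = solve-∀

    reduced : Reduced
    reduced = reduce (+ 1) (+ 0) (+ 0) (+ 1) refl (<-wellFounded _)

-- Counting integer vectors by the product of their entries

module Tuples where

  open Sums
  open import Data.Nat
  open import Data.Nat.Properties
  open import Data.Nat.DivMod using (_/_; m/n*n≤m; /-monoˡ-≤; /-monoʳ-≤; m*n/n≡m; m≥n⇒m/n>0; n/1≡n)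
  open import Data.Integer as ℤ using (ℤ; +_; -[1+_])
  open import Data.Nat.Tactic.RingSolver using (solve-∀)
  open import Data.Vec using (Vec; []; _∷_)
  open import Relation.Binary.PropositionalEquality hiding ([_])

  -- This is max(1, |c|), so that a zero entry does not annihilate the weight. The outer `suc` makes
  -- it visibly nonzero, as a divisor has to be.
  size : ℤ → ℕ
  size c = suc (pred (1 ⊔ ℤ.∣ c ∣))

  weight : ∀ {k} → Vec ℤ k → ℕ
  weight [] = 1
  weight (c ∷ v) = size c * weight v

  ∣c∣≤size : ∀ c → ℤ.∣ c ∣ ≤ size c
  ∣c∣≤size (+ zero) = z≤n
  ∣c∣≤size (+ suc n) = ≤-refl
  ∣c∣≤size -[1+ n ] = ≤-refl

  weight≥1 : ∀ {k} (v : Vec ℤ k) → 1 ≤ weight v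
  weight≥1 [] = ≤-refl
  weight≥1 (c ∷ v) = *-mono-≤ {1} {size c} {1} {weight v} (s≤s z≤n) (weight≥1 v)

  -- Sum over the integer vectors of weight at most T.

  ΣT : ∀ k → ℕ → (Vec ℤ k → ℕ) → ℕ
  ΣT zero T F = F []
  ΣT (suc k) T F = Box T (λ c → ΣT k (T / size c) (λ v → F (c ∷ v)))

  ΣT-mono : ∀ k T {F G} → (∀ v → F v ≤ G v) → ΣT k T F ≤ ΣT k T G
  ΣT-mono zero T h = h []
  ΣT-mono (suc k) T h = Box-mono T λ c _ → ΣT-mono k (T / size c) λ v → h (c ∷ v)

  ΣT-* : ∀ k T B F → ΣT k T (λ v → B * F v) ≡ B * ΣT k T F
  ΣT-* zero T B F = refl
  ΣT-* (suc k) T B F = trans (Box-cong T λ c → ΣT-* k (T / size c) B (λ v → F (c ∷ v))) (Σ-* (suc (T + T)) B _)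

  ΣT-swap : ∀ k T s L (F : ℤ → Vec ℤ k → ℕ) → W s L (λ a → ΣT k T (F a)) ≡ ΣT k T (λ v → W s L (λ a → F a v))
  ΣT-swap zero T s L F = refl
  ΣT-swap (suc k) T s L F = trans (Σ-swap L (suc (T + T)) _) (Box-cong T λ c → ΣT-swap k (T / size c) s L (λ a v → F a (c ∷ v)))

  ΣT-term : ∀ k T F v → weight v ≤ T → F v ≤ ΣT k T F
  ΣT-term zero T F [] _ = ≤-refl
  ΣT-term (suc k) T F (c ∷ v) h = ≤-trans
    (ΣT-term k (T / size c) (λ v → F (c ∷ v)) v w≤)
    (Box-term T (λ c → ΣT k (T / size c) (λ v → F (c ∷ v))) c c≤)
    where
    c≤ : ℤ.∣ c ∣ ≤ T
    c≤ = ≤-trans (∣c∣≤size c) (≤-trans (≤-trans (≤-reflexive (sym (*-identityʳ (size c)))) (*-monoʳ-≤ (size c) (weight≥1 v))) h)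
    w≤ : weight v ≤ T / size c
    w≤ = ≤-trans (≤-reflexive (sym (m*n/n≡m (weight v) (size c)))) (/-monoˡ-≤ (size c) (≤-trans (≤-reflexive (*-comm (weight v) (size c))) h))

  Box-∣∣ : ∀ T g → Box T (λ c → g ℤ.∣ c ∣) ≤ 2 * Σ< (suc T) g
  Box-∣∣ zero g = ≤-trans (m≤m+n _ _) (≤-reflexive (cong (_+_ (g 0)) (sym (+-identityʳ _))))
  Box-∣∣ (suc T) g = ≤-trans (≤-reflexive (Box-suc T (λ c → g ℤ.∣ c ∣)))
    (≤-trans (+-monoˡ-≤ (g (suc T)) (+-monoʳ-≤ (g (suc T)) (Box-∣∣ T g))) (≤-reflexive (e (g (suc T)) (Σ< (suc T) g))))
    where
    e : ∀ x s → x + 2 * s + x ≡ 2 * (s + x)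
    e = solve-∀

  private
    h : ℕ → ℕ → ℕ
    h T x = T / suc (pred (1 ⊔ x))

  -- Dyadic blocks: each of the `2 ^ j` indices starting at `2 ^ j` contributes at most `T / 2 ^ j`,
  -- hence each block at most `T`.
  harmonic : ∀ T j → Σ< (2 ^ j) (h T) ≤ suc j * T
  harmonic T zero = ≤-reflexive (trans (n/1≡n T) (sym (*-identityˡ T)))
  harmonic T (suc j) = begin
    Σ< (2 ^ j + (2 ^ j + 0)) (h T) ≡⟨ cong (λ n → Σ< (2 ^ j + n) (h T)) (+-identityʳ (2 ^ j)) ⟩
    Σ< (2 ^ j + 2 ^ j) (h T) ≡⟨ Σ-split (2 ^ j) (2 ^ j) (h T) ⟩
    Σ< (2 ^ j) (h T) + Σ< (2 ^ j) (λ i → h T (2 ^ j + i)) ≤⟨ +-mono-≤ (harmonic T j) (Σ-≤const (2 ^ j) (T / P) λ i _ → block i) ⟩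
    suc j * T + 2 ^ j * (T / P) ≤⟨ +-monoʳ-≤ (suc j * T) (≤-trans (≤-reflexive (trans (cong (_* (T / P)) (sym P≡)) (*-comm P (T / P)))) (m/n*n≤m T P)) ⟩
    suc j * T + T ≡⟨ +-comm (suc j * T) T ⟩
    suc (suc j) * T ∎
    where
    open ≤-Reasoning
    P = suc (pred (2 ^ j))
    P≡ : P ≡ 2 ^ j
    P≡ = suc-pred (2 ^ j) {{m^n≢0 2 j}}
    block : ∀ i → h T (2 ^ j + i) ≤ T / P
    block i = /-monoʳ-≤ T (s≤s (pred-mono-≤ (≤-trans (m≤m+n (2 ^ j) i) (m≤n⊔m 1 (2 ^ j + i)))))

  -- A bound of divisor type. Fixing the first entry `c` replaces `T` by `T / size c`; the harmonic
  -- sum of these quotients costs `j + 1`, and the two signs of `c` a factor 2.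
  ΣT-count : ∀ k T j → 1 ≤ T → T < 2 ^ j → ΣT k T (λ _ → 1) ≤ T * (2 * suc j) ^ k
  ΣT-count zero T j 1≤T T< = ≤-trans 1≤T (≤-reflexive (sym (*-identityʳ T)))
  ΣT-count (suc k) T j 1≤T T< = begin
    Box T (λ c → ΣT k (T / size c) (λ _ → 1))
      ≤⟨ Box-mono T (λ c c≤ → ΣT-count k (T / size c) j (T/≥1 c c≤) (≤-<-trans (≤-trans (m≤m*n (T / size c) (size c)) (m/n*n≤m T (size c))) T<)) ⟩
    Box T (λ c → h T ℤ.∣ c ∣ * C) ≡⟨ Σ-*ʳ (suc (T + T)) C _ ⟩
    Box T (λ c → h T ℤ.∣ c ∣) * C ≤⟨ *-monoˡ-≤ C (Box-∣∣ T (h T)) ⟩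
    2 * Σ< (suc T) (h T) * C ≤⟨ *-monoˡ-≤ C (*-monoʳ-≤ 2 (≤-trans (Σ-extend (h T) T<) (harmonic T j))) ⟩
    2 * (suc j * T) * C ≡⟨ e (suc j) T C ⟩
    T * (2 * suc j * C) ∎
    where
    open ≤-Reasoning
    C = (2 * suc j) ^ k
    e : ∀ j T C → 2 * (j * T) * C ≡ T * (2 * j * C)
    e = solve-∀
    -- The induction hypothesis requires this, because the empty vector is counted whatever the
    -- bound is.
    T/≥1 : ∀ c → ℤ.∣ c ∣ ≤ T → 1 ≤ T / size c
    T/≥1 c c≤ = m≥n⇒m/n>0 {T} {size c} (s≤T c c≤)
      where
      s≤T : ∀ c → ℤ.∣ c ∣ ≤ T → size c ≤ T
      s≤T (+ zero) _ = 1≤T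
      s≤T (+ suc n) q = q
      s≤T -[1+ n ] q = q

-- Binary cubic forms and their covariants

module Forms where

  open import Data.Integer using (ℤ; +_; _+_; _*_; _-_; -_)
  open import Data.Integer.Tactic.RingSolver using (solve-∀)
  open import Data.Vec using (Vec; []; _∷_)
  open import Data.Product using (_×_; _,_)
  open import Relation.Binary.PropositionalEquality using (_≡_)

  -- Covariants of the binary cubic form f₀u³ + f₁u²v + f₂uv² + f₃v³.

  hessian jacobian : (f₀ f₁ f₂ f₃ u v : ℤ) → ℤ
  hessian f₀ f₁ f₂ f₃ u v =
    (f₁ * f₁ - + 3 * f₀ * f₂) * u * u + (f₁ * f₂ - + 9 * f₀ * f₃) * u * v + (f₂ * f₂ - + 3 * f₁ * f₃) * v * v
  jacobian f₀ f₁ f₂ f₃ u v =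
    (+ 3 * f₀ * u * u + + 2 * f₁ * u * v + f₂ * v * v) * ((f₁ * f₂ - + 9 * f₀ * f₃) * u + + 2 * (f₂ * f₂ - + 3 * f₁ * f₃) * v)
    - (f₁ * u * u + + 2 * f₂ * u * v + + 3 * f₃ * v * v) * (+ 2 * (f₁ * f₁ - + 3 * f₀ * f₂) * u + (f₁ * f₂ - + 9 * f₀ * f₃) * v)

  -- In the application these are the four coefficients of the form in a reduced basis and the
  -- vector at which it takes the value `p`. The two equations fix `b` and `a²`.
  Code : ℤ → ℤ → Vec ℤ 6 → Set
  Code a b (f₀ ∷ f₁ ∷ f₂ ∷ f₃ ∷ u ∷ v ∷ []) =
    hessian f₀ f₁ f₂ f₃ u v ≡ + 12 * b × jacobian f₀ f₁ f₂ f₃ u v ≡ + 27 * (a * a)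

  Root : ℤ → ℤ → ℤ → Set
  Root a b ρ = ρ * ρ * ρ ≡ + 4 * b * ρ + a * a

  -- The form (p , 3r , q , w) in the basis (x , y) , (x′ , y′).

  φ₀ φ₁ φ₂ φ₃ : (p r q w x y x′ y′ : ℤ) → ℤ
  φ₀ p r q w x y x′ y′ = p * x * x * x + + 3 * r * x * x * y + q * x * y * y + w * y * y * y
  φ₁ p r q w x y x′ y′ = + 3 * p * x * x * x′ + + 3 * r * (x * x * y′ + + 2 * x * y * x′) + q * (+ 2 * x * y * y′ + y * y * x′) + + 3 * w * y * y * y′
  φ₂ p r q w x y x′ y′ = + 3 * p * x * x′ * x′ + + 3 * r * (+ 2 * x * x′ * y′ + y * x′ * x′) + q * (x * y′ * y′ + + 2 * y * x′ * y′) + + 3 * w * y * y′ * y′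
  φ₃ p r q w x y x′ y′ = p * x′ * x′ * x′ + + 3 * r * x′ * x′ * y′ + q * x′ * y′ * y′ + w * y′ * y′ * y′

  -- Three times the polarisation of z³ − βzy² − αy³.

  polar : (β α z y z′ y′ z″ y″ : ℤ) → ℤ
  polar β α z y z′ y′ z″ y″ =
    + 3 * (z * z′ * z″) - (β * (z * (y′ * y″)) + β * (z′ * (y * y″)) + β * (z″ * (y * y′))) - + 3 * (α * (y * (y′ * y″)))

  module _ (p r q w x y x′ y′ : ℤ) where
    private
      β = + 3 * r * r - p * q
      α = r * r * r - β * r - p * p * w
      z = p * x + r * y
      z′ = p * x′ + r * y′

    -- With `z = px + ry` the form is `z³ − βzy² − αy³` divided by `p²`, so its coefficients in a
    -- basis are values of the trilinear form at basis vectors. The tripling absorbs the binomial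
    -- factor of the two middle coefficients and leaves a 3 at the outer ones.
    polar₀ : polar β α z y z y z y ≡ p * p * (+ 3 * φ₀ p r q w x y x′ y′)
    polar₀ = e p r q w x y
      where
      e : ∀ p r q w x y → let β = + 3 * r * r - p * q ; α = r * r * r - β * r - p * p * w ; z = p * x + r * y in
        + 3 * (z * z * z) - (β * (z * (y * y)) + β * (z * (y * y)) + β * (z * (y * y))) - + 3 * (α * (y * (y * y)))
        ≡ p * p * (+ 3 * (p * x * x * x + + 3 * r * x * x * y + q * x * y * y + w * y * y * y))
      e = solve-∀

    polar₁ : polar β α z y z y z′ y′ ≡ p * p * φ₁ p r q w x y x′ y′
    polar₁ = e p r q w x y x′ y′
      where
      e : ∀ p r q w x y x′ y′ → let β = + 3 * r * r - p * q ; α = r * r * r - β * r - p * p * w ; z = p * x + r * y ; z′ = p * x′ + r * y′ in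
        + 3 * (z * z * z′) - (β * (z * (y * y′)) + β * (z * (y * y′)) + β * (z′ * (y * y))) - + 3 * (α * (y * (y * y′)))
        ≡ p * p * (+ 3 * p * x * x * x′ + + 3 * r * (x * x * y′ + + 2 * x * y * x′) + q * (+ 2 * x * y * y′ + y * y * x′) + + 3 * w * y * y * y′)
      e = solve-∀

    polar₂ : polar β α z y z′ y′ z′ y′ ≡ p * p * φ₂ p r q w x y x′ y′
    polar₂ = e p r q w x y x′ y′
      where
      e : ∀ p r q w x y x′ y′ → let β = + 3 * r * r - p * q ; α = r * r * r - β * r - p * p * w ; z = p * x + r * y ; z′ = p * x′ + r * y′ in
        + 3 * (z * z′ * z′) - (β * (z * (y′ * y′)) + β * (z′ * (y * y′)) + β * (z′ * (y * y′))) - + 3 * (α * (y * (y′ * y′)))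
        ≡ p * p * (+ 3 * p * x * x′ * x′ + + 3 * r * (+ 2 * x * x′ * y′ + y * x′ * x′) + q * (x * y′ * y′ + + 2 * y * x′ * y′) + + 3 * w * y * y′ * y′)
      e = solve-∀

    private
      δ = x * y′ - y * x′

    -- The change of basis sends `(y′ , −y)` to `(δ , 0)`. The Hessian has weight 2 and degree 2,
    -- hence `δ⁴` times its value `3β` at `(1 , 0)`. The Jacobian covariant has weight and degree 3,
    -- hence `δ⁶` in `jacobian-φ`.
    hessian-φ : hessian (φ₀ p r q w x y x′ y′) (φ₁ p r q w x y x′ y′) (φ₂ p r q w x y x′ y′) (φ₃ p r q w x y x′ y′) y′ (- y)
      ≡ δ * δ * δ * δ * (+ 3 * β)
    hessian-φ = e p r q w x y x′ y′
      where
      e : ∀ p r q w x y x′ y′ →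
        let f₀ = p * x * x * x + + 3 * r * x * x * y + q * x * y * y + w * y * y * y
            f₁ = + 3 * p * x * x * x′ + + 3 * r * (x * x * y′ + + 2 * x * y * x′) + q * (+ 2 * x * y * y′ + y * y * x′) + + 3 * w * y * y * y′
            f₂ = + 3 * p * x * x′ * x′ + + 3 * r * (+ 2 * x * x′ * y′ + y * x′ * x′) + q * (x * y′ * y′ + + 2 * y * x′ * y′) + + 3 * w * y * y′ * y′
            f₃ = p * x′ * x′ * x′ + + 3 * r * x′ * x′ * y′ + q * x′ * y′ * y′ + w * y′ * y′ * y′
            u = y′ ; v = - y ; δ = x * y′ - y * x′ in
        (f₁ * f₁ - + 3 * f₀ * f₂) * u * u + (f₁ * f₂ - + 9 * f₀ * f₃) * u * v + (f₂ * f₂ - + 3 * f₁ * f₃) * v * v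
        ≡ δ * δ * δ * δ * (+ 3 * (+ 3 * r * r - p * q))
      e = solve-∀

    jacobian-φ : jacobian (φ₀ p r q w x y x′ y′) (φ₁ p r q w x y x′ y′) (φ₂ p r q w x y x′ y′) (φ₃ p r q w x y x′ y′) y′ (- y)
      ≡ δ * δ * δ * δ * δ * δ * (+ 27 * α)
    jacobian-φ = e p r q w x y x′ y′
      where
      e : ∀ p r q w x y x′ y′ →
        let f₀ = p * x * x * x + + 3 * r * x * x * y + q * x * y * y + w * y * y * y
            f₁ = + 3 * p * x * x * x′ + + 3 * r * (x * x * y′ + + 2 * x * y * x′) + q * (+ 2 * x * y * y′ + y * y * x′) + + 3 * w * y * y * y′
            f₂ = + 3 * p * x * x′ * x′ + + 3 * r * (+ 2 * x * x′ * y′ + y * x′ * x′) + q * (x * y′ * y′ + + 2 * y * x′ * y′) + + 3 * w * y * y′ * y′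
            f₃ = p * x′ * x′ * x′ + + 3 * r * x′ * x′ * y′ + q * x′ * y′ * y′ + w * y′ * y′ * y′
            u = y′ ; v = - y ; δ = x * y′ - y * x′ in
        (+ 3 * f₀ * u * u + + 2 * f₁ * u * v + f₂ * v * v) * ((f₁ * f₂ - + 9 * f₀ * f₃) * u + + 2 * (f₂ * f₂ - + 3 * f₁ * f₃) * v)
        - (f₁ * u * u + + 2 * f₂ * u * v + + 3 * f₃ * v * v) * (+ 2 * (f₁ * f₁ - + 3 * f₀ * f₂) * u + (f₁ * f₂ - + 9 * f₀ * f₃) * v)
        ≡ δ * δ * δ * δ * δ * δ * (+ 27 * (r * r * r - (+ 3 * r * r - p * q) * r - p * p * w))
      e = solve-∀

  polar₃ : ∀ p r q w x y x′ y′ →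
    let β = + 3 * r * r - p * q ; α = r * r * r - β * r - p * p * w ; z′ = p * x′ + r * y′ in
    polar β α z′ y′ z′ y′ z′ y′ ≡ p * p * (+ 3 * φ₃ p r q w x y x′ y′)
  polar₃ p r q w x y x′ y′ = polar₀ p r q w x′ y′ x y

-- Large primes: an integer root or a small sextuple

module Core where

  open Divs
  open Local
  open Gauss
  open Forms
  open Tuples using (size; weight)
  open import Defs using (disc)
  open import Data.Nat as ℕ using (ℕ; zero; suc; s≤s; z≤n; _≤_; _<_)
  open import Data.Nat.Properties
  import Data.Nat.Divisibility as ℕD
  open import Data.Nat.GCD using (gcd; gcd[m,n]∣m; gcd[m,n]∣n; gcd[m,n]≢0)
  open import Data.Nat.DivMod using (_/_)
  open import Data.Nat.Coprimality using (Coprime; coprime-divisor; coprime-/gcd) renaming (sym to coprime-sym)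
  open import Data.Nat.Primality using (Prime; prime⇒nonZero)
  open import Data.Integer using (ℤ; +_; -[1+_]; _+_; _*_; _-_; -_; ∣_∣)
  import Data.Integer.Properties as ℤP
  open import Data.Integer.Divisibility.Signed
  open import Data.Integer.Tactic.RingSolver using (solve-∀)
  import Data.Nat.Tactic.RingSolver as ℕR
  open import Data.Vec using ([]; _∷_)
  open import Data.Product using (_×_; _,_; ∃-syntax)
  open import Data.Sum using (_⊎_; inj₁; inj₂; [_,_]′)
  open import Relation.Nullary using (¬_; Dec; yes; no; contradiction)
  open import Relation.Binary.PropositionalEquality using (_≡_; _≢_; refl; sym; trans; cong; cong₂; subst; subst₂)

  -- A double root of `x³ − βx − α` satisfies `2βr = −3α`. For the resolvent this is the equation
  -- `X = 0`, solvable modulo `p²` because `8b` is a unit. Multiplied by powers of `8b`, both claims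
  -- become combinations of `X` and the discriminant.
  doubleRoot : ∀ {p} (pr : Prime p) (5≤p : 5 ≤ p) a b → ¬ (+ p ∣ a) → + (p ℕ.* p) ∣ disc a b →
    ∃[ r ] (+ (p ℕ.* p) ∣ + 3 * r * r - + 4 * b) × (+ (p ℕ.* p) ∣ r * r * r - + 4 * b * r - a * a)
  doubleRoot {p} pr 5≤p a b p∤a d =
    let (c , _ , lin) = linear-congruence {+ 8 * b} {p ℕ.* p} {{q≢0}} (coprime-sym (prime²-coprimeℤ {k = + 8 * b} pr p∤8b)) (+ 3 * (a * a))
        r = + c
        X = + 8 * b * r + + 3 * (a * a)
    in r ,
      prime²-cancel pr {+ 8 * b * (+ 8 * b)} (∤-* pr 5≤p (+ 8 * b) (+ 8 * b) p∤8b p∤8b)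
        (∣-lin₂ (+ 3 * (X - + 6 * (a * a))) (- + 1) lin d (e₁ a b r)) ,
      prime²-cancel pr {+ 8 * b * (+ 8 * b) * (+ 8 * b)} (∤-* pr 5≤p (+ 8 * b * (+ 8 * b)) (+ 8 * b) (∤-* pr 5≤p (+ 8 * b) (+ 8 * b) p∤8b p∤8b) p∤8b)
        (∣-lin₂ (X * X - + 9 * (a * a) * X + + 27 * (a * a) * (a * a) - + 256 * b * b * b) (a * a) lin d (e₂ a b r))
    where
    q≢0 : ℕ.NonZero (p ℕ.* p)
    q≢0 = m*n≢0 p p {{prime⇒nonZero pr}} {{prime⇒nonZero pr}}
    p∤8b : ¬ (+ p ∣ + 8 * b)
    p∤8b = ∤-* pr 5≤p (+ 8) b (∤-* pr 5≤p (+ 2) (+ 4) (∤-small pr 5≤p 2 (s≤s (s≤s (s≤s z≤n)))) (∤4 pr 5≤p))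
      (λ p∣b → p∤a (∣disc∧∣b⇒∣a pr 5≤p a b (∣-square d) p∣b))
    e₁ : ∀ a b r → let X = + 8 * b * r + + 3 * (a * a) in
      (+ 8 * b * (+ 8 * b)) * (+ 3 * r * r - + 4 * b)
      ≡ (+ 3 * (X - + 6 * (a * a))) * X + - + 1 * (+ 256 * (b * b * b) - + 27 * (a * a * a * a))
    e₁ = solve-∀
    e₂ : ∀ a b r → let X = + 8 * b * r + + 3 * (a * a) in
      (+ 8 * b * (+ 8 * b) * (+ 8 * b)) * (r * r * r - + 4 * b * r - a * a)
      ≡ (X * X - + 9 * (a * a) * X + + 27 * (a * a) * (a * a) - + 256 * b * b * b) * X + (a * a) * (+ 256 * (b * b * b) - + 27 * (a * a * a * a))
    e₂ = solve-∀

  abs₃ : ∀ x y z → ∣ x * (y * z) ∣ ≡ ∣ x ∣ ℕ.* (∣ y ∣ ℕ.* ∣ z ∣)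
  abs₃ x y z = trans (ℤP.abs-* x (y * z)) (cong (∣ x ∣ ℕ.*_) (ℤP.abs-* y z))

  -- This is why the lattice scales `y` by `m`: with `z` of size `ν`, `y` of size `ν/m`, `β` of size
  -- `4m²` and `α` of size `m³`, all monomials have the same size. The constant is `3 + 3 · 4 + 3`.
  polar-bound : ∀ m β α {z y z′ y′ z″ y″ ν ν′ ν″} → ∣ β ∣ ≤ 4 ℕ.* (m ℕ.* m) → ∣ α ∣ ≤ m ℕ.* (m ℕ.* m) →
    ∣ z ∣ ≤ ν → m ℕ.* ∣ y ∣ ≤ ν → ∣ z′ ∣ ≤ ν′ → m ℕ.* ∣ y′ ∣ ≤ ν′ → ∣ z″ ∣ ≤ ν″ → m ℕ.* ∣ y″ ∣ ≤ ν″ →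
    ∣ polar β α z y z′ y′ z″ y″ ∣ ≤ 18 ℕ.* (ν ℕ.* (ν′ ℕ.* ν″))
  polar-bound m β α {z} {y} {z′} {y′} {z″} {y″} {ν} {ν′} {ν″} hβ hα hz hy hz′ hy′ hz″ hy″ = begin
    ∣ A - B - C ∣ ≤⟨ ℤP.∣i-j∣≤∣i∣+∣j∣ (A - B) C ⟩
    ∣ A - B ∣ ℕ.+ ∣ C ∣ ≤⟨ +-monoˡ-≤ ∣ C ∣ (ℤP.∣i-j∣≤∣i∣+∣j∣ A B) ⟩
    ∣ A ∣ ℕ.+ ∣ B ∣ ℕ.+ ∣ C ∣ ≤⟨ +-mono-≤ (+-mono-≤ hA hB) hC ⟩
    3 ℕ.* V ℕ.+ (4 ℕ.* V ℕ.+ 4 ℕ.* V ℕ.+ 4 ℕ.* V) ℕ.+ 3 ℕ.* V ≡⟨ e V ⟩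
    18 ℕ.* V ∎
    where
    open ≤-Reasoning
    V = ν ℕ.* (ν′ ℕ.* ν″)
    A = + 3 * (z * z′ * z″)
    B₁ = β * (z * (y′ * y″))
    B₂ = β * (z′ * (y * y″))
    B₃ = β * (z″ * (y * y′))
    B = B₁ + B₂ + B₃
    C = + 3 * (α * (y * (y′ * y″)))
    e : ∀ V → 3 ℕ.* V ℕ.+ (4 ℕ.* V ℕ.+ 4 ℕ.* V ℕ.+ 4 ℕ.* V) ℕ.+ 3 ℕ.* V ≡ 18 ℕ.* V
    e = ℕR.solve-∀
    mixed : ∀ {z y′ y″ ν ν′ ν″} → ∣ z ∣ ≤ ν → m ℕ.* ∣ y′ ∣ ≤ ν′ → m ℕ.* ∣ y″ ∣ ≤ ν″ →
      ∣ β * (z * (y′ * y″)) ∣ ≤ 4 ℕ.* (ν ℕ.* (ν′ ℕ.* ν″))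
    mixed {z} {y′} {y″} {ν} {ν′} {ν″} hz hy′ hy″ = begin
      ∣ β * (z * (y′ * y″)) ∣ ≡⟨ trans (abs₃ β z (y′ * y″)) (cong (λ t → ∣ β ∣ ℕ.* (∣ z ∣ ℕ.* t)) (ℤP.abs-* y′ y″)) ⟩
      ∣ β ∣ ℕ.* (∣ z ∣ ℕ.* (∣ y′ ∣ ℕ.* ∣ y″ ∣)) ≤⟨ *-mono-≤ hβ (*-monoˡ-≤ (∣ y′ ∣ ℕ.* ∣ y″ ∣) hz) ⟩
      4 ℕ.* (m ℕ.* m) ℕ.* (ν ℕ.* (∣ y′ ∣ ℕ.* ∣ y″ ∣)) ≡⟨ e′ m ν (∣ y′ ∣) (∣ y″ ∣) ⟩
      4 ℕ.* (ν ℕ.* ((m ℕ.* ∣ y′ ∣) ℕ.* (m ℕ.* ∣ y″ ∣))) ≤⟨ *-monoʳ-≤ 4 (*-monoʳ-≤ ν (*-mono-≤ hy′ hy″)) ⟩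
      4 ℕ.* (ν ℕ.* (ν′ ℕ.* ν″)) ∎
      where
      e′ : ∀ m ν a b → 4 ℕ.* (m ℕ.* m) ℕ.* (ν ℕ.* (a ℕ.* b)) ≡ 4 ℕ.* (ν ℕ.* ((m ℕ.* a) ℕ.* (m ℕ.* b)))
      e′ = ℕR.solve-∀
    swap : ∀ a b c → a ℕ.* (b ℕ.* c) ≡ b ℕ.* (a ℕ.* c)
    swap = ℕR.solve-∀
    rot : ∀ a b c → c ℕ.* (a ℕ.* b) ≡ a ℕ.* (b ℕ.* c)
    rot = ℕR.solve-∀
    hA : ∣ A ∣ ≤ 3 ℕ.* V
    hA = begin
      ∣ A ∣ ≡⟨ trans (ℤP.abs-* (+ 3) (z * z′ * z″)) (cong (3 ℕ.*_) (trans (cong ∣_∣ (ℤP.*-assoc z z′ z″)) (abs₃ z z′ z″))) ⟩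
      3 ℕ.* (∣ z ∣ ℕ.* (∣ z′ ∣ ℕ.* ∣ z″ ∣)) ≤⟨ *-monoʳ-≤ 3 (*-mono-≤ hz (*-mono-≤ hz′ hz″)) ⟩
      3 ℕ.* V ∎
    hB : ∣ B ∣ ≤ 4 ℕ.* V ℕ.+ 4 ℕ.* V ℕ.+ 4 ℕ.* V
    hB = ≤-trans (ℤP.∣i+j∣≤∣i∣+∣j∣ (B₁ + B₂) B₃) (+-mono-≤
      (≤-trans (ℤP.∣i+j∣≤∣i∣+∣j∣ B₁ B₂) (+-mono-≤ (mixed {z} {y′} {y″} hz hy′ hy″)
        (≤-trans (mixed {z′} {y} {y″} hz′ hy hy″) (≤-reflexive (cong (4 ℕ.*_) (swap ν′ ν ν″))))))
      (≤-trans (mixed {z″} {y} {y′} hz″ hy hy′) (≤-reflexive (cong (4 ℕ.*_) (rot ν ν′ ν″)))))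
    hC : ∣ C ∣ ≤ 3 ℕ.* V
    hC = begin
      ∣ C ∣
        ≡⟨ trans (ℤP.abs-* (+ 3) (α * (y * (y′ * y″)))) (cong (3 ℕ.*_) (trans (ℤP.abs-* α (y * (y′ * y″))) (cong (∣ α ∣ ℕ.*_) (abs₃ y y′ y″)))) ⟩
      3 ℕ.* (∣ α ∣ ℕ.* (∣ y ∣ ℕ.* (∣ y′ ∣ ℕ.* ∣ y″ ∣))) ≤⟨ *-monoʳ-≤ 3 (*-monoˡ-≤ (∣ y ∣ ℕ.* (∣ y′ ∣ ℕ.* ∣ y″ ∣)) hα) ⟩
      3 ℕ.* (m ℕ.* (m ℕ.* m) ℕ.* (∣ y ∣ ℕ.* (∣ y′ ∣ ℕ.* ∣ y″ ∣))) ≡⟨ cong (3 ℕ.*_) (e′ m (∣ y ∣) (∣ y′ ∣) (∣ y″ ∣)) ⟩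
      3 ℕ.* ((m ℕ.* ∣ y ∣) ℕ.* ((m ℕ.* ∣ y′ ∣) ℕ.* (m ℕ.* ∣ y″ ∣))) ≤⟨ *-monoʳ-≤ 3 (*-mono-≤ hy (*-mono-≤ hy′ hy″)) ⟩
      3 ℕ.* V ∎
      where
      e′ : ∀ m a b c → m ℕ.* (m ℕ.* m) ℕ.* (a ℕ.* (b ℕ.* c)) ≡ (m ℕ.* a) ℕ.* ((m ℕ.* b) ℕ.* (m ℕ.* c))
      e′ = ℕR.solve-∀

  -- The cubic is monic: in lowest terms `y₁` divides `z₁³`, so it is a unit.
  rationalRoot : ∀ β α z y → y ≢ + 0 → z * z * z ≡ β * z * y * y + α * y * y * y → ∃[ ρ ] ρ * ρ * ρ ≡ β * ρ + α
  rationalRoot β α z y y≢0 eq = finish (∣ᵤ⇒∣ {+ g} {z} (gcd[m,n]∣m (∣ z ∣) (∣ y ∣))) (∣ᵤ⇒∣ {+ g} {y} (gcd[m,n]∣n (∣ z ∣) (∣ y ∣)))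
    where
    g = gcd (∣ z ∣) (∣ y ∣)
    instance
      g≢0 : ℕ.NonZero g
      g≢0 = ℕ.≢-nonZero (gcd[m,n]≢0 (∣ z ∣) (∣ y ∣) (inj₂ λ ∣y∣≡0 → y≢0 (ℤP.∣i∣≡0⇒i≡0 ∣y∣≡0)))
      gℤ≢0 : Data.Integer.NonZero (+ g)
      gℤ≢0 = g≢0
    unit : ∀ u → ∣ u ∣ ≡ 1 → u * u ≡ + 1
    unit (+ .1) refl = refl
    unit -[1+ .0 ] refl = refl
    finish : + g ∣ z → + g ∣ y → ∃[ ρ ] ρ * ρ * ρ ≡ β * ρ + α
    -- As `y₁` is its own inverse, `z₁ * y₁` is the quotient `z₁ / y₁`.
    finish (divides z₁ z≡) (divides y₁ y≡) = z₁ * y₁ , root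
      where
      reduced-eq : z₁ * z₁ * z₁ ≡ β * z₁ * y₁ * y₁ + α * y₁ * y₁ * y₁
      reduced-eq = cancel³ (subst₂ (λ z y → z * z * z ≡ β * z * y * y + α * y * y * y) z≡ y≡ eq)
        where
        l : ∀ z g → z * g * (z * g) * (z * g) ≡ g * (g * (g * (z * z * z)))
        l = solve-∀
        r : ∀ β α z y g → β * (z * g) * (y * g) * (y * g) + α * (y * g) * (y * g) * (y * g) ≡ g * (g * (g * (β * z * y * y + α * y * y * y)))
        r = solve-∀
        cancel³ : (z₁ * + g) * (z₁ * + g) * (z₁ * + g) ≡ β * (z₁ * + g) * (y₁ * + g) * (y₁ * + g) + α * (y₁ * + g) * (y₁ * + g) * (y₁ * + g) →
          z₁ * z₁ * z₁ ≡ β * z₁ * y₁ * y₁ + α * y₁ * y₁ * y₁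
        cancel³ h = ℤP.*-cancelˡ-≡ (+ g) _ _ (ℤP.*-cancelˡ-≡ (+ g) _ _ (ℤP.*-cancelˡ-≡ (+ g) _ _
          (trans (sym (l z₁ (+ g))) (trans h (r β α z₁ y₁ (+ g))))))
      abs-quot : ∀ {x x₁} → x ≡ x₁ * + g → ∣ x ∣ / g ≡ ∣ x₁ ∣
      abs-quot {x} {x₁} x≡ = trans (cong (_/ g) (trans (cong ∣_∣ x≡) (ℤP.abs-* x₁ (+ g)))) (Data.Nat.DivMod.m*n/n≡m ∣ x₁ ∣ g)
        where import Data.Nat.DivMod
      coprime : Coprime (∣ y₁ ∣) (∣ z₁ ∣)
      coprime = coprime-sym (subst₂ Coprime (abs-quot {z} {z₁} z≡) (abs-quot {y} {y₁} y≡) (coprime-/gcd (∣ z ∣) (∣ y ∣)))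
      y₁∣z₁³ : ∣ y₁ ∣ ℕD.∣ ∣ z₁ ∣ ℕ.* (∣ z₁ ∣ ℕ.* ∣ z₁ ∣)
      y₁∣z₁³ = subst (∣ y₁ ∣ ℕD.∣_) (trans (cong ∣_∣ (ℤP.*-assoc z₁ z₁ z₁)) (abs₃ z₁ z₁ z₁))
        (∣⇒∣ᵤ {y₁} (divides (β * z₁ * y₁ + α * y₁ * y₁) (trans reduced-eq (e β α z₁ y₁))))
        where
        e : ∀ β α z y → β * z * y * y + α * y * y * y ≡ (β * z * y + α * y * y) * y
        e = solve-∀
      y₁-unit : y₁ * y₁ ≡ + 1
      y₁-unit = unit y₁ (coprime (ℕD.∣-refl , coprime-divisor coprime (coprime-divisor coprime y₁∣z₁³)))
      root : (z₁ * y₁) * (z₁ * y₁) * (z₁ * y₁) ≡ β * (z₁ * y₁) + α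
      root = trans (e₁ z₁ y₁) (trans (cong (_* (y₁ * y₁ * y₁)) reduced-eq) (trans (e₂ β α z₁ y₁)
        (trans (cong (λ t → β * (z₁ * y₁) * (t * t) + α * (t * t * t)) y₁-unit) (e₃ (β * (z₁ * y₁)) α))))
        where
        e₁ : ∀ z y → (z * y) * (z * y) * (z * y) ≡ (z * z * z) * (y * y * y)
        e₁ = solve-∀
        e₂ : ∀ β α z y → (β * z * y * y + α * y * y * y) * (y * y * y) ≡ β * (z * y) * ((y * y) * (y * y)) + α * ((y * y) * (y * y) * (y * y))
        e₂ = solve-∀
        e₃ : ∀ s α → s * (+ 1 * + 1) + α * (+ 1 * + 1 * + 1) ≡ s + α
        e₃ = solve-∀

  -- If `s = |ρ|` exceeded `3m`, then `s³` would exceed `9m²s`, whereas the other side is at most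
  -- `4m²s + m³ ≤ 5m²s`.
  root-bound : ∀ m β α ρ → ∣ β ∣ ≤ 4 ℕ.* (m ℕ.* m) → ∣ α ∣ ≤ m ℕ.* (m ℕ.* m) → ρ * ρ * ρ ≡ β * ρ + α → ∣ ρ ∣ ≤ 3 ℕ.* m
  root-bound m β α ρ hβ hα eq = ≮⇒≥ λ 3m<s → <⇒≱ (big 3m<s) small
    where
    s = ∣ ρ ∣
    small : s ℕ.* (s ℕ.* s) ≤ 4 ℕ.* (m ℕ.* m) ℕ.* s ℕ.+ m ℕ.* (m ℕ.* m)
    small = begin
      s ℕ.* (s ℕ.* s) ≡⟨ trans (sym (abs₃ ρ ρ ρ)) (cong ∣_∣ (trans (sym (ℤP.*-assoc ρ ρ ρ)) eq)) ⟩
      ∣ β * ρ + α ∣ ≤⟨ ℤP.∣i+j∣≤∣i∣+∣j∣ (β * ρ) α ⟩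
      ∣ β * ρ ∣ ℕ.+ ∣ α ∣ ≤⟨ +-mono-≤ (≤-trans (≤-reflexive (ℤP.abs-* β ρ)) (*-monoˡ-≤ s hβ)) hα ⟩
      4 ℕ.* (m ℕ.* m) ℕ.* s ℕ.+ m ℕ.* (m ℕ.* m) ∎
      where open ≤-Reasoning
    big : 3 ℕ.* m < s → 4 ℕ.* (m ℕ.* m) ℕ.* s ℕ.+ m ℕ.* (m ℕ.* m) < s ℕ.* (s ℕ.* s)
    big h = begin-strict
      4 ℕ.* (m ℕ.* m) ℕ.* s ℕ.+ m ℕ.* (m ℕ.* m) ≤⟨ +-monoʳ-≤ (4 ℕ.* (m ℕ.* m) ℕ.* s) (*-monoˡ-≤ (m ℕ.* m) m≤s) ⟩
      4 ℕ.* (m ℕ.* m) ℕ.* s ℕ.+ s ℕ.* (m ℕ.* m) ≡⟨ e₁ m s ⟩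
      s ℕ.* (5 ℕ.* (m ℕ.* m)) ≤⟨ *-monoʳ-≤ s (*-monoˡ-≤ (m ℕ.* m) (m≤m+n 5 4)) ⟩
      s ℕ.* (9 ℕ.* (m ℕ.* m)) ≡⟨ cong (s ℕ.*_) (e₂ m) ⟩
      s ℕ.* (3 ℕ.* m ℕ.* (3 ℕ.* m)) <⟨ *-monoʳ-< s {{ℕ.>-nonZero (≤-<-trans z≤n h)}} (*-mono-< h h) ⟩
      s ℕ.* (s ℕ.* s) ∎
      where
      open ≤-Reasoning
      m≤s : m ≤ s
      m≤s = ≤-trans (m≤m+n m (m ℕ.+ (m ℕ.+ 0))) (<⇒≤ h)
      e₁ : ∀ m s → 4 ℕ.* (m ℕ.* m) ℕ.* s ℕ.+ s ℕ.* (m ℕ.* m) ≡ s ℕ.* (5 ℕ.* (m ℕ.* m))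
      e₁ = ℕR.solve-∀
      e₂ : ∀ m → 9 ℕ.* (m ℕ.* m) ≡ 3 ℕ.* m ℕ.* (3 ℕ.* m)
      e₂ = ℕR.solve-∀

  private
    -- The product of the six bounds has `p⁸m²` times the weight on the left and `c⁴(ν₁ν₂)⁷` on the
    -- right. With `ν₁ν₂ ≤ 2mp` this leaves `p` times the weight below `2⁷c⁴m⁵`, and `m² ≤ pK` then
    -- removes `p`.
    weight-bound : ∀ c p m K {ν₁ ν₂ s₀ s₁ s₂ s₃ t u} .{{_ : ℕ.NonZero p}} .{{_ : ℕ.NonZero m}} →
      p ℕ.* p ℕ.* s₀ ≤ c ℕ.* (ν₁ ℕ.* (ν₁ ℕ.* ν₁)) → p ℕ.* p ℕ.* s₁ ≤ c ℕ.* (ν₁ ℕ.* (ν₁ ℕ.* ν₂)) →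
      p ℕ.* p ℕ.* s₂ ≤ c ℕ.* (ν₁ ℕ.* (ν₂ ℕ.* ν₂)) → p ℕ.* p ℕ.* s₃ ≤ c ℕ.* (ν₂ ℕ.* (ν₂ ℕ.* ν₂)) →
      m ℕ.* t ≤ ν₂ → m ℕ.* u ≤ ν₁ → ν₁ ℕ.* ν₂ ≤ 2 ℕ.* (m ℕ.* p) → m ℕ.* m ≤ p ℕ.* K →
      s₀ ℕ.* (s₁ ℕ.* (s₂ ℕ.* (s₃ ℕ.* (t ℕ.* (u ℕ.* 1))))) ≤ m ℕ.* m ℕ.* m ℕ.* (K ℕ.* (c ℕ.* c ℕ.* c ℕ.* c ℕ.* 128))
    weight-bound c p m K {ν₁} {ν₂} {s₀} {s₁} {s₂} {s₃} {t} {u} h₀ h₁ h₂ h₃ ht hu hν hK =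
      *-cancelˡ-≤ (m ℕ.* m) {{m*n≢0 m m}} (begin
        m ℕ.* m ℕ.* w ≤⟨ *-monoˡ-≤ w hK ⟩
        p ℕ.* K ℕ.* w ≡⟨ e₄ p K w ⟩
        K ℕ.* (p ℕ.* w) ≤⟨ *-monoʳ-≤ K pw ⟩
        K ℕ.* (m⁵ ℕ.* C) ≡⟨ e₅ m K C ⟩
        m ℕ.* m ℕ.* (m ℕ.* m ℕ.* m ℕ.* (K ℕ.* C)) ∎)
      where
      open ≤-Reasoning
      w p⁷ m⁵ C x : ℕ
      w = s₀ ℕ.* (s₁ ℕ.* (s₂ ℕ.* (s₃ ℕ.* (t ℕ.* (u ℕ.* 1)))))
      p⁷ = p ℕ.* p ℕ.* p ℕ.* p ℕ.* p ℕ.* p ℕ.* p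
      m⁵ = m ℕ.* m ℕ.* m ℕ.* m ℕ.* m
      C = c ℕ.* c ℕ.* c ℕ.* c ℕ.* 128
      x = ν₁ ℕ.* ν₂
      e₁ : ∀ p m s₀ s₁ s₂ s₃ t u →
        (p ℕ.* p ℕ.* p ℕ.* p ℕ.* p ℕ.* p ℕ.* p ℕ.* (m ℕ.* m)) ℕ.* (p ℕ.* (s₀ ℕ.* (s₁ ℕ.* (s₂ ℕ.* (s₃ ℕ.* (t ℕ.* (u ℕ.* 1)))))))
        ≡ (p ℕ.* p ℕ.* s₀) ℕ.* ((p ℕ.* p ℕ.* s₁) ℕ.* ((p ℕ.* p ℕ.* s₂) ℕ.* ((p ℕ.* p ℕ.* s₃) ℕ.* ((m ℕ.* t) ℕ.* (m ℕ.* u)))))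
      e₁ = ℕR.solve-∀
      e₂ : ∀ c a b → (c ℕ.* (a ℕ.* (a ℕ.* a))) ℕ.* ((c ℕ.* (a ℕ.* (a ℕ.* b))) ℕ.* ((c ℕ.* (a ℕ.* (b ℕ.* b))) ℕ.* ((c ℕ.* (b ℕ.* (b ℕ.* b))) ℕ.* (b ℕ.* a))))
        ≡ c ℕ.* c ℕ.* c ℕ.* c ℕ.* ((a ℕ.* b) ℕ.* ((a ℕ.* b) ℕ.* ((a ℕ.* b) ℕ.* ((a ℕ.* b) ℕ.* ((a ℕ.* b) ℕ.* ((a ℕ.* b) ℕ.* (a ℕ.* b)))))))
      e₂ = ℕR.solve-∀
      e₃ : ∀ c m p → let y = 2 ℕ.* (m ℕ.* p) in
        c ℕ.* c ℕ.* c ℕ.* c ℕ.* (y ℕ.* (y ℕ.* (y ℕ.* (y ℕ.* (y ℕ.* (y ℕ.* y))))))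
        ≡ (p ℕ.* p ℕ.* p ℕ.* p ℕ.* p ℕ.* p ℕ.* p ℕ.* (m ℕ.* m)) ℕ.* (m ℕ.* m ℕ.* m ℕ.* m ℕ.* m ℕ.* (c ℕ.* c ℕ.* c ℕ.* c ℕ.* 128))
      e₃ = ℕR.solve-∀
      e₄ : ∀ p K w → p ℕ.* K ℕ.* w ≡ K ℕ.* (p ℕ.* w)
      e₄ = ℕR.solve-∀
      e₅ : ∀ m K C → K ℕ.* (m ℕ.* m ℕ.* m ℕ.* m ℕ.* m ℕ.* C) ≡ m ℕ.* m ℕ.* (m ℕ.* m ℕ.* m ℕ.* (K ℕ.* C))
      e₅ = ℕR.solve-∀
      pw : p ℕ.* w ≤ m⁵ ℕ.* C
      pw = *-cancelˡ-≤ (p⁷ ℕ.* (m ℕ.* m)) {{nz}} (begin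
        p⁷ ℕ.* (m ℕ.* m) ℕ.* (p ℕ.* w)
          ≡⟨ e₁ p m s₀ s₁ s₂ s₃ t u ⟩
        (p ℕ.* p ℕ.* s₀) ℕ.* ((p ℕ.* p ℕ.* s₁) ℕ.* ((p ℕ.* p ℕ.* s₂) ℕ.* ((p ℕ.* p ℕ.* s₃) ℕ.* ((m ℕ.* t) ℕ.* (m ℕ.* u)))))
          ≤⟨ *-mono-≤ h₀ (*-mono-≤ h₁ (*-mono-≤ h₂ (*-mono-≤ h₃ (*-mono-≤ ht hu)))) ⟩
        (c ℕ.* (ν₁ ℕ.* (ν₁ ℕ.* ν₁))) ℕ.* ((c ℕ.* (ν₁ ℕ.* (ν₁ ℕ.* ν₂))) ℕ.* ((c ℕ.* (ν₁ ℕ.* (ν₂ ℕ.* ν₂))) ℕ.* ((c ℕ.* (ν₂ ℕ.* (ν₂ ℕ.* ν₂))) ℕ.* (ν₂ ℕ.* ν₁))))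
          ≡⟨ e₂ c ν₁ ν₂ ⟩
        c ℕ.* c ℕ.* c ℕ.* c ℕ.* (x ℕ.* (x ℕ.* (x ℕ.* (x ℕ.* (x ℕ.* (x ℕ.* x))))))
          ≤⟨ *-monoʳ-≤ (c ℕ.* c ℕ.* c ℕ.* c) (*-mono-≤ hν (*-mono-≤ hν (*-mono-≤ hν (*-mono-≤ hν (*-mono-≤ hν (*-mono-≤ hν hν)))))) ⟩
        c ℕ.* c ℕ.* c ℕ.* c ℕ.* (y ℕ.* (y ℕ.* (y ℕ.* (y ℕ.* (y ℕ.* (y ℕ.* y))))))
          ≡⟨ e₃ c m p ⟩
        p⁷ ℕ.* (m ℕ.* m) ℕ.* (m⁵ ℕ.* C) ∎)
        where
        y = 2 ℕ.* (m ℕ.* p)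
        infixl 7 _⊛_
        _⊛_ : ∀ {a b} → ℕ.NonZero a → ℕ.NonZero b → ℕ.NonZero (a ℕ.* b)
        _⊛_ {a} {b} i j = m*n≢0 a b {{i}} {{j}}
        pz : ℕ.NonZero p
        pz = ℕ.≢-nonZero λ { refl → ℕ.≢-nonZero⁻¹ p refl }
        mz : ℕ.NonZero m
        mz = ℕ.≢-nonZero λ { refl → ℕ.≢-nonZero⁻¹ m refl }
        nz : ℕ.NonZero (p⁷ ℕ.* (m ℕ.* m))
        nz = pz ⊛ pz ⊛ pz ⊛ pz ⊛ pz ⊛ pz ⊛ pz ⊛ (mz ⊛ mz)

    -- For `f = 0` the size is 1 instead of 0; that case is paid for by `P ≤ B`.
    size-bound : ∀ f {P B} → P ≤ B → P ℕ.* ∣ f ∣ ≤ B → P ℕ.* size f ≤ B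
    size-bound (+ zero) {P} h _ = ≤-trans (≤-reflexive (*-identityʳ P)) h
    size-bound (+ suc n) _ h′ = h′
    size-bound -[1+ n ] _ h′ = h′

    cube-zero : ∀ z → z * z * z ≡ + 0 → z ≡ + 0
    cube-zero z h with ℤP.i*j≡0⇒i≡0∨j≡0 (z * z) h
    ... | inj₂ z≡0 = z≡0
    ... | inj₁ zz≡0 with ℤP.i*j≡0⇒i≡0∨j≡0 z zz≡0
    ... | inj₁ z≡0 = z≡0
    ... | inj₂ z≡0 = z≡0

    cubes-mono : ∀ {m n} → m ℕ.* (m ℕ.* m) ≤ n ℕ.* (n ℕ.* n) → m ≤ n
    cubes-mono h = ≮⇒≥ λ n<m → <⇒≱ (*-mono-< n<m (*-mono-< n<m n<m)) h

    polar-zero : ∀ β α z y → polar β α z y z y z y ≡ + 0 → z * z * z ≡ β * z * y * y + α * y * y * y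
    polar-zero β α z y h = ℤP.i-j≡0⇒i≡j _ _ (ℤP.*-cancelˡ-≡ (+ 3) _ (+ 0) (trans (sym (e β α z y)) h))
      where
      e : ∀ β α z y → + 3 * (z * z * z) - (β * (z * (y * y)) + β * (z * (y * y)) + β * (z * (y * y))) - + 3 * (α * (y * (y * y)))
        ≡ + 3 * (z * z * z - (β * z * y * y + α * y * y * y))
      e = solve-∀

  module _ (n K p : ℕ) (a b : ℤ) (pr : Prime p) (5≤p : 5 ≤ p) (p∤a : ¬ (+ p ∣ a)) (p²∣disc : + (p ℕ.* p) ∣ disc a b)
    (a≤ : ∣ a ∣ ≤ n ℕ.* n ℕ.* n) (b≤ : ∣ b ∣ ≤ n ℕ.* n ℕ.* (n ℕ.* n))
    (n≢0 : ℕ.NonZero n) (p-large : n ℕ.* n ℕ.* (n ℕ.* n) ≤ p ℕ.* K) (n-large : 18 ℕ.* (K ℕ.* K) ≤ n ℕ.* n) where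

    private
      m : ℕ
      m = n ℕ.* n
      instance
        m≢0 : ℕ.NonZero m
        m≢0 = m*n≢0 n n {{n≢0}} {{n≢0}}
        p≢0 : ℕ.NonZero p
        p≢0 = prime⇒nonZero pr
        P≢0 : ℕ.NonZero (p ℕ.* p)
        P≢0 = m*n≢0 p p

      P : ℕ
      P = p ℕ.* p

    RootOrCode : Set
    RootOrCode = (∃[ ρ ] ∣ ρ ∣ ≤ 3 ℕ.* m × Root a b ρ)
      ⊎ (∃[ v ] weight v ≤ m ℕ.* m ℕ.* m ℕ.* (K ℕ.* (18 ℕ.* 18 ℕ.* 18 ℕ.* 18 ℕ.* 128)) × Code a b v)

    private
      K≢0 : ℕ.NonZero K
      K≢0 = ℕ.≢-nonZero λ { refl → ℕ.≢-nonZero⁻¹ (m ℕ.* m) {{m*n≢0 m m}} (n≤0⇒n≡0 (≤-trans p-large (≤-reflexive (*-zeroʳ p)))) }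

      -- From `p ≥ m²/K` one gets `p² ≥ m⁴/K²`, and `m ≥ 18K²`. Compared with `p² ≤ 18ν₁³` this
      -- yields `m ≤ ν₁`, which covers a zero coordinate of the vector representing `p`.
      18m³≤P : 18 ℕ.* (m ℕ.* (m ℕ.* m)) ≤ P
      18m³≤P = *-cancelˡ-≤ (K ℕ.* K) {{m*n≢0 K K {{K≢0}} {{K≢0}}}} (begin
        K ℕ.* K ℕ.* (18 ℕ.* (m ℕ.* (m ℕ.* m))) ≡⟨ e₁ K m ⟩
        18 ℕ.* (K ℕ.* K) ℕ.* (m ℕ.* (m ℕ.* m)) ≤⟨ *-monoˡ-≤ (m ℕ.* (m ℕ.* m)) n-large ⟩
        m ℕ.* (m ℕ.* (m ℕ.* m)) ≡⟨ *-assoc m m (m ℕ.* m) ⟨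
        (m ℕ.* m) ℕ.* (m ℕ.* m) ≤⟨ *-mono-≤ p-large p-large ⟩
        (p ℕ.* K) ℕ.* (p ℕ.* K) ≡⟨ e₂ p K ⟩
        K ℕ.* K ℕ.* P ∎)
        where
        open ≤-Reasoning
        e₁ : ∀ K m → K ℕ.* K ℕ.* (18 ℕ.* (m ℕ.* (m ℕ.* m))) ≡ 18 ℕ.* (K ℕ.* K) ℕ.* (m ℕ.* (m ℕ.* m))
        e₁ = ℕR.solve-∀
        e₂ : ∀ p K → (p ℕ.* K) ℕ.* (p ℕ.* K) ≡ K ℕ.* K ℕ.* (p ℕ.* p)
        e₂ = ℕR.solve-∀

      abs-P : ∀ f → P ℕ.* ∣ f ∣ ≡ ∣ + p * + p * f ∣
      abs-P f = sym (trans (ℤP.abs-* (+ p * + p) f) (cong (ℕ._* ∣ f ∣) (ℤP.abs-* (+ p) (+ p))))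

      module Reduction (r k w : ℤ) (hβ : + 3 * r * r - + p * (k * + p) ≡ + 4 * b)
        (hα : r * r * r - (+ 3 * r * r - + p * (k * + p)) * r - + p * + p * w ≡ a * a) where

        q β α : ℤ
        q = k * + p
        β = + 3 * r * r - + p * q
        α = r * r * r - β * r - + p * + p * w

        β≤ : ∣ β ∣ ≤ 4 ℕ.* (m ℕ.* m)
        β≤ = subst (λ t → ∣ t ∣ ≤ 4 ℕ.* (m ℕ.* m)) (sym hβ)
          (≤-trans (≤-reflexive (ℤP.abs-* (+ 4) b)) (*-monoʳ-≤ 4 b≤))

        α≤ : ∣ α ∣ ≤ m ℕ.* (m ℕ.* m)
        α≤ = subst (λ t → ∣ t ∣ ≤ m ℕ.* (m ℕ.* m)) (sym hα)
          (≤-trans (≤-reflexive (ℤP.abs-* a a)) (≤-trans (*-mono-≤ a≤ a≤) (≤-reflexive (e n))))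
          where
          e : ∀ n → n ℕ.* n ℕ.* n ℕ.* (n ℕ.* n ℕ.* n) ≡ (n ℕ.* n) ℕ.* ((n ℕ.* n) ℕ.* (n ℕ.* n))
          e = ℕR.solve-∀

        open Reduced (reduced m p r) renaming (a to x; b to y; c to x′; d to y′)

        ν₁ ν₂ : ℕ
        ν₁ = ν m p r x y
        ν₂ = ν m p r x′ y′

        z z′ : ℤ
        z = + p * x + r * y
        z′ = + p * x′ + r * y′

        z≤ : ∣ z ∣ ≤ ν₁
        z≤ = m≤n⊔m (∣ Y m p r y ∣) (∣ z ∣)
        z′≤ : ∣ z′ ∣ ≤ ν₂
        z′≤ = m≤n⊔m (∣ Y m p r y′ ∣) (∣ z′ ∣)
        y≤ : m ℕ.* ∣ y ∣ ≤ ν₁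
        y≤ = ≤-trans (≤-reflexive (sym (ℤP.abs-* (+ m) y))) (m≤m⊔n (∣ Y m p r y ∣) (∣ z ∣))
        y′≤ : m ℕ.* ∣ y′ ∣ ≤ ν₂
        y′≤ = ≤-trans (≤-reflexive (sym (ℤP.abs-* (+ m) y′))) (m≤m⊔n (∣ Y m p r y′ ∣) (∣ z′ ∣))

        f₀ f₁ f₂ f₃ : ℤ
        f₀ = φ₀ (+ p) r q w x y x′ y′
        f₁ = φ₁ (+ p) r q w x y x′ y′
        f₂ = φ₂ (+ p) r q w x y x′ y′
        f₃ = φ₃ (+ p) r q w x y x′ y′

        B₀ : P ℕ.* ∣ + 3 * f₀ ∣ ≤ 18 ℕ.* (ν₁ ℕ.* (ν₁ ℕ.* ν₁))
        B₀ = ≤-trans (≤-reflexive (trans (abs-P (+ 3 * f₀)) (cong ∣_∣ (sym (polar₀ (+ p) r q w x y x′ y′)))))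
          (polar-bound m β α {z} {y} {z} {y} {z} {y} β≤ α≤ z≤ y≤ z≤ y≤ z≤ y≤)
        B₁ : P ℕ.* ∣ f₁ ∣ ≤ 18 ℕ.* (ν₁ ℕ.* (ν₁ ℕ.* ν₂))
        B₁ = ≤-trans (≤-reflexive (trans (abs-P f₁) (cong ∣_∣ (sym (polar₁ (+ p) r q w x y x′ y′)))))
          (polar-bound m β α {z} {y} {z} {y} {z′} {y′} β≤ α≤ z≤ y≤ z≤ y≤ z′≤ y′≤)
        B₂ : P ℕ.* ∣ f₂ ∣ ≤ 18 ℕ.* (ν₁ ℕ.* (ν₂ ℕ.* ν₂))
        B₂ = ≤-trans (≤-reflexive (trans (abs-P f₂) (cong ∣_∣ (sym (polar₂ (+ p) r q w x y x′ y′)))))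
          (polar-bound m β α {z} {y} {z′} {y′} {z′} {y′} β≤ α≤ z≤ y≤ z′≤ y′≤ z′≤ y′≤)
        B₃ : P ℕ.* ∣ + 3 * f₃ ∣ ≤ 18 ℕ.* (ν₂ ℕ.* (ν₂ ℕ.* ν₂))
        B₃ = ≤-trans (≤-reflexive (trans (abs-P (+ 3 * f₃)) (cong ∣_∣ (sym (polar₃ (+ p) r q w x y x′ y′)))))
          (polar-bound m β α {z′} {y′} {z′} {y′} {z′} {y′} β≤ α≤ z′≤ y′≤ z′≤ y′≤ z′≤ y′≤)

        ∣f∣≤∣3f∣ : ∀ f → ∣ f ∣ ≤ ∣ + 3 * f ∣
        ∣f∣≤∣3f∣ f = ≤-trans (m≤m+n (∣ f ∣) _) (≤-reflexive (sym (ℤP.abs-* (+ 3) f)))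

        -- A zero `(X , Y)` of the form is a zero `(ζ , Y)` of the cubic, so `ζ / Y` is a rational
        -- root. If `Y` were 0, then `ζ = pX` would vanish, and `X` with it.
        fromRoot : ∀ X Y → X ≢ + 0 ⊎ Y ≢ + 0 → polar β α (+ p * X + r * Y) Y (+ p * X + r * Y) Y (+ p * X + r * Y) Y ≡ + 0 → RootOrCode
        fromRoot X Y nonzero h =
          let (ρ , hρ) = rationalRoot β α ζ Y Y≢0 cubic in
          inj₁ (ρ , root-bound m β α ρ β≤ α≤ hρ , trans hρ (cong₂ (λ s t → s * ρ + t) hβ hα))
          where
          ζ = + p * X + r * Y
          cubic : ζ * ζ * ζ ≡ β * ζ * Y * Y + α * Y * Y * Y
          cubic = polar-zero β α ζ Y h
          Y≢0 : Y ≢ + 0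
          Y≢0 refl = [ (λ X≢0 → X≢0 X≡0) , (λ Y≢0 → Y≢0 refl) ]′ nonzero
            where
            e : ∀ β α ζ → β * ζ * + 0 * + 0 + α * + 0 * + 0 * + 0 ≡ + 0
            e = solve-∀
            e′ : ∀ p X r → p * X + r * + 0 ≡ p * X
            e′ = solve-∀
            pX≡0 : + p * X ≡ + 0
            pX≡0 = trans (sym (e′ (+ p) X r)) (cube-zero ζ (trans cubic (e β α ζ)))
            X≡0 : X ≡ + 0
            X≡0 = [ (λ p≡0 → contradiction (ℤP.+-injective p≡0) (ℕ.≢-nonZero⁻¹ p)) , (λ h → h) ]′ (ℤP.i*j≡0⇒i≡0∨j≡0 (+ p) pX≡0)

        e₁≢0 : x ≢ + 0 ⊎ y ≢ + 0
        e₁≢0 = go (x Data.Integer.≟ + 0) (y Data.Integer.≟ + 0)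
          where
          go : Dec (x ≡ + 0) → Dec (y ≡ + 0) → x ≢ + 0 ⊎ y ≢ + 0
          go (no h) _ = inj₁ h
          go (yes _) (no h) = inj₂ h
          go (yes h) (yes h′) = contradiction (trans (sym det) (cong₂ (λ s t → s * y′ - t * x′) h h′)) λ ()

        e₂≢0 : x′ ≢ + 0 ⊎ y′ ≢ + 0
        e₂≢0 = go (x′ Data.Integer.≟ + 0) (y′ Data.Integer.≟ + 0)
          where
          go : Dec (x′ ≡ + 0) → Dec (y′ ≡ + 0) → x′ ≢ + 0 ⊎ y′ ≢ + 0
          go (no h) _ = inj₁ h
          go (yes _) (no h) = inj₂ h
          go (yes h) (yes h′) = contradiction
            (trans (sym det) (trans (cong₂ (λ s t → x * t - y * s) h h′) (cong₂ _-_ (ℤP.*-zeroʳ x) (ℤP.*-zeroʳ y)))) λ ()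

        zero-polar : ∀ f → f ≡ + 0 → + p * + p * (+ 3 * f) ≡ + 0
        zero-polar f refl = ℤP.*-zeroʳ (+ p * + p)

        ∣3f∣≥1 : ∀ f → f ≢ + 0 → 1 ≤ ∣ + 3 * f ∣
        ∣3f∣≥1 (+ zero) h = contradiction refl h
        ∣3f∣≥1 (+ suc n) h = s≤s z≤n
        ∣3f∣≥1 -[1+ n ] h = s≤s z≤n

        -- A vanishing outer coefficient is a zero of the form at a basis vector and leads to a
        -- root. Otherwise `|3f₀| ≥ 1` turns the upper bound for `f₀` into `p² ≤ 18ν₁³`. This lower
        -- bound on the norms lets the remaining integers vanish without harm to the product
        -- estimate.
        conclusion : RootOrCode
        conclusion = go (f₀ Data.Integer.≟ + 0) (f₃ Data.Integer.≟ + 0)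
          where
          go : Dec (f₀ ≡ + 0) → Dec (f₃ ≡ + 0) → RootOrCode
          go (yes h) _ = fromRoot x y e₁≢0 (trans (polar₀ (+ p) r q w x y x′ y′) (zero-polar f₀ h))
          go (no _) (yes h) = fromRoot x′ y′ e₂≢0 (trans (polar₃ (+ p) r q w x y x′ y′) (zero-polar f₃ h))
          -- As the determinant is 1, `(y′ , −y)` are the coordinates in the reduced basis of the
          -- original `(1 , 0)`, where the form has the value `p`.
          go (no h₀) (no h₃) = inj₂ (f₀ ∷ f₁ ∷ f₂ ∷ f₃ ∷ y′ ∷ (- y) ∷ [] ,
              weight-bound 18 p m K {ν₁} {ν₂} s₀ s₁ s₂ s₃ t u bound p-large , hess , jac)
            where
            P≤ : P ≤ 18 ℕ.* (ν₁ ℕ.* (ν₁ ℕ.* ν₁))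
            P≤ = ≤-trans (≤-trans (≤-reflexive (sym (*-identityʳ P))) (*-monoʳ-≤ P (∣3f∣≥1 f₀ h₀))) B₀
            up : ∀ {A B} → A ≤ B → 18 ℕ.* A ≤ 18 ℕ.* B
            up = *-monoʳ-≤ 18
            c₁ : ν₁ ℕ.* (ν₁ ℕ.* ν₁) ≤ ν₁ ℕ.* (ν₁ ℕ.* ν₂)
            c₁ = *-monoʳ-≤ ν₁ (*-monoʳ-≤ ν₁ ordered)
            c₂ : ν₁ ℕ.* (ν₁ ℕ.* ν₂) ≤ ν₁ ℕ.* (ν₂ ℕ.* ν₂)
            c₂ = *-monoʳ-≤ ν₁ (*-monoˡ-≤ ν₂ ordered)
            c₃ : ν₁ ℕ.* (ν₂ ℕ.* ν₂) ≤ ν₂ ℕ.* (ν₂ ℕ.* ν₂)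
            c₃ = *-monoˡ-≤ (ν₂ ℕ.* ν₂) ordered
            P≤₁ = ≤-trans P≤ (up c₁)
            P≤₂ = ≤-trans P≤₁ (up c₂)
            P≤₃ = ≤-trans P≤₂ (up c₃)
            s₀ : P ℕ.* size f₀ ≤ 18 ℕ.* (ν₁ ℕ.* (ν₁ ℕ.* ν₁))
            s₀ = size-bound f₀ P≤ (≤-trans (*-monoʳ-≤ P (∣f∣≤∣3f∣ f₀)) B₀)
            s₁ : P ℕ.* size f₁ ≤ 18 ℕ.* (ν₁ ℕ.* (ν₁ ℕ.* ν₂))
            s₁ = size-bound f₁ P≤₁ B₁
            s₂ : P ℕ.* size f₂ ≤ 18 ℕ.* (ν₁ ℕ.* (ν₂ ℕ.* ν₂))
            s₂ = size-bound f₂ P≤₂ B₂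
            s₃ : P ℕ.* size f₃ ≤ 18 ℕ.* (ν₂ ℕ.* (ν₂ ℕ.* ν₂))
            s₃ = size-bound f₃ P≤₃ (≤-trans (*-monoʳ-≤ P (∣f∣≤∣3f∣ f₃)) B₃)
            m≤ν₁ : m ≤ ν₁
            m≤ν₁ = cubes-mono (*-cancelˡ-≤ 18 (≤-trans 18m³≤P P≤))
            t : m ℕ.* size y′ ≤ ν₂
            t = size-bound y′ (≤-trans m≤ν₁ ordered) y′≤
            u : m ℕ.* size (- y) ≤ ν₁
            u = size-bound (- y) m≤ν₁ (subst (λ s → m ℕ.* s ≤ ν₁) (sym (ℤP.∣-i∣≡∣i∣ y)) y≤)
            e₁ : ∀ b → + 1 * + 1 * + 1 * + 1 * (+ 3 * (+ 4 * b)) ≡ + 12 * b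
            e₁ = solve-∀
            e₂ : ∀ s → + 1 * + 1 * + 1 * + 1 * + 1 * + 1 * s ≡ s
            e₂ = solve-∀
            hess : hessian f₀ f₁ f₂ f₃ y′ (- y) ≡ + 12 * b
            hess = trans (hessian-φ (+ p) r q w x y x′ y′) (trans (cong₂ (λ s t → s * s * s * s * (+ 3 * t)) det hβ) (e₁ b))
            jac : jacobian f₀ f₁ f₂ f₃ y′ (- y) ≡ + 27 * (a * a)
            jac = trans (jacobian-φ (+ p) r q w x y x′ y′) (trans (cong₂ (λ s t → s * s * s * s * s * s * (+ 27 * t)) det hα) (e₂ (+ 27 * (a * a))))

    rootOrCode : RootOrCode
    rootOrCode = go (doubleRoot pr 5≤p a b p∤a p²∣disc)
      where
      go : ∃[ r ] (+ P ∣ + 3 * r * r - + 4 * b) × (+ P ∣ r * r * r - + 4 * b * r - a * a) → RootOrCode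
      -- From `3r² − 4b = kp²` the third coefficient of the form is `kp`, and from
      -- `r³ − 4br − a² = wp²` the last one is `w`.
      go (r , divides k hk , divides w hw) = Reduction.conclusion r k w hβ hα
        where
        e₁ : ∀ s k p → s ≡ k * (p * p) → s - p * (k * p) ≡ + 0
        e₁ s k p refl = e k p
          where
          e : ∀ k p → k * (p * p) - p * (k * p) ≡ + 0
          e = solve-∀
        e₂ : ∀ s t x → s - t - x ≡ + 0 → s - x ≡ t
        e₂ s t x h = trans (e s t x) (trans (cong (_+ t) h) (ℤP.+-identityˡ t))
          where
          e : ∀ s t x → s - x ≡ s - t - x + t
          e = solve-∀
        hβ : + 3 * r * r - + p * (k * + p) ≡ + 4 * b
        hβ = e₂ (+ 3 * r * r) (+ 4 * b) (+ p * (k * + p)) (e₁ (+ 3 * r * r - + 4 * b) k (+ p) (trans hk (cong (k *_) (ℤP.pos-* p p))))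
        comm : ∀ w p → w * (p * p) ≡ p * p * w
        comm = solve-∀
        hα : r * r * r - (+ 3 * r * r - + p * (k * + p)) * r - + p * + p * w ≡ a * a
        hα = trans (cong (λ s → r * r * r - s * r - + p * + p * w) hβ)
          (e₂ (r * r * r - + 4 * b * r) (a * a) (+ p * + p * w)
            (trans (cong (_- + p * + p * w) (trans hw (trans (cong (w *_) (ℤP.pos-* p p)) (comm w (+ p))))) (ℤP.+-inverseʳ (+ p * + p * w))))

-- Inverse squares, and pairs with a given root or code

module Tail where

  open Sums
  open Tuples
  open Forms
  open import Data.Nat as ℕ using (ℕ; zero; suc; z≤n; _≤_; _<_; _+_; _*_; NonZero)
  open import Data.Nat.Properties
  open import Data.Nat.DivMod using (_/_; m*n/n≡m; m/n*n≤m; /-monoˡ-≤)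
  open import Data.Nat.Tactic.RingSolver using (solve-∀)
  open import Data.Integer as ℤ using (ℤ; +_; -[1+_])
  import Data.Integer.Properties as ℤP
  open import Data.Integer.Divisibility.Signed using (_∣_)
  open import Data.Vec using (Vec; []; _∷_)
  open import Data.Product using (_×_; _,_)
  open import Relation.Nullary using (¬_; Dec; yes; no; contradiction)
  open import Relation.Nullary.Decidable using (_×-dec_; ¬?)
  open import Relation.Binary.PropositionalEquality using (_≡_; _≢_; refl; sym; trans; cong)

  ≤-/ : ∀ k x d .{{_ : NonZero d}} → k * d ≤ x → k ≤ x / d
  ≤-/ k x d h = ≤-trans (≤-reflexive (sym (m*n/n≡m k d))) (/-monoˡ-≤ d h)

  -- Inverse squares beyond a point add up to at most the inverse of that point. The induction
  -- carries the exact value of the telescoping sum after `k` terms, which is weakened only at the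
  -- end.
  Σ-reciprocalSquares : ∀ U M k → suc M * Σ< k (λ i → U / ((suc (suc M) + i) * (suc (suc M) + i))) ≤ U
  Σ-reciprocalSquares U M′ k = *-cancelˡ-≤ (suc M′ + k) (≤-trans (invariant k)
    (≤-trans (*-monoʳ-≤ U (m≤n+m k (suc M′))) (≤-reflexive (*-comm U (suc M′ + k)))))
    where
    M = suc M′
    t : ℕ → ℕ
    t i = U / ((suc M + i) * (suc M + i))
    -- 1/(R + 1)² ≤ 1/R − 1/(R + 1), cleared of denominators
    invariant : ∀ k → (M + k) * (M * Σ< k t) ≤ U * k
    invariant zero = ≤-reflexive (trans (cong ((M + 0) *_) (*-zeroʳ M)) (trans (*-zeroʳ (M + 0)) (sym (*-zeroʳ U))))
    invariant (suc k) = *-cancelˡ-≤ (R * suc R) {{m*n≢0 R (suc R)}} (begin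
      R * suc R * ((M + suc k) * (M * (s + t k))) ≡⟨ cong (λ r → R * suc R * (r * (M * (s + t k)))) (+-suc M k) ⟩
      R * suc R * (suc R * (M * (s + t k))) ≡⟨ e₁ R M s (t k) ⟩
      suc R * suc R * (R * (M * s)) + R * M * (suc R * suc R * t k)
        ≤⟨ +-mono-≤ (*-monoʳ-≤ (suc R * suc R) (invariant k)) (*-monoʳ-≤ (R * M) (≤-trans (≤-reflexive (*-comm (suc R * suc R) (t k))) (m/n*n≤m U (suc R * suc R)))) ⟩
      suc R * suc R * (U * k) + R * M * U ≤⟨ m≤m+n _ (M * U) ⟩
      suc R * suc R * (U * k) + R * M * U + M * U ≡⟨ e₂ M k U ⟩
      R * suc R * (U * suc k) ∎)
      where
      open ≤-Reasoning
      R = M + k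
      s = Σ< k t
      e₁ : ∀ R M s t → R * suc R * (suc R * (M * (s + t))) ≡ suc R * suc R * (R * (M * s)) + R * M * (suc R * suc R * t)
      e₁ = solve-∀
      e₂ : ∀ M k U → suc (M + k) * suc (M + k) * (U * k) + (M + k) * M * U + M * U ≡ (M + k) * suc (M + k) * (U * suc k)
      e₂ = solve-∀

  /-*-/ : ∀ x y p .{{_ : NonZero p}} → (x / p) * (y / p) ≤ (x * y) / suc (ℕ.pred (p * p))
  /-*-/ x y p@(suc _) = ≤-/ _ _ _ (begin
    (x / p) * (y / p) * (p * p) ≡⟨ e (x / p) (y / p) p ⟩
    ((x / p) * p) * ((y / p) * p) ≤⟨ *-mono-≤ (m/n*n≤m x p) (m/n*n≤m y p) ⟩
    x * y ∎)
    where
    open ≤-Reasoning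
    e : ∀ a b p → a * b * (p * p) ≡ (a * p) * (b * p)
    e = solve-∀

  Box-atMostTwo : ∀ B {P : ℤ → Set} (P? : ∀ a → Dec (P a)) →
    (∀ a a′ → P a → P a′ → ℤ.∣ a ∣ ≡ ℤ.∣ a′ ∣) → Box B (λ a → ⟦ P? a ⟧) ≤ 2
  Box-atMostTwo B {P} P? h = begin
    Box B (λ a → ⟦ P? a ⟧)
      ≤⟨ Box-mono B (λ a _ → split a (P? a) (+ 0 ℤ.≤? a)) ⟩
    Box B (λ a → ⟦ P? a ×-dec (+ 0 ℤ.≤? a) ⟧ + ⟦ P? a ×-dec ¬? (+ 0 ℤ.≤? a) ⟧)
      ≡⟨ Σ-+ (suc (B + B)) _ _ ⟩
    Box B (λ a → ⟦ P? a ×-dec (+ 0 ℤ.≤? a) ⟧) + Box B (λ a → ⟦ P? a ×-dec ¬? (+ 0 ℤ.≤? a) ⟧)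
      ≤⟨ +-mono-≤ (Box-atMostOne B (λ a → P? a ×-dec (+ 0 ℤ.≤? a)) λ a a′ (p , s) (p′ , s′) → pos a a′ s s′ (h a a′ p p′))
                  (Box-atMostOne B (λ a → P? a ×-dec ¬? (+ 0 ℤ.≤? a)) λ a a′ (p , s) (p′ , s′) → neg a a′ s s′ (h a a′ p p′)) ⟩
    2 ∎
    where
    open ≤-Reasoning
    split : ∀ a (d : Dec (P a)) (e : Dec (+ 0 ℤ.≤ a)) → ⟦ d ⟧ ≤ ⟦ d ×-dec e ⟧ + ⟦ d ×-dec ¬? e ⟧
    split a (yes _) (yes _) = ≤-refl
    split a (yes _) (no _) = ≤-refl
    split a (no _) _ = z≤n
    pos : ∀ a a′ → + 0 ℤ.≤ a → + 0 ℤ.≤ a′ → ℤ.∣ a ∣ ≡ ℤ.∣ a′ ∣ → a ≡ a′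
    pos (+ m) (+ n) _ _ refl = refl
    neg : ∀ a a′ → ¬ + 0 ℤ.≤ a → ¬ + 0 ℤ.≤ a′ → ℤ.∣ a ∣ ≡ ℤ.∣ a′ ∣ → a ≡ a′
    neg (+ m) _ h _ _ = contradiction (ℤ.+≤+ z≤n) h
    neg -[1+ m ] (+ n) _ h _ = contradiction (ℤ.+≤+ z≤n) h
    neg -[1+ m ] -[1+ n ] _ _ refl = refl

  square-injective : ∀ a a′ → a ℤ.* a ≡ a′ ℤ.* a′ → ℤ.∣ a ∣ ≡ ℤ.∣ a′ ∣
  square-injective a a′ h = ≤-antisym (le eq) (le (sym eq))
    where
    eq : ℤ.∣ a ∣ * ℤ.∣ a ∣ ≡ ℤ.∣ a′ ∣ * ℤ.∣ a′ ∣
    eq = trans (sym (ℤP.abs-* a a)) (trans (cong ℤ.∣_∣ h) (ℤP.abs-* a′ a′))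
    le : ∀ {m n} → m * m ≡ n * n → m ≤ n
    le h = ≮⇒≥ λ n<m → <⇒≢ (*-mono-< n<m n<m) (sym h)

  root? : ∀ a b ρ → Dec (Root a b ρ)
  root? a b ρ = ρ ℤ.* ρ ℤ.* ρ ℤ.≟ + 4 ℤ.* b ℤ.* ρ ℤ.+ a ℤ.* a

  -- With `a` summed innermost, `ρ` and `b` fix `a² = ρ³ − 4bρ` and leave at most two values of `a`.
  -- The saving comes from the roots being O(`n²`) while `a` ranges up to about `n³`.
  rootCount : ∀ R α β → Box α (λ a → Box β (λ b → Box R (λ ρ → ⟦ root? a b ρ ⟧))) ≤ suc (R + R) * (suc (β + β) * 2)
  rootCount R α β = begin
    Box α (λ a → Box β (λ b → Box R (λ ρ → ⟦ root? a b ρ ⟧)))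
      ≡⟨ Σ-cong (suc (α + α)) (λ i _ → Σ-swap (suc (β + β)) (suc (R + R)) _) ⟩
    Box α (λ a → Box R (λ ρ → Box β (λ b → ⟦ root? a b ρ ⟧)))
      ≡⟨ Σ-swap (suc (α + α)) (suc (R + R)) _ ⟩
    Box R (λ ρ → Box α (λ a → Box β (λ b → ⟦ root? a b ρ ⟧)))
      ≡⟨ Σ-cong (suc (R + R)) (λ i _ → Σ-swap (suc (α + α)) (suc (β + β)) _) ⟩
    Box R (λ ρ → Box β (λ b → Box α (λ a → ⟦ root? a b ρ ⟧)))
      ≤⟨ Σ-≤const (suc (R + R)) _ (λ i _ → Σ-≤const (suc (β + β)) 2 λ j _ → two (ℤ.- (+ β) ℤ.+ + j) (ℤ.- (+ R) ℤ.+ + i)) ⟩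
    suc (R + R) * (suc (β + β) * 2) ∎
    where
    open ≤-Reasoning
    two : ∀ b ρ → Box α (λ a → ⟦ root? a b ρ ⟧) ≤ 2
    two b ρ = Box-atMostTwo α (λ a → root? a b ρ) λ a a′ h h′ →
      square-injective a a′ (+ℤ-cancelˡ (+ 4 ℤ.* b ℤ.* ρ) (trans (sym h) h′))

  code? : ∀ a b v → Dec (Code a b v)
  code? a b (f₀ ∷ f₁ ∷ f₂ ∷ f₃ ∷ u ∷ v ∷ []) =
    (hessian f₀ f₁ f₂ f₃ u v ℤ.≟ + 12 ℤ.* b) ×-dec (jacobian f₀ f₁ f₂ f₃ u v ℤ.≟ + 27 ℤ.* (a ℤ.* a))

  -- The two conditions separate: `h` fixes `b`, and `j` fixes `a²`, hence `a` up to sign.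
  fibre : ∀ α β h j → Box α (λ a → Box β (λ b → ⟦ (h ℤ.≟ + 12 ℤ.* b) ×-dec (j ℤ.≟ + 27 ℤ.* (a ℤ.* a)) ⟧)) ≤ 2
  fibre α β h j = begin
    Box α (λ a → Box β (λ b → ⟦ (h ℤ.≟ + 12 ℤ.* b) ×-dec (j ℤ.≟ + 27 ℤ.* (a ℤ.* a)) ⟧))
      ≡⟨ Box-cong α (λ a → trans (Box-cong β λ b → ⟦⟧-× (h ℤ.≟ + 12 ℤ.* b) (j ℤ.≟ + 27 ℤ.* (a ℤ.* a))) (Σ-*ʳ (suc (β + β)) (J a) (λ i → I (ℤ.- (+ β) ℤ.+ + i)))) ⟩
    Box α (λ a → Box β I * J a)
      ≡⟨ Σ-* (suc (α + α)) (Box β I) (λ i → J (ℤ.- (+ α) ℤ.+ + i)) ⟩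
    Box β I * Box α J
      ≤⟨ *-mono-≤ (Box-atMostOne β (λ b → h ℤ.≟ + 12 ℤ.* b) λ b b′ e e′ → ℤP.*-cancelˡ-≡ (+ 12) b b′ (trans (sym e) e′))
                  (Box-atMostTwo α (λ a → j ℤ.≟ + 27 ℤ.* (a ℤ.* a)) λ a a′ e e′ →
                    square-injective a a′ (ℤP.*-cancelˡ-≡ (+ 27) (a ℤ.* a) (a′ ℤ.* a′) (trans (sym e) e′))) ⟩
    2 ∎
    where
    open ≤-Reasoning
    I J : ℤ → ℕ
    I b = ⟦ h ℤ.≟ + 12 ℤ.* b ⟧
    J a = ⟦ j ℤ.≟ + 27 ℤ.* (a ℤ.* a) ⟧

  codeFibre : ∀ α β v → Box α (λ a → Box β (λ b → ⟦ code? a b v ⟧)) ≤ 2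
  codeFibre α β (f₀ ∷ f₁ ∷ f₂ ∷ f₃ ∷ u ∷ v ∷ []) = fibre α β (hessian f₀ f₁ f₂ f₃ u v) (jacobian f₀ f₁ f₂ f₃ u v)

  ΣT-fibres : ∀ k T α β {F : ℤ → ℤ → Vec ℤ k → ℕ} c → (∀ v → Box α (λ a → Box β (λ b → F a b v)) ≤ c) →
    Box α (λ a → Box β (λ b → ΣT k T (F a b))) ≤ c * ΣT k T (λ _ → 1)
  ΣT-fibres k T α β {F} c h = begin
    Box α (λ a → Box β (λ b → ΣT k T (F a b)))
      ≡⟨ Box-cong α (λ a → ΣT-swap k T (ℤ.- (+ β)) (suc (β + β)) (F a)) ⟩
    Box α (λ a → ΣT k T (λ v → Box β (λ b → F a b v)))
      ≡⟨ ΣT-swap k T (ℤ.- (+ α)) (suc (α + α)) (λ a v → Box β (λ b → F a b v)) ⟩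
    ΣT k T (λ v → Box α (λ a → Box β (λ b → F a b v)))
      ≤⟨ ΣT-mono k T (λ v → ≤-trans (h v) (≤-reflexive (sym (*-identityʳ c)))) ⟩
    ΣT k T (λ _ → c * 1)
      ≡⟨ ΣT-* k T c (λ _ → 1) ⟩
    c * ΣT k T (λ _ → 1) ∎
    where open ≤-Reasoning

  codeCount : ∀ T α β → Box α (λ a → Box β (λ b → ΣT 6 T (λ v → ⟦ code? a b v ⟧))) ≤ 2 * ΣT 6 T (λ _ → 1)
  codeCount T α β = ΣT-fibres 6 T α β {λ a b v → ⟦ code? a b v ⟧} 2 (codeFibre α β)

-- Pairs spoiled only by a prime above M

module Except where

  open Sums
  open Divs
  open Periodic
  open Local
  open Density
  open Tuples
  open Forms
  open Core
  open Tail
  open import Defs using (disc; Squarefree; squarefree?)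
  open import Data.Nat as ℕ using (ℕ; suc; s≤s; z≤n; _≤_; _<_; _+_; _*_; _∸_; NonZero)
  open import Data.Nat.Properties
  import Data.Nat.Divisibility as ℕD
  open import Data.Nat.DivMod using (_/_; m/n*n≤m; m≡m%n+[m/n]*n; m%n<n)
  open import Data.Nat.Primality using (Prime; prime?; ¬prime[0]; ¬prime[1]; composite[4]; prime⇒¬composite)
  open import Data.Nat.Tactic.RingSolver using (solve-∀)
  open import Data.Integer as ℤ using (ℤ; +_)
  import Data.Integer.Properties as ℤP
  open import Data.Integer.Divisibility.Signed using (_∣_; _∣?_; ∣⇒∣ᵤ; ∣ᵤ⇒∣; divides)
  open import Data.Product using (_×_; _,_; ∃-syntax; proj₁; proj₂)
  open import Data.Sum using (inj₁; inj₂)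
  open import Relation.Nullary using (¬_; Dec; yes; no; contradiction)
  open import Relation.Nullary.Decidable using (_×-dec_; ¬?)
  open import Relation.Binary.PropositionalEquality using (_≡_; _≢_; refl; sym; trans; cong; cong₂; subst)

  -- An interval of `2γ + 1` integers has at most `(2γ + 1)/p + 1` multiples of `p`, and `p ≤ γ`
  -- absorbs the final 1 into the constant 4.
  multiples-bound : ∀ p γ .{{_ : NonZero p}} → p ≤ γ → Box γ (λ a → ⟦ + p ∣? a ⟧) ≤ (4 * γ) / p
  multiples-bound p γ p≤γ = ≤-trans
    (proj₂ (W-quot (∣-indicator-periodic p) (ℤ.- (+ γ)) (suc (γ + γ))))
    (≤-trans (≤-reflexive (trans (cong (λ c → L / p * c + c) (Per-∣-indicator p)) (cong (_+ 1) (*-identityʳ (L / p)))))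
      (≤-/ (L / p + 1) (4 * γ) p (begin
        (L / p + 1) * p ≡⟨ *-distribʳ-+ p (L / p) 1 ⟩
        L / p * p + 1 * p ≤⟨ +-mono-≤ (m/n*n≤m L p) (≤-trans (≤-reflexive (*-identityˡ p)) p≤γ) ⟩
        suc (γ + γ) + γ ≤⟨ +-monoˡ-≤ γ (+-monoˡ-≤ (γ + γ) (≤-trans (ℕ.>-nonZero⁻¹ p) p≤γ)) ⟩
        γ + (γ + γ) + γ ≡⟨ e γ ⟩
        4 * γ ∎)))
    where
    open ≤-Reasoning
    L = suc (γ + γ)
    e : ∀ γ → γ + (γ + γ) + γ ≡ 4 * γ
    e = solve-∀

  both unit : ℕ → ℤ → ℤ → ℕ
  both p a b = ⟦ + p ∣? a ⟧ * ⟦ + p ∣? b ⟧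
  unit p a b = ⟦ prime? p ×-dec ¬? (+ p ∣? a) ⟧ * divDisc (p * p) a b

  Box-both : ∀ p α β .{{_ : NonZero p}} → p ≤ α → α ≤ β → Box α (λ a → Box β (both p a)) ≤ (4 * α) / p * ((4 * β) / p)
  Box-both p α β p≤α α≤β = begin
    Box α (λ a → Box β (both p a)) ≡⟨ Box-cong α (λ a → Σ-* (suc (β + β)) ⟦ + p ∣? a ⟧ (λ i → ⟦ + p ∣? (ℤ.- (+ β) ℤ.+ + i) ⟧)) ⟩
    Box α (λ a → ⟦ + p ∣? a ⟧ * Box β (λ b → ⟦ + p ∣? b ⟧)) ≡⟨ Σ-*ʳ (suc (α + α)) (Box β (λ b → ⟦ + p ∣? b ⟧)) (λ i → ⟦ + p ∣? (ℤ.- (+ α) ℤ.+ + i) ⟧) ⟩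
    Box α (λ a → ⟦ + p ∣? a ⟧) * Box β (λ b → ⟦ + p ∣? b ⟧) ≤⟨ *-mono-≤ (multiples-bound p α p≤α) (multiples-bound p β (≤-trans p≤α α≤β)) ⟩
    (4 * α) / p * ((4 * β) / p) ∎
    where open ≤-Reasoning

  -- Each row `a` prime to `p` meets at most three classes of `b` modulo `p²`; the last 3 pays for
  -- an incomplete period.
  Box-unit : ∀ p α β .{{_ : NonZero (p * p)}} → 5 ≤ p →
    Box α (λ a → Box β (unit p a)) ≤ suc (α + α) * (suc (β + β) / (p * p) * 3 + 3)
  Box-unit p α β 5≤p = Σ-≤const (suc (α + α)) _ λ i _ → row (ℤ.- (+ α) ℤ.+ + i)
    where
    L = suc (β + β)
    row : ∀ a → Box β (unit p a) ≤ L / (p * p) * 3 + 3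
    row a = ≤-trans (≤-reflexive (Σ-* L ⟦ prime? p ×-dec ¬? (+ p ∣? a) ⟧ (λ i → divDisc (p * p) a (ℤ.- (+ β) ℤ.+ + i)))) (go (prime? p ×-dec ¬? (+ p ∣? a)))
      where
      go : (d : Dec (Prime p × ¬ (+ p ∣ a))) → ⟦ d ⟧ * Box β (divDisc (p * p) a) ≤ L / (p * p) * 3 + 3
      go (no _) = z≤n
      go (yes (pr , p∤a)) = ≤-trans (≤-reflexive (*-identityˡ _))
        (≤-trans (proj₂ (W-quot (proj₂ (divDisc-periodic (p * p)) a) (ℤ.- (+ β)) L))
          (+-mono-≤ (*-monoʳ-≤ (L / (p * p)) three) three))
        where
        three : Per (p * p) (divDisc (p * p) a) ≤ 3
        three = atMostThreeRoots pr 5≤p {a} p∤a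

  rootTerm codeTerm : ℕ → ℤ → ℤ → ℕ
  rootTerm R a b = Box R (λ ρ → ⟦ root? a b ρ ⟧)
  codeTerm T a b = ΣT 6 T (λ v → ⟦ code? a b v ⟧)

  rootTerm≥1 : ∀ R a b ρ → ℤ.∣ ρ ∣ ≤ R → Root a b ρ → 1 ≤ rootTerm R a b
  rootTerm≥1 R a b ρ h r = ≤-trans (≤-reflexive (sym (⟦⟧-yes (root? a b ρ) r))) (Box-term R (λ ρ → ⟦ root? a b ρ ⟧) ρ h)

  codeTerm≥1 : ∀ T a b v → weight v ≤ T → Code a b v → 1 ≤ codeTerm T a b
  codeTerm≥1 T a b v h c = ≤-trans (≤-reflexive (sym (⟦⟧-yes (code? a b v) c))) (ΣT-term 6 T (λ v → ⟦ code? a b v ⟧) v h)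

  prime≥5 : ∀ {p} → Prime p → p ≢ 2 → p ≢ 3 → 5 ≤ p
  prime≥5 {0} pr _ _ = contradiction pr ¬prime[0]
  prime≥5 {1} pr _ _ = contradiction pr ¬prime[1]
  prime≥5 {2} _ h _ = contradiction refl h
  prime≥5 {3} _ _ h = contradiction refl h
  prime≥5 {4} pr _ _ = contradiction composite[4] (prime⇒¬composite pr)
  prime≥5 {suc (suc (suc (suc (suc p))))} _ _ _ = s≤s (s≤s (s≤s (s≤s (s≤s z≤n))))

  -- A prime whose square divides `d ≠ 0` is at most `|d|`, so a bounded search extracts a witness
  -- from the negation.
  notSquarefree : ∀ d → d ≢ + 0 → ¬ Squarefree d → ∃[ p ] Prime p × (+ (p * p) ∣ d)
  notSquarefree d d≢0 h = go (anyUpTo? (λ p → prime? p ×-dec (+ (p * p) ∣? d)) (suc ℤ.∣ d ∣))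
    where
    go : Dec (∃[ p ] p < suc ℤ.∣ d ∣ × Prime p × (+ (p * p) ∣ d)) → ∃[ p ] Prime p × (+ (p * p) ∣ d)
    go (yes (p , _ , pr , dv)) = p , pr , dv
    go (no none) = contradiction (d≢0 , λ p pr dv → none (p , s≤s (ℕD.∣⇒≤ {{ℕ.≢-nonZero λ e → d≢0 (ℤP.∣i∣≡0⇒i≡0 e)}} (ℕD.∣-trans (ℕD.m∣m*n p) dv)) , pr , ∣ᵤ⇒∣ dv)) h

  module _ (M′ : ℕ) (5≤M : 5 ≤ suc M′) (S : Sieve (suc M′)) (n α β : ℕ) .{{n≢0 : NonZero n}}
    (α≤ : α ≤ n * n * n) (β≤ : β ≤ n * n * (n * n)) (α≤β : α ≤ β) (β-large : n * n * (n * n) ≤ 16 * β)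
    (K : ℕ) (K≡ : K ≡ suc M′ * 16) (n-large : 18 * (K * K) ≤ n * n)
    (c : ℕ) (c-large : 18 * 18 * 18 * 18 * 128 ≤ c)
    (T : ℕ) (T-large : n * n * (n * n) * (n * n) * (K * c) ≤ T) where

    open Sieve S

    private
      M m Z La Lb : ℕ
      M = suc M′
      m = n * n
      Z = β / M
      La = suc (α + α)
      Lb = suc (β + β)

      bothSum unitSum : ℤ → ℤ → ℕ
      bothSum a b = Σ< (α ∸ M) (λ i → both (suc M + i) a b)
      unitSum a b = Σ< (Z ∸ M) (λ i → unit (suc M + i) a b)

      -- Dominates the indicator of the pairs that pass the sieve without having a squarefree
      -- discriminant. The row `a = 0` is set apart, since there `p ∣ a` puts no bound on `p`.
      bad : ℤ → ℤ → ℕ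
      bad a b = ⟦ a ℤ.≟ + 0 ⟧ + (bothSum a b + (unitSum a b + (rootTerm (3 * m) a b + codeTerm T a b)))

      in-range : ∀ {p R} (g : ℕ → ℕ) → M < p → p ≤ R → g p ≤ Σ< (R ∸ M) (λ i → g (suc M + i))
      in-range {p} {R} g M<p p≤R = subst (λ x → g x ≤ Σ< (R ∸ M) (λ i → g (suc M + i))) (m+[n∸m]≡n M<p)
        (Σ-term (R ∸ M) (λ i → g (suc M + i)) (p ∸ suc M) (≤-trans (≤-reflexive (sym (+-∸-assoc 1 M<p))) (∸-monoˡ-≤ M p≤R)))

      bad≥1 : ∀ a b p → ℤ.∣ a ∣ ≤ α → ℤ.∣ b ∣ ≤ β → a ≢ + 0 → Prime p → 5 ≤ p → M < p → + (p * p) ∣ disc a b →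
        1 ≤ bothSum a b + (unitSum a b + (rootTerm (3 * m) a b + codeTerm T a b))
      bad≥1 a b p a≤ b≤ a≢0 pr 5≤p M<p d = go (+ p ∣? a) (p ≤? Z)
        where
        go : Dec (+ p ∣ a) → Dec (p ≤ Z) → 1 ≤ bothSum a b + (unitSum a b + (rootTerm (3 * m) a b + codeTerm T a b))
        go (yes p∣a) _ = ≤-trans (≤-trans one (in-range (λ p → both p a b) M<p p≤α)) (m≤m+n (bothSum a b) _)
          where
          p≤α : p ≤ α
          p≤α = ≤-trans (ℕD.∣⇒≤ {{ℕ.≢-nonZero λ e → a≢0 (ℤP.∣i∣≡0⇒i≡0 e)}} (∣⇒∣ᵤ p∣a)) a≤
          one : 1 ≤ both p a b
          one = ≤-reflexive (sym (cong₂ _*_ (⟦⟧-yes (+ p ∣? a) p∣a) (⟦⟧-yes (+ p ∣? b) (∣disc∧∣a⇒∣b pr 5≤p a b (∣-square d) p∣a))))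
        go (no p∤a) (yes p≤Z) = ≤-trans (≤-trans (≤-trans one (in-range (λ p → unit p a b) M<p p≤Z)) (m≤m+n (unitSum a b) _)) (m≤n+m _ (bothSum a b))
          where
          one : 1 ≤ unit p a b
          one = ≤-reflexive (sym (cong₂ _*_ (⟦⟧-yes (prime? p ×-dec ¬? (+ p ∣? a)) (pr , p∤a)) (⟦⟧-yes (+ (p * p) ∣? disc a b) d)))
        go (no p∤a) (no p≰Z) = ≤-trans (≤-trans (last (rootOrCode n K p a b pr 5≤p p∤a d (≤-trans a≤ α≤) (≤-trans b≤ β≤) n≢0′ p-large n-large)) (m≤n+m _ (unitSum a b))) (m≤n+m _ (bothSum a b))
          where
          n≢0′ : NonZero n
          n≢0′ = ℕ.≢-nonZero λ { refl → ℕ.≢-nonZero⁻¹ n refl }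
          β<pM : β < p * M
          β<pM = begin-strict
            β ≡⟨ m≡m%n+[m/n]*n β M ⟩
            β ℕ.% M + Z * M <⟨ +-monoˡ-< (Z * M) (m%n<n β M) ⟩
            M + Z * M ≤⟨ *-monoˡ-≤ M (≰⇒> p≰Z) ⟩
            p * M ∎
            where open ≤-Reasoning
          -- From `p > β/M` and `n⁴ ≤ 16β` one gets `n⁴ ≤ 16pM`, which is the origin of `K = 16M`.
          p-large : m * m ≤ p * K
          p-large = ≤-trans β-large (≤-trans (*-monoʳ-≤ 16 (<⇒≤ β<pM)) (≤-reflexive (trans (e p M) (cong (p *_) (sym K≡)))))
            where
            e : ∀ p M → 16 * (p * M) ≡ p * (M * 16)
            e = solve-∀
          last : RootOrCode n K p a b pr 5≤p p∤a d (≤-trans a≤ α≤) (≤-trans b≤ β≤) n≢0′ p-large n-large → 1 ≤ rootTerm (3 * m) a b + codeTerm T a b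
          last (inj₁ (ρ , h , r)) = ≤-trans (rootTerm≥1 (3 * m) a b ρ h r) (m≤m+n (rootTerm (3 * m) a b) (codeTerm T a b))
          last (inj₂ (v , h , k)) = ≤-trans (codeTerm≥1 T a b v (≤-trans h (≤-trans (*-monoʳ-≤ (m * m * m) (*-monoʳ-≤ K c-large)) T-large)) k) (m≤n+m (codeTerm T a b) (rootTerm (3 * m) a b))

      pointwise : ∀ a b → ℤ.∣ a ∣ ≤ α → ℤ.∣ b ∣ ≤ β → ind a b ≤ ⟦ squarefree? (disc a b) ⟧ + bad a b
      pointwise a b a≤ b≤ = go (ind a b ℕ.≟ 1) (squarefree? (disc a b)) (a ℤ.≟ + 0)
        where
        rest = bothSum a b + (unitSum a b + (rootTerm (3 * m) a b + codeTerm T a b))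
        go : Dec (ind a b ≡ 1) → (s : Dec (Squarefree (disc a b))) → (z : Dec (a ≡ + 0)) → ind a b ≤ ⟦ s ⟧ + (⟦ z ⟧ + rest)
        go (no ≢1) s z = ≤-trans (≤-reflexive (n<1⇒n≡0 (≤∧≢⇒< (ind≤1 a b) ≢1))) z≤n
        go (yes i≡1) (yes _) z = ≤-trans (ind≤1 a b) (m≤m+n 1 _)
        go (yes i≡1) (no _) (yes _) = ≤-trans (ind≤1 a b) (m≤m+n 1 _)
        go (yes i≡1) (no ¬s) (no a≢0) = ≤-trans (ind≤1 a b) (found (notSquarefree (disc a b) d≢0 ¬s))
          where
          s₄ = proj₁ (sound a b i≡1)
          s₉ = proj₁ (proj₂ (sound a b i≡1))
          d≢0 : disc a b ≢ + 0
          d≢0 h = s₄ (divides (+ 0) h)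
          found : ∃[ p ] Prime p × (+ (p * p) ∣ disc a b) → 1 ≤ rest
          found (p , pr , d) = bad≥1 a b p a≤ b≤ a≢0 pr 5≤p M<p d
            where
            5≤p : 5 ≤ p
            5≤p = prime≥5 pr (λ { refl → s₄ d }) (λ { refl → s₉ d })
            M<p : M < p
            M<p = ≰⇒> λ p≤M → proj₂ (proj₂ (sound a b i≡1)) p pr 5≤p p≤M d

      BB : (ℤ → ℤ → ℕ) → ℕ
      BB f = Box α (λ a → Box β (f a))

      BB-+ : ∀ f g → BB (λ a b → f a b + g a b) ≡ BB f + BB g
      BB-+ f g = trans (Box-cong α λ a → Σ-+ Lb (λ j → f a (ℤ.- (+ β) ℤ.+ + j)) (λ j → g a (ℤ.- (+ β) ℤ.+ + j)))
        (Σ-+ La (λ i → Box β (f (ℤ.- (+ α) ℤ.+ + i))) (λ i → Box β (g (ℤ.- (+ α) ℤ.+ + i))))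

      BB-Σ : ∀ k (f : ℕ → ℤ → ℤ → ℕ) → BB (λ a b → Σ< k (λ i → f i a b)) ≡ Σ< k (λ i → BB (f i))
      BB-Σ k f = trans (Box-cong α λ a → Σ-swap Lb k (λ j i → f i a (ℤ.- (+ β) ℤ.+ + j))) (Σ-swap La k (λ j i → Box β (f i (ℤ.- (+ α) ℤ.+ + j))))

      zero-bound : BB (λ a b → ⟦ a ℤ.≟ + 0 ⟧) ≤ Lb
      zero-bound = begin
        BB (λ a b → ⟦ a ℤ.≟ + 0 ⟧) ≡⟨ Box-cong α (λ a → Σ-const Lb ⟦ a ℤ.≟ + 0 ⟧) ⟩
        Box α (λ a → Lb * ⟦ a ℤ.≟ + 0 ⟧) ≡⟨ Σ-* La Lb (λ i → ⟦ (ℤ.- (+ α) ℤ.+ + i) ℤ.≟ + 0 ⟧) ⟩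
        Lb * Box α (λ a → ⟦ a ℤ.≟ + 0 ⟧) ≤⟨ *-monoʳ-≤ Lb (Box-atMostOne α (λ a → a ℤ.≟ + 0) λ a a′ h h′ → trans h (sym h′)) ⟩
        Lb * 1 ≡⟨ *-identityʳ Lb ⟩
        Lb ∎
        where open ≤-Reasoning

      both-bound : M * BB bothSum ≤ 4 * α * (4 * β)
      both-bound = begin
        M * BB bothSum ≡⟨ cong (M *_) (BB-Σ (α ∸ M) (λ i → both (suc M + i))) ⟩
        M * Σ< (α ∸ M) (λ i → BB (both (suc M + i)))
          ≤⟨ *-monoʳ-≤ M (Σ-mono (α ∸ M) λ i i< → ≤-trans (Box-both (suc M + i) α β (p≤α i i<) α≤β) (/-*-/ (4 * α) (4 * β) (suc M + i))) ⟩
        M * Σ< (α ∸ M) (λ i → (4 * α * (4 * β)) / ((suc M + i) * (suc M + i)))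
          ≤⟨ Σ-reciprocalSquares (4 * α * (4 * β)) M′ (α ∸ M) ⟩
        4 * α * (4 * β) ∎
        where
        open ≤-Reasoning
        p≤α : ∀ i → i < α ∸ M → suc M + i ≤ α
        p≤α i i< = ≤-trans (≤-reflexive (sym (+-suc M i))) (≤-trans (+-monoʳ-≤ M i<) (≤-reflexive (m+[n∸m]≡n {M} {α} (<⇒≤ (m∸n≢0⇒n<m λ e → contradiction (subst (i <_) e i<) λ ())))))

      -- The additive 1 of each modulus is the dangerous part. There are at most `Z = β / M` moduli,
      -- so even after multiplication by `M` these terms cost at most `3β` per row.
      unit-bound : M * BB unitSum ≤ La * 3 * (Lb + M * Z)
      unit-bound = begin
        M * BB unitSum ≡⟨ cong (M *_) (BB-Σ (Z ∸ M) (λ i → unit (suc M + i))) ⟩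
        M * Σ< (Z ∸ M) (λ i → BB (unit (suc M + i)))
          ≤⟨ *-monoʳ-≤ M (Σ-mono (Z ∸ M) λ i _ → ≤-trans (Box-unit (suc M + i) α β (≤-trans 5≤M (≤-trans (n≤1+n M) (m≤m+n (suc M) i)))) (≤-reflexive (e₁ La (t i)))) ⟩
        M * Σ< (Z ∸ M) (λ i → La * 3 * (t i + 1)) ≡⟨ cong (M *_) (trans (Σ-* (Z ∸ M) (La * 3) (λ i → t i + 1)) (cong (La * 3 *_) (trans (Σ-+ (Z ∸ M) t (λ _ → 1)) (cong (_+_ (Σ< (Z ∸ M) t)) (trans (Σ-const (Z ∸ M) 1) (*-identityʳ (Z ∸ M))))))) ⟩
        M * (La * 3 * (Σ< (Z ∸ M) t + (Z ∸ M))) ≡⟨ e₂ M (La * 3) (Σ< (Z ∸ M) t) (Z ∸ M) ⟩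
        La * 3 * (M * Σ< (Z ∸ M) t + M * (Z ∸ M)) ≤⟨ *-monoʳ-≤ (La * 3) (+-mono-≤ (Σ-reciprocalSquares Lb M′ (Z ∸ M)) (*-monoʳ-≤ M (m∸n≤m Z M))) ⟩
        La * 3 * (Lb + M * Z) ∎
        where
        open ≤-Reasoning
        t : ℕ → ℕ
        t i = Lb / ((suc M + i) * (suc M + i))
        e₁ : ∀ L t → L * (t * 3 + 3) ≡ L * 3 * (t + 1)
        e₁ = solve-∀
        e₂ : ∀ M L s z → M * (L * (s + z)) ≡ L * (M * s + M * z)
        e₂ = solve-∀

    -- Everything is multiplied by `M`, so an error is acceptable as soon as it is a constant times
    -- the number of pairs. The error terms belong, in this order, to `a = 0`, to `p ∣ a`, to
    -- `p ∤ a` below the cut, to roots and to codes.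
    exceptions : M * BB ind ≤ M * BB (λ a b → ⟦ squarefree? (disc a b) ⟧)
      + (M * Lb + (4 * α * (4 * β) + (La * 3 * (Lb + M * Z) + (M * (suc (3 * m + 3 * m) * (Lb * 2)) + M * (2 * ΣT 6 T (λ _ → 1))))))
    exceptions = begin
      M * BB ind
        ≤⟨ *-monoʳ-≤ M (Box-mono α λ a a≤ → Box-mono β λ b b≤ → pointwise a b a≤ b≤) ⟩
      M * BB (λ a b → ⟦ squarefree? (disc a b) ⟧ + bad a b)
        ≡⟨ cong (M *_) split ⟩
      M * (s + (z + (bs + (us + (rs + cs)))))
        ≡⟨ e M s z bs us rs cs ⟩
      M * s + (M * z + (M * bs + (M * us + (M * rs + M * cs))))
        ≤⟨ +-monoʳ-≤ (M * s) (+-mono-≤ (*-monoʳ-≤ M zero-bound) (+-mono-≤ both-bound (+-mono-≤ unit-bound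
             (+-mono-≤ (*-monoʳ-≤ M (rootCount (3 * m) α β)) (*-monoʳ-≤ M (codeCount T α β)))))) ⟩
      M * s + (M * Lb + (4 * α * (4 * β) + (La * 3 * (Lb + M * Z) + (M * (suc (3 * m + 3 * m) * (Lb * 2)) + M * (2 * ΣT 6 T (λ _ → 1)))))) ∎
      where
      open ≤-Reasoning
      sq zr : ℤ → ℤ → ℕ
      sq a b = ⟦ squarefree? (disc a b) ⟧
      zr a b = ⟦ a ℤ.≟ + 0 ⟧
      s = BB sq
      z = BB zr
      bs = BB bothSum
      us = BB unitSum
      rs = BB (rootTerm (3 * m))
      cs = BB (codeTerm T)
      split : BB (λ a b → sq a b + bad a b) ≡ s + (z + (bs + (us + (rs + cs))))
      split = trans (BB-+ sq bad) (cong (_+_ s) (trans (BB-+ zr (λ a b → bothSum a b + (unitSum a b + (rootTerm (3 * m) a b + codeTerm T a b)))) (cong (_+_ z)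
        (trans (BB-+ bothSum (λ a b → unitSum a b + (rootTerm (3 * m) a b + codeTerm T a b))) (cong (_+_ bs)
          (trans (BB-+ unitSum (λ a b → rootTerm (3 * m) a b + codeTerm T a b)) (cong (_+_ us) (BB-+ (rootTerm (3 * m)) (codeTerm T)))))))))
      e : ∀ M s z b u r c → M * (s + (z + (b + (u + (r + c))))) ≡ M * s + (M * z + (M * b + (M * u + (M * r + M * c))))
      e = solve-∀

-- Powers against logarithms

module Growth where

  open import Data.Nat
  open import Data.Nat.Properties
  open import Data.Nat.Tactic.RingSolver using (solve-∀)
  open import Data.Product using (_×_; _,_; ∃-syntax)
  open import Data.Sum using (inj₁; inj₂)
  open import Relation.Binary.PropositionalEquality using (_≡_; sym; trans; cong; subst)

  n<2^n : ∀ n → n < 2 ^ n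
  n<2^n zero = s≤s z≤n
  n<2^n (suc n) = begin-strict
    1 + n <⟨ +-monoʳ-< 1 (n<2^n n) ⟩
    1 + 2 ^ n ≤⟨ +-monoˡ-≤ (2 ^ n) (m^n>0 2 n) ⟩
    2 ^ n + 2 ^ n ≡⟨ cong (2 ^ n +_) (sym (+-identityʳ (2 ^ n))) ⟩
    2 ^ suc n ∎
    where open ≤-Reasoning

  power-bracket : ∀ b → 1 < b → ∀ n → 1 ≤ n → ∃[ i ] (b ^ i ≤ n × n < b ^ suc i)
  power-bracket b 1<b (suc zero) _ = 0 , ≤-refl , ≤-trans 1<b (≤-reflexive (sym (*-identityʳ b)))
  power-bracket b 1<b (suc (suc n)) _ with power-bracket b 1<b (suc n) (s≤s z≤n)
  ... | i , lo , hi with m≤n⇒m<n∨m≡n hi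
  ... | inj₁ lt = i , ≤-trans lo (n≤1+n (suc n)) , lt
  ... | inj₂ eq = suc i , ≤-reflexive (sym eq) , subst (_< b ^ suc (suc i)) (sym eq) (^-monoʳ-< b 1<b (n<1+n (suc i)))

  pow₆ : ∀ a b → (a * b) ^ 6 ≡ a ^ 6 * b ^ 6
  pow₆ = e
    where
    e : ∀ a b → (a * b) * ((a * b) * ((a * b) * ((a * b) * ((a * b) * ((a * b) * 1))))) ≡ (a * (a * (a * (a * (a * (a * 1)))))) * (b * (b * (b * (b * (b * (b * 1))))))
    e = solve-∀

  -- With 128^i ≤ n < 128^(i+1) one may take k = 42(i + 1) + D, because i⁷ ≤ (2^i)⁷ ≤ n.

  growth : ∀ G D → ∃[ n₀ ] (∀ n → n₀ ≤ n → 1 ≤ n → ∃[ k ]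
    ((n * n) * (n * n) * (n * n) * D < 2 ^ k × G * (2 * suc k) ^ 6 ≤ n))
  growth G D = 128 ^ I₀ , λ n n₀≤n 1≤n → conclude n n₀≤n (power-bracket 128 (s≤s (s≤s z≤n)) n 1≤n)
    where
    w I₀ : ℕ
    -- With `s = i + 1` one has `42s + D + 1 ≤ (43 + D)s`, so `2(k + 1) ≤ ws`. The 64 in `I₀` is
    -- `2⁶`, coming from `s ≤ 2i`.
    w = 2 * (43 + D)
    I₀ = suc (G * w ^ 6 * 64)
    conclude : ∀ n → 128 ^ I₀ ≤ n → ∃[ i ] (128 ^ i ≤ n × n < 128 ^ suc i) → ∃[ k ]
      ((n * n) * (n * n) * (n * n) * D < 2 ^ k × G * (2 * suc k) ^ 6 ≤ n)
    conclude n n₀≤n (i , lo , hi) = k , small , large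
      where
      open ≤-Reasoning
      s = suc i
      -- Here 42 is `7 · 6`, since `n` is below `2^(7s)` and its sixth power is needed; the summand
      -- `D` suffices because `D < 2^D`.
      k = 42 * s + D
      I₀≤i : I₀ ≤ i
      I₀≤i = ≮⇒≥ λ i<I₀ → <⇒≱ hi (≤-trans (^-monoʳ-≤ 128 i<I₀) n₀≤n)
      hi′ : n ≤ 2 ^ (7 * s)
      hi′ = ≤-trans (<⇒≤ hi) (≤-reflexive (^-*-assoc 2 7 s))
      e₁ : ∀ n → (n * n) * (n * n) * (n * n) ≡ n * (n * (n * (n * (n * (n * 1)))))
      e₁ = solve-∀
      small : (n * n) * (n * n) * (n * n) * D < 2 ^ k
      small = begin-strict
        (n * n) * (n * n) * (n * n) * D ≡⟨ cong (_* D) (e₁ n) ⟩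
        n ^ 6 * D ≤⟨ *-monoˡ-≤ D (≤-trans (^-monoˡ-≤ 6 hi′) (≤-reflexive (trans (^-*-assoc 2 (7 * s) 6) (cong (2 ^_) (e₂ s))))) ⟩
        2 ^ (42 * s) * D <⟨ *-monoʳ-< (2 ^ (42 * s)) {{m^n≢0 2 (42 * s)}} (n<2^n D) ⟩
        2 ^ (42 * s) * 2 ^ D ≡⟨ ^-distribˡ-+-* 2 (42 * s) D ⟨
        2 ^ k ∎
        where
        e₂ : ∀ s → 7 * s * 6 ≡ 42 * s
        e₂ = solve-∀
      2k≤ws : 2 * suc k ≤ w * s
      2k≤ws = begin
        2 * suc (42 * s + D) ≤⟨ *-monoʳ-≤ 2 (s≤s (+-monoʳ-≤ (42 * s) (m≤m*n D s))) ⟩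
        2 * suc (42 * s + D * s) ≤⟨ *-monoʳ-≤ 2 (+-monoˡ-≤ (42 * s + D * s) (s≤s (z≤n {i}))) ⟩
        2 * (s + (42 * s + D * s)) ≡⟨ e₃ D s ⟩
        w * s ∎
        where
        e₃ : ∀ D s → 2 * (s + (42 * s + D * s)) ≡ 2 * (43 + D) * s
        e₃ = solve-∀
      s≤2i : s ≤ 2 * i
      s≤2i = ≤-trans (+-monoˡ-≤ i (≤-trans (s≤s z≤n) I₀≤i)) (≤-reflexive (cong (i +_) (sym (+-identityʳ i))))
      large : G * (2 * suc k) ^ 6 ≤ n
      large = begin
        G * (2 * suc k) ^ 6 ≤⟨ *-monoʳ-≤ G (^-monoˡ-≤ 6 (≤-trans 2k≤ws (*-monoʳ-≤ w s≤2i))) ⟩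
        G * (w * (2 * i)) ^ 6 ≡⟨ cong (G *_) (trans (pow₆ w (2 * i)) (cong (w ^ 6 *_) (pow₆ 2 i))) ⟩
        G * (w ^ 6 * (64 * i ^ 6)) ≡⟨ e₄ G (w ^ 6) (i ^ 6) ⟩
        G * w ^ 6 * 64 * i ^ 6 ≤⟨ *-monoˡ-≤ (i ^ 6) (≤-trans (n≤1+n _) I₀≤i) ⟩
        i ^ 7 ≤⟨ ^-monoˡ-≤ 7 (<⇒≤ (n<2^n i)) ⟩
        (2 ^ i) ^ 7 ≡⟨ trans (^-*-assoc 2 i 7) (trans (cong (2 ^_) (*-comm i 7)) (sym (^-*-assoc 2 7 i))) ⟩
        128 ^ i ≤⟨ lo ⟩
        n ∎
        where
        e₄ : ∀ G a b → G * (a * (64 * b)) ≡ G * a * 64 * b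
        e₄ = solve-∀

-- The height condition as a rectangle of integers

module Height where

  open Rat
  open Sums
  open import Defs
  open Density using (ι; ι-*)
  open import Data.Nat as ℕ using (ℕ; zero; suc; z≤n)
  import Data.Nat.Properties as ℕP
  open import Data.Integer as ℤ using (ℤ; +_)
  import Data.Integer.Properties as ℤP
  import Data.Integer.DivMod as ℤD
  open import Data.Rational
  open import Data.Rational.Properties
  import Data.Rational.Unnormalised as ℚᵘ
  import Data.Rational.Unnormalised.Properties as ℚᵘP
  open import Data.List using (length; filter)
  open import Data.Product using (_×_; _,_; ∃-syntax; proj₁; proj₂)
  open import Relation.Nullary using (¬_; Dec; yes; no; contradiction)
  open import Relation.Nullary.Decidable using (_×-dec_)
  open import Relation.Binary.PropositionalEquality hiding ([_])

  ι-mono-≤ : ∀ m n → m ℕ.≤ n → ι m ≤ ι n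
  ι-mono-≤ m n h = toℚ-mono-≤ {+ m} {+ n} (ℤ.+≤+ h)

  ι-cancel-≤ : ∀ m n → ι m ≤ ι n → m ℕ.≤ n
  ι-cancel-≤ m n h = ℤP.drop‿+≤+ (toℚ-cancel-≤ {+ m} {+ n} h)

  ι-cancel-< : ∀ m n → ι m < ι n → m ℕ.< n
  ι-cancel-< m n h = ℤP.drop‿+<+ (toℚ-cancel-< {+ m} {+ n} h)

  ≤⇒≯ : ∀ {x y} → x ≤ y → ¬ (y < x)
  ≤⇒≯ h k = <-irrefl refl (≤-<-trans h k)

  toℚ-neg : ∀ i → toℚ (ℤ.- i) ≡ - toℚ i
  toℚ-neg i = begin
    toℚ (ℤ.- i) ≡⟨ +-identityʳ (toℚ (ℤ.- i)) ⟨
    toℚ (ℤ.- i) + 0ℚ ≡⟨ cong (_+_ (toℚ (ℤ.- i))) (+-inverseʳ (toℚ i)) ⟨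
    toℚ (ℤ.- i) + (toℚ i - toℚ i) ≡⟨ +-assoc (toℚ (ℤ.- i)) (toℚ i) (- toℚ i) ⟨
    toℚ (ℤ.- i) + toℚ i - toℚ i ≡⟨ cong (_- toℚ i) (trans (sym (toℚ-+ (ℤ.- i) i)) (cong toℚ (ℤP.+-inverseˡ i))) ⟩
    0ℚ - toℚ i ≡⟨ +-identityˡ (- toℚ i) ⟩
    - toℚ i ∎
    where open ≡-Reasoning

  floor-≤ : ∀ p → toℚ (floor p) ≤ p
  floor-≤ p@(mkℚ _ _ _) = toℚᵘ-cancel-≤ (ℚᵘP.≤-respˡ-≃ (ℚᵘP.≃-sym (toℚᵘ-/ (floor p) 1))
    (ℚᵘ.*≤* (subst (floor p ℤ.* ↧ p ℤ.≤_) (sym (ℤP.*-identityʳ (↥ p))) (ℤD.[n/d]*d≤n (↥ p) (↧ p)))))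

  floor-> : ∀ p → p < toℚ (floor p ℤ.+ + 1)
  floor-> p@(mkℚ _ _ _) = toℚᵘ-cancel-< (ℚᵘP.<-respʳ-≃ (ℚᵘP.≃-sym (toℚᵘ-/ (floor p ℤ.+ + 1) 1))
    (ℚᵘ.*<* (subst₂ ℤ._<_ (sym (ℤP.*-identityʳ (↥ p)))
      (cong (ℤ._* ↧ p) (trans (cong ℤ.suc (sym (ℤD.div-pos-is-/ℕ (↥ p) (↧ₙ p)))) (ℤP.+-comm (+ 1) (floor p))))
      (ℤD.n<s[n/ℕd]*d (↥ p) (↧ₙ p)))))

  neg-neg : ∀ x → - (- x) ≡ x
  neg-neg x = begin
    - (- x) ≡⟨ +-identityˡ (- (- x)) ⟨
    0ℚ - (- x) ≡⟨ cong (_- (- x)) (+-inverseʳ x) ⟨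
    x - x - (- x) ≡⟨ +-assoc x (- x) (- (- x)) ⟩
    x + (- x - (- x)) ≡⟨ cong (_+_ x) (+-inverseʳ (- x)) ⟩
    x + 0ℚ ≡⟨ +-identityʳ x ⟩
    x ∎
    where open ≡-Reasoning

  ceiling-≥ : ∀ X → X ≤ toℚ (ceiling X)
  ceiling-≥ X@(mkℚ _ _ _) = subst₂ _≤_ (neg-neg X) (sym (toℚ-neg (floor (- X)))) (neg-antimono-≤ (floor-≤ (- X)))

  ceiling-< : ∀ X → toℚ (ceiling X ℤ.- + 1) < X
  ceiling-< X@(mkℚ _ _ _) = subst₂ _<_ (trans (sym (toℚ-neg (floor (- X) ℤ.+ + 1))) (cong toℚ (ℤP.neg-distrib-+ (floor (- X)) (+ 1)))) (neg-neg X) (neg-antimono-< (floor-> (- X)))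

  ceilingℕ : ∀ X → ι 1 ≤ X → ∃[ c ] (ℤ.∣ ceiling X ∣ ≡ suc c × X ≤ ι (suc c) × ι c < X)
  ceilingℕ X 1≤X = go (ceiling X) refl
    where
    go : ∀ z → z ≡ ceiling X → ∃[ c ] (ℤ.∣ ceiling X ∣ ≡ suc c × X ≤ ι (suc c) × ι c < X)
    go z eq with toℚ-cancel-≤ {+ 1} {z} (subst (λ w → ι 1 ≤ toℚ w) (sym eq) (≤-trans 1≤X (ceiling-≥ X)))
    go (+ suc c) eq | _ = c , cong ℤ.∣_∣ (sym eq) , subst (λ z → X ≤ toℚ z) (sym eq) (ceiling-≥ X) ,
      subst (λ z → toℚ (z ℤ.- + 1) < X) (sym eq) (ceiling-< X)
    go (+ zero) eq | ℤ.+≤+ ()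

  *-mono-≤-nonNeg : ∀ {a b c d} → 0ℚ ≤ c → 0ℚ ≤ b → a ≤ b → c ≤ d → a * c ≤ b * d
  *-mono-≤-nonNeg {a} {b} {c} {d} 0≤c 0≤b a≤b c≤d =
    ≤-trans (*-monoʳ-≤-nonNeg c {{nonNegative 0≤c}} a≤b) (*-monoˡ-≤-nonNeg b {{nonNegative 0≤b}} c≤d)

  *-mono-<-nonNeg : ∀ {a b c d} → 0ℚ ≤ c → 0ℚ < b → a ≤ b → c < d → a * c < b * d
  *-mono-<-nonNeg {a} {b} {c} {d} 0≤c 0<b a≤b c<d =
    ≤-<-trans (*-monoʳ-≤-nonNeg c {{nonNegative 0≤c}} a≤b) (*-monoʳ-<-pos b {{positive 0<b}} c<d)

  0≤ι : ∀ n → 0ℚ ≤ ι n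
  0≤ι n = ι-mono-≤ 0 n z≤n

  powers-≤ : ∀ X c → 0ℚ ≤ X → X ≤ ι c → (X * X * X ≤ ι (c ℕ.* c ℕ.* c)) × (X * X * X * X ≤ ι (c ℕ.* c ℕ.* c ℕ.* c))
  powers-≤ X c 0≤X X≤c = X³≤ , X⁴≤
    where
    X²≤ : X * X ≤ ι (c ℕ.* c)
    X²≤ = subst (X * X ≤_) (sym (ι-* c c)) (*-mono-≤-nonNeg 0≤X (0≤ι c) X≤c X≤c)
    X³≤ : X * X * X ≤ ι (c ℕ.* c ℕ.* c)
    X³≤ = subst (X * X * X ≤_) (sym (ι-* (c ℕ.* c) c)) (*-mono-≤-nonNeg 0≤X (0≤ι (c ℕ.* c)) X²≤ X≤c)
    X⁴≤ : X * X * X * X ≤ ι (c ℕ.* c ℕ.* c ℕ.* c)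
    X⁴≤ = subst (X * X * X * X ≤_) (sym (ι-* (c ℕ.* c ℕ.* c) c)) (*-mono-≤-nonNeg 0≤X (0≤ι (c ℕ.* c ℕ.* c)) X³≤ X≤c)

  powers-> : ∀ X c → ι c < X → (ι (c ℕ.* c ℕ.* c) < X * X * X) × (ι (c ℕ.* c ℕ.* c ℕ.* c) < X * X * X * X)
  powers-> X c c<X = X³> , X⁴>
    where
    0<X : 0ℚ < X
    0<X = ≤-<-trans (0≤ι c) c<X
    X²> : ι (c ℕ.* c) < X * X
    X²> = subst (_< X * X) (sym (ι-* c c)) (*-mono-<-nonNeg (0≤ι c) 0<X (<⇒≤ c<X) c<X)
    X³> : ι (c ℕ.* c ℕ.* c) < X * X * X
    X³> = subst (_< X * X * X) (sym (ι-* (c ℕ.* c) c)) (*-mono-<-nonNeg (0≤ι c) (≤-<-trans (0≤ι (c ℕ.* c)) X²>) (<⇒≤ X²>) c<X)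
    X⁴> : ι (c ℕ.* c ℕ.* c ℕ.* c) < X * X * X * X
    X⁴> = subst (_< X * X * X * X) (sym (ι-* (c ℕ.* c ℕ.* c) c)) (*-mono-<-nonNeg (0≤ι c) (≤-<-trans (0≤ι (c ℕ.* c ℕ.* c)) X³>) (<⇒≤ X³>) c<X)

  -- For a natural number `k` the strict condition `k < T` becomes `k ≤ α`. In this way both counts
  -- turn into sums over a rectangle with integer sides.
  largestBelow : ∀ T B → 0ℚ < T → T ≤ ι B → ∃[ α ] (α ℕ.≤ B × ι α < T × T ≤ ι (suc α))
  largestBelow T zero 0<T T≤ = contradiction 0<T (≤⇒≯ {T} {0ℚ} T≤)
  largestBelow T (suc B) 0<T T≤ = go (ι B <? T)
    where
    go : Dec (ι B < T) → ∃[ α ] (α ℕ.≤ suc B × ι α < T × T ≤ ι (suc α))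
    go (yes B<T) = B , ℕP.n≤1+n B , B<T , T≤
    go (no B≮T) = let (α , α≤B , lo , hi) = largestBelow T B 0<T (≮⇒≥ B≮T) in α , ℕP.m≤n⇒m≤1+n α≤B , lo , hi

  module _ (X : ℚ) (B α β : ℕ) (α≤ : α ℕ.≤ B) (β≤ : β ℕ.≤ B)
    (α-lo : ι α < X * X * X) (α-hi : X * X * X ≤ ι (suc α))
    (β-lo : ι β < X * X * X * X) (β-hi : X * X * X * X ≤ ι (suc β)) where

    private
      A? B? : ℤ → ℕ
      A? a = ⟦ ℤ.∣ a ∣ ℕ.≤? α ⟧
      B? b = ⟦ ℤ.∣ b ∣ ℕ.≤? β ⟧

      height-factor : ∀ a b → ⟦ heightBelow? X a b ⟧ ≡ A? a ℕ.* B? b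
      height-factor a b = trans (⟦⟧-× (ι ℤ.∣ a ∣ <? X * X * X) (ι ℤ.∣ b ∣ <? X * X * X * X)) (cong₂ ℕ._*_
        (⟦⟧-cong (ι ℤ.∣ a ∣ <? X * X * X) (ℤ.∣ a ∣ ℕ.≤? α)
          (λ h → ℕP.≤-pred (ι-cancel-< ℤ.∣ a ∣ (suc α) (<-≤-trans h α-hi))) (λ h → ≤-<-trans (ι-mono-≤ ℤ.∣ a ∣ α h) α-lo))
        (⟦⟧-cong (ι ℤ.∣ b ∣ <? X * X * X * X) (ℤ.∣ b ∣ ℕ.≤? β)
          (λ h → ℕP.≤-pred (ι-cancel-< ℤ.∣ b ∣ (suc β) (<-≤-trans h β-hi))) (λ h → ≤-<-trans (ι-mono-≤ ℤ.∣ b ∣ β h) β-lo)))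

      restrict : ∀ (f : ℤ → ℤ → ℕ) → Box B (λ a → Box B (λ b → A? a ℕ.* B? b ℕ.* f a b)) ≡ Box α (λ a → Box β (f a))
      restrict f = begin
        Box B (λ a → Box B (λ b → A? a ℕ.* B? b ℕ.* f a b))
          ≡⟨ Box-cong B {λ a → Box B (λ b → A? a ℕ.* B? b ℕ.* f a b)} {λ a → Box B (λ b → A? a ℕ.* (B? b ℕ.* f a b))}
               (λ a → Box-cong B {λ b → A? a ℕ.* B? b ℕ.* f a b} {λ b → A? a ℕ.* (B? b ℕ.* f a b)} (λ b → ℕP.*-assoc (A? a) (B? b) (f a b))) ⟩
        Box B (λ a → Box B (λ b → A? a ℕ.* (B? b ℕ.* f a b)))
          ≡⟨ Box-cong B {λ a → Box B (λ b → A? a ℕ.* (B? b ℕ.* f a b))} {λ a → A? a ℕ.* Box B (λ b → B? b ℕ.* f a b)}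
               (λ a → Σ-* (suc (B ℕ.+ B)) (A? a) (λ i → B? (ℤ.- (+ B) ℤ.+ + i) ℕ.* f a (ℤ.- (+ B) ℤ.+ + i))) ⟩
        Box B (λ a → A? a ℕ.* Box B (λ b → B? b ℕ.* f a b))
          ≡⟨ Box-cong B {λ a → A? a ℕ.* Box B (λ b → B? b ℕ.* f a b)} {λ a → A? a ℕ.* Box β (f a)} (λ a → cong (A? a ℕ.*_) (Box-restrict (f a) β≤)) ⟩
        Box B (λ a → A? a ℕ.* Box β (f a))
          ≡⟨ Box-restrict (λ a → Box β (f a)) α≤ ⟩
        Box α (λ a → Box β (f a)) ∎
        where open ≡-Reasoning

      count : ∀ {P : ℤ × ℤ → Set} (P? : ∀ x → Dec (P x)) (f : ℤ → ℤ → ℕ) → (∀ a b → ⟦ P? (a , b) ⟧ ≡ A? a ℕ.* B? b ℕ.* f a b) →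
        length (filter P? (pairsInBox B)) ≡ Box α (λ a → Box β (f a))
      count P? f h = begin
        length (filter P? (pairsInBox B)) ≡⟨ length-filter-pairs B P? ⟩
        Box B (λ a → Box B (λ b → ⟦ P? (a , b) ⟧))
          ≡⟨ Box-cong B {λ a → Box B (λ b → ⟦ P? (a , b) ⟧)} {λ a → Box B (λ b → A? a ℕ.* B? b ℕ.* f a b)}
               (λ a → Box-cong B {λ b → ⟦ P? (a , b) ⟧} {λ b → A? a ℕ.* B? b ℕ.* f a b} (h a)) ⟩
        Box B (λ a → Box B (λ b → A? a ℕ.* B? b ℕ.* f a b)) ≡⟨ restrict f ⟩
        Box α (λ a → Box β (f a)) ∎
        where open ≡-Reasoning

    count-all : length (filter (λ (ab : ℤ × ℤ) → let (a , b) = ab in heightBelow? X a b) (pairsInBox B)) ≡ suc (α ℕ.+ α) ℕ.* suc (β ℕ.+ β)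
    count-all = trans (count (λ ab → heightBelow? X (proj₁ ab) (proj₂ ab)) (λ _ _ → 1) (λ a b → trans (height-factor a b) (sym (ℕP.*-identityʳ (A? a ℕ.* B? b)))))
      (trans (Σ-cong (suc (α ℕ.+ α)) {λ _ → Σ< (suc (β ℕ.+ β)) (λ _ → 1)} {λ _ → suc (β ℕ.+ β)} λ i _ → trans (Σ-const (suc (β ℕ.+ β)) 1) (ℕP.*-identityʳ (suc (β ℕ.+ β))))
        (Σ-const (suc (α ℕ.+ α)) (suc (β ℕ.+ β))))

    count-squarefree : length (filter (λ (ab : ℤ × ℤ) → let (a , b) = ab in heightBelow? X a b ×-dec squarefree? (disc a b)) (pairsInBox B))
      ≡ Box α (λ a → Box β (λ b → ⟦ squarefree? (disc a b) ⟧))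
    count-squarefree = count (λ ab → heightBelow? X (proj₁ ab) (proj₂ ab) ×-dec squarefree? (disc (proj₁ ab) (proj₂ ab))) (λ a b → ⟦ squarefree? (disc a b) ⟧)
      (λ a b → trans (⟦⟧-× (heightBelow? X a b) (squarefree? (disc a b))) (cong (ℕ._* ⟦ squarefree? (disc a b) ⟧) (height-factor a b)))

-- Choice of parameters and the estimates for large n

module Estimate where

  open Sums
  open Periodic
  open Density
  open Tuples
  open Growth
  open Except
  open import Defs using (disc; squarefree?)
  open import Data.Nat
  open import Data.Nat.Properties
  open import Data.Nat.DivMod using (_/_; m/n*n≤m)
  open import Data.Integer as ℤ using (ℤ; +_)
  open import Data.Integer.Divisibility.Signed using (∣⇒∣ᵤ)
  open import Data.Nat.Tactic.RingSolver using (solve-∀)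
  open import Data.Product using (_×_; _,_; ∃-syntax; proj₁; proj₂)
  open import Relation.Nullary using (Dec; yes; no)
  open import Relation.Binary.PropositionalEquality using (_≡_; refl; sym; trans; cong)
  open import Defs using (Squarefree)

  count₂ : ℕ → ℕ → (ℤ → ℤ → ℕ) → ℕ
  count₂ α β f = Box α (λ a → Box β (f a))

  squarefreeInd : ℤ → ℤ → ℕ
  squarefreeInd a b = ⟦ squarefree? (disc a b) ⟧

  module _ (c : ℕ) (c-large : 18 * 18 * 18 * 18 * 128 ≤ c) (E M′ : ℕ) (1≤E : 1 ≤ E) (M≡ : suc M′ ≡ 48 * E) (S : Sieve (suc M′)) where

    open Sieve S

    private
      M K D G : ℕ
      M = suc M′
      K = M * 16
      D = K * c
      G = M * 64 * D

      5≤M : 5 ≤ M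
      5≤M = ≤-trans (≤-trans (m≤m+n 5 43) (≤-trans (≤-reflexive (sym (*-identityʳ 48))) (*-monoʳ-≤ 48 1≤E))) (≤-reflexive (sym M≡))

      -- Each summand serves one largeness hypothesis of `Large`; the `suc` provides `n ≥ 1` for
      -- `growth`.
      threshold : ℕ
      threshold = suc (16 + (120 * M + (32 * E * (2 * Q + Q * Q) + (18 * (K * K) + proj₁ (growth G D)))))

    module Large (n α β : ℕ) (n≥16 : 16 ≤ n) (n≥M : 120 * M ≤ n) (n≥Q : 32 * E * (2 * Q + Q * Q) ≤ n) (n≥K : 18 * (K * K) ≤ n)
      (k T : ℕ) (T≡ : T ≡ (n * n) * (n * n) * (n * n) * D) (T<2^k : T < 2 ^ k) (G≤n : G * (2 * suc k) ^ 6 ≤ n)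
      (α≤ : α ≤ n * n * n) (β≤ : β ≤ n * n * (n * n)) (α-large : n * n * n ≤ 8 * α) (β-large : n * n * (n * n) ≤ 16 * β) where

      private
        instance
          n≢0 : NonZero n
          n≢0 = >-nonZero (≤-trans (s≤s z≤n) n≥16)
          Q≢0′ : NonZero Q
          Q≢0′ = Q≢0

        m Z La Lb A I C R N : ℕ
        m = n * n
        Z = β / M
        La = suc (α + α)
        Lb = suc (β + β)
        A = La * Lb
        I = count₂ α β ind
        C = Per₂ Q ind
        R = Q * (La + Lb) + Q * Q
        N = ΣT 6 T (λ _ → 1)

        α≤β : α ≤ β
        α≤β = *-cancelˡ-≤ 16 (begin
          16 * α ≤⟨ *-mono-≤ n≥16 α≤ ⟩
          n * (n * n * n) ≡⟨ e n ⟩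
          n * n * (n * n) ≤⟨ β-large ⟩
          16 * β ∎)
          where
          open ≤-Reasoning
          e : ∀ n → n * (n * n * n) ≡ n * n * (n * n)
          e = solve-∀

        La≤Lb : La ≤ Lb
        La≤Lb = s≤s (+-mono-≤ α≤β α≤β)

        α≤La : α ≤ La
        α≤La = ≤-trans (m≤m+n α α) (n≤1+n _)

        β≤Lb : β ≤ Lb
        β≤Lb = ≤-trans (m≤m+n β β) (n≤1+n _)

        small≤La : ∀ x → 8 * x ≤ n * n * n → x ≤ La
        small≤La x h = ≤-trans (*-cancelˡ-≤ 8 (≤-trans h α-large)) α≤La

        C≤ : C ≤ Q * Q
        C≤ = Σ-≤const Q Q λ i _ → ≤-trans (Σ-≤const Q 1 λ j _ → ind≤1 (+ i) (+ j)) (≤-reflexive (*-identityʳ Q))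

        -- `R` is the excess of `(La + Q)(Lb + Q)` over `A`, the boundary error of the sieve. For
        -- fixed `Q` it grows like `n⁴`, against `n⁷` for `A`.
        R≤ : 4 * E * R ≤ A
        R≤ = begin
          4 * E * R ≤⟨ *-monoʳ-≤ (4 * E) (+-mono-≤ (*-monoʳ-≤ Q (+-monoˡ-≤ Lb La≤Lb)) (m≤m*n (Q * Q) Lb)) ⟩
          4 * E * (Q * (Lb + Lb) + Q * Q * Lb) ≡⟨ e₁ E Q Lb ⟩
          4 * E * (2 * Q + Q * Q) * Lb ≤⟨ *-monoˡ-≤ Lb (small≤La (4 * E * (2 * Q + Q * Q)) (begin
              8 * (4 * E * (2 * Q + Q * Q)) ≡⟨ e₂ E (2 * Q + Q * Q) ⟩
              32 * E * (2 * Q + Q * Q) ≤⟨ n≥Q ⟩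
              n ≤⟨ m≤m*n n (n * n) {{m*n≢0 n n}} ⟩
              n * (n * n) ≡⟨ *-assoc n n n ⟨
              n * n * n ∎)) ⟩
          A ∎
          where
          open ≤-Reasoning
          e₁ : ∀ E Q L → 4 * E * (Q * (L + L) + Q * Q * L) ≡ 4 * E * (2 * Q + Q * Q) * L
          e₁ = solve-∀
          e₂ : ∀ E x → 8 * (4 * E * x) ≡ 32 * E * x
          e₂ = solve-∀

      sieve-upper : 4 * E * (Q * Q * I) ≤ 4 * E * (A * C) + A * (Q * Q)
      sieve-upper = begin
        4 * E * (Q * Q * I) ≤⟨ *-monoʳ-≤ (4 * E) (W₂-upper {Q} {ind} periodic (ℤ.- (+ α)) (ℤ.- (+ β)) La Lb) ⟩
        4 * E * ((La + Q) * (Lb + Q) * C) ≡⟨ e E La Lb Q C ⟩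
        4 * E * (A * C) + 4 * E * R * C ≤⟨ +-monoʳ-≤ (4 * E * (A * C)) (*-mono-≤ R≤ C≤) ⟩
        4 * E * (A * C) + A * (Q * Q) ∎
        where
        open ≤-Reasoning
        e : ∀ E La Lb Q C → 4 * E * ((La + Q) * (Lb + Q) * C) ≡ 4 * E * (La * Lb * C) + 4 * E * (Q * (La + Lb) + Q * Q) * C
        e = solve-∀

      sieve-lower : 4 * E * (A * C) ≤ 4 * E * (Q * Q * I) + A * (Q * Q)
      sieve-lower = begin
        4 * E * (A * C) ≤⟨ *-monoʳ-≤ (4 * E) (W₂-lower {Q} {ind} periodic (ℤ.- (+ α)) (ℤ.- (+ β)) La Lb ind≤1) ⟩
        4 * E * (Q * Q * I + Q * Q * Q * (La + Lb)) ≤⟨ *-monoʳ-≤ (4 * E) (+-monoʳ-≤ (Q * Q * I) (≤-trans (≤-reflexive (e₁ Q (La + Lb))) (*-monoˡ-≤ (Q * Q) (m≤m+n (Q * (La + Lb)) (Q * Q))))) ⟩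
        4 * E * (Q * Q * I + R * (Q * Q)) ≡⟨ e₂ (4 * E) (Q * Q * I) R (Q * Q) ⟩
        4 * E * (Q * Q * I) + 4 * E * R * (Q * Q) ≤⟨ +-monoʳ-≤ (4 * E * (Q * Q * I)) (*-monoˡ-≤ (Q * Q) R≤) ⟩
        4 * E * (Q * Q * I) + A * (Q * Q) ∎
        where
        open ≤-Reasoning
        e₁ : ∀ Q L → Q * Q * Q * L ≡ Q * L * (Q * Q)
        e₁ = solve-∀
        e₂ : ∀ e x R q → e * (x + R * q) ≡ e * x + e * R * q
        e₂ = solve-∀

      squarefree≤sieve : count₂ α β squarefreeInd ≤ I
      squarefree≤sieve = Box-mono α λ a _ → Box-mono β λ b _ → go a b (squarefree? (disc a b))
        where
        go : ∀ a b (d : Dec (Squarefree (disc a b))) → ⟦ d ⟧ ≤ ind a b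
        go a b (yes (_ , h)) = ≤-reflexive (sym (complete a b λ p pr dv → h p pr (∣⇒∣ᵤ dv)))
        go a b (no _) = z≤n

      private
        T≥1 : 1 ≤ T
        T≥1 = ≤-trans (>-nonZero⁻¹ (m * m * m * D) {{m*n≢0 (m * m * m) D {{m*n≢0 (m * m) m {{m*n≢0 m m {{mz}} {{mz}}}} {{mz}}}} {{m*n≢0 K c {{m*n≢0 M 16}} {{>-nonZero (≤-trans (s≤s z≤n) c-large)}}}}}}) (≤-reflexive (sym T≡))
          where
          mz : NonZero m
          mz = m*n≢0 n n

        -- From `n³ ≤ 8α` and `n⁴ ≤ 16β` one gets `n⁷ ≤ 32 · 2α · 2β`. The vectors number at most
        -- `n⁶D(2(k + 1))⁶`, and the 64 in `G` makes room for this 32 and for the two pairs per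
        -- code.
        codes≤ : M * (2 * N) ≤ A
        codes≤ = *-cancelˡ-≤ 32 (begin
          32 * (M * (2 * N)) ≤⟨ *-monoʳ-≤ 32 (*-monoʳ-≤ M (*-monoʳ-≤ 2 (ΣT-count 6 T k T≥1 T<2^k))) ⟩
          32 * (M * (2 * (T * P))) ≡⟨ trans (cong (λ t → 32 * (M * (2 * (t * P)))) T≡) (e₁ M (m * m * m) D P) ⟩
          m * m * m * (G * P) ≤⟨ *-monoʳ-≤ (m * m * m) G≤n ⟩
          m * m * m * n ≡⟨ e₂ n ⟩
          (n * n * n) * (n * n * (n * n)) ≤⟨ *-mono-≤ α-large β-large ⟩
          (8 * α) * (16 * β) ≡⟨ e₃ α β ⟩
          32 * ((α + α) * (β + β)) ≤⟨ *-monoʳ-≤ 32 (*-mono-≤ (n≤1+n (α + α)) (n≤1+n (β + β))) ⟩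
          32 * A ∎)
          where
          open ≤-Reasoning
          P = (2 * suc k) ^ 6
          e₁ : ∀ M x D P → 32 * (M * (2 * (x * D * P))) ≡ x * (M * 64 * D * P)
          e₁ = solve-∀
          e₂ : ∀ n → (n * n) * (n * n) * (n * n) * n ≡ (n * n * n) * (n * n * (n * n))
          e₂ = solve-∀
          e₃ : ∀ α β → (8 * α) * (16 * β) ≡ 32 * ((α + α) * (β + β))
          e₃ = solve-∀

        both≤ : 4 * α * (4 * β) ≤ 4 * A
        both≤ = ≤-trans (≤-reflexive (e α β)) (*-monoʳ-≤ 4 (*-mono-≤ (n≤1+n (α + α)) (n≤1+n (β + β))))
          where
          e : ∀ α β → 4 * α * (4 * β) ≡ 4 * ((α + α) * (β + β))
          e = solve-∀

        units≤ : La * 3 * (Lb + M * Z) ≤ 6 * A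
        units≤ = ≤-trans (*-monoʳ-≤ (La * 3) (+-monoʳ-≤ Lb (≤-trans (≤-trans (≤-reflexive (*-comm M Z)) (m/n*n≤m β M)) β≤Lb))) (≤-reflexive (e La Lb))
          where
          e : ∀ La Lb → La * 3 * (Lb + Lb) ≡ 6 * (La * Lb)
          e = solve-∀

        roots≤ : M * Lb + M * (suc (3 * m + 3 * m) * (Lb * 2)) ≤ A
        roots≤ = begin
          M * Lb + M * (suc (3 * m + 3 * m) * (Lb * 2)) ≡⟨ e₁ M m Lb ⟩
          M * (12 * m + 3) * Lb ≤⟨ *-monoˡ-≤ Lb (small≤La (M * (12 * m + 3)) (begin
              8 * (M * (12 * m + 3)) ≤⟨ *-monoʳ-≤ 8 (*-monoʳ-≤ M (+-monoʳ-≤ (12 * m) (*-monoʳ-≤ 3 (>-nonZero⁻¹ m {{m*n≢0 n n}})))) ⟩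
              8 * (M * (12 * m + 3 * m)) ≡⟨ e₂ M m ⟩
              120 * M * m ≤⟨ *-monoˡ-≤ m n≥M ⟩
              n * m ≡⟨ *-assoc n n n ⟨
              n * n * n ∎)) ⟩
          A ∎
          where
          open ≤-Reasoning
          e₁ : ∀ M m L → M * L + M * (suc (3 * m + 3 * m) * (L * 2)) ≡ M * (12 * m + 3) * L
          e₁ = solve-∀
          e₂ : ∀ M m → 8 * (M * (12 * m + 3 * m)) ≡ 120 * M * m
          e₂ = solve-∀

      -- With the first and fourth errors taken together, the errors amount to `1 + 4 + 6 + 1 = 12`
      -- times `A`. As `M = 48E = 12 · 4E`, division by 12 leaves a single `A`.
      sieve-squarefree : 4 * E * I ≤ 4 * E * count₂ α β squarefreeInd + A
      sieve-squarefree = *-cancelˡ-≤ 12 (begin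
        12 * (4 * E * I) ≡⟨ e₁ E I ⟩
        48 * E * I ≡⟨ cong (_* I) M≡ ⟨
        M * I ≤⟨ exceptions M′ 5≤M S n α β α≤ β≤ α≤β β-large K refl (≤-trans n≥K (m≤m*n n n)) c c-large T (≤-reflexive (sym T≡)) ⟩
        M * s + (x₁ + (x₂ + (x₃ + (x₄ + x₅)))) ≡⟨ e₂ (M * s) x₁ x₂ x₃ x₄ x₅ ⟩
        M * s + ((x₁ + x₄) + x₂ + x₃ + x₅) ≤⟨ +-monoʳ-≤ (M * s) (+-mono-≤ (+-mono-≤ (+-mono-≤ roots≤ both≤) units≤) codes≤) ⟩
        M * s + (A + 4 * A + 6 * A + A) ≡⟨ cong (λ M → M * s + (A + 4 * A + 6 * A + A)) M≡ ⟩
        48 * E * s + (A + 4 * A + 6 * A + A) ≡⟨ e₃ E s A ⟩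
        12 * (4 * E * s + A) ∎)
        where
        open ≤-Reasoning
        s = count₂ α β squarefreeInd
        x₁ = M * Lb
        x₂ = 4 * α * (4 * β)
        x₃ = La * 3 * (Lb + M * Z)
        x₄ = M * (suc (3 * m + 3 * m) * (Lb * 2))
        x₅ = M * (2 * N)
        e₁ : ∀ E I → 12 * (4 * E * I) ≡ 48 * E * I
        e₁ = solve-∀
        e₂ : ∀ s a b c d e → s + (a + (b + (c + (d + e)))) ≡ s + ((a + d) + b + c + e)
        e₂ = solve-∀
        e₃ : ∀ E s A → 48 * E * s + (A + 4 * A + 6 * A + A) ≡ 12 * (4 * E * s + A)
        e₃ = solve-∀

    -- The denominators `4E` and `Q²` are cleared to stay in ℕ. In relative terms, the sieved
    -- proportion is within `1/(4E)` of its mean, and the squarefree proportion is at most `1/(4E)`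
    -- below the sieved one.
    Estimates : ℕ → ℕ → Set
    Estimates α β = let A = suc (α + α) * suc (β + β) ; I = count₂ α β ind ; s = count₂ α β squarefreeInd in
      (4 * E * (Q * Q * I) ≤ 4 * E * (A * Per₂ Q ind) + A * (Q * Q)) ×
      (4 * E * (A * Per₂ Q ind) ≤ 4 * E * (Q * Q * I) + A * (Q * Q)) ×
      (s ≤ I) × (4 * E * I ≤ 4 * E * s + A)

    estimates : ∃[ n₀ ] (∀ n → n₀ ≤ n → ∀ α β → α ≤ n * n * n → β ≤ n * n * (n * n) →
      n * n * n ≤ 8 * α → n * n * (n * n) ≤ 16 * β → Estimates α β)
    estimates = threshold , λ n n₀≤n α β α≤ β≤ α-large β-large →
      let h₀ = ≤-trans (n≤1+n _) n₀≤n
          h₁ = ≤-trans (m≤n+m _ 16) h₀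
          h₂ = ≤-trans (m≤n+m _ (120 * M)) h₁
          h₃ = ≤-trans (m≤n+m _ (32 * E * (2 * Q + Q * Q))) h₂
          h₄ = ≤-trans (m≤n+m _ (18 * (K * K))) h₃
          (k , T<2^k , G≤n) = proj₂ (growth G D) n h₄ (≤-trans (s≤s z≤n) n₀≤n)
          module L = Large n α β (≤-trans (m≤m+n 16 _) h₀) (≤-trans (m≤m+n (120 * M) _) h₁)
            (≤-trans (m≤m+n (32 * E * (2 * Q + Q * Q)) _) h₂) (≤-trans (m≤m+n (18 * (K * K)) _) h₃) k _ refl T<2^k G≤n α≤ β≤ α-large β-large
      in L.sieve-upper , L.sieve-lower , L.squarefree≤sieve , L.sieve-squarefree

-- Assembly of the limit

open Rat
open Periodic
open Euler
open Density
open Height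
open Estimate
open import Defs
open import Data.Nat as ℕ using (ℕ; zero; suc; s≤s; z≤n) renaming (_≤_ to _≤ℕ_)
import Data.Nat.Properties as ℕP
import Data.Nat.Tactic.RingSolver as ℕR
open import Data.Integer as ℤ using (ℤ; +_)
import Data.Integer.Properties as ℤP
open import Data.Rational
open import Data.Rational.Properties
open import Data.Product using (_×_; _,_; ∃-syntax; proj₁; proj₂)
open import Data.Sum using (_⊎_; inj₁; inj₂)
open import Relation.Binary.PropositionalEquality

p≤q+r⇒p-q≤r : ∀ p q r → p ≤ q + r → p - q ≤ r
p≤q+r⇒p-q≤r p q r h = subst (p - q ≤_) (trans (cong (_- q) (+-comm q r)) (trans (+-assoc r q (- q)) (trans (cong (_+_ r) (+-inverseʳ q)) (+-identityʳ r)))) (+-monoˡ-≤ (- q) h)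

ι-+ : ∀ m n → ι (m ℕ.+ n) ≡ ι m + ι n
ι-+ m n = toℚ-+ (+ m) (+ n)

-- There are three errors of size `A/e`: the sieve, the large primes and the truncated product.
-- Monotonicity leaves two in each direction: from above the sieve and the product, because `s ≤ I`;
-- from below the sieve and the large primes, because `cN ≤ cM`. So the total is `2A/e`, strictly
-- below `4A/e ≤ εA`.
combine : ∀ e s I A cM cN ε → 0ℚ < e → 0ℚ < A →
  e * I ≤ e * (cM * A) + A → e * (cM * A) ≤ e * I + A → s ≤ I → e * I ≤ e * s + A →
  cN ≤ cM → e * cM ≤ e * cN + 1ℚ → ι 4 ≤ ε * e → ∣ s - cN * A ∣ < ε * A
combine e s I A cM cN ε 0<e 0<A h₁ h₂ h₃ h₄ h₅ h₆ h₇ =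
  *-cancelˡ-<-nonNeg e {{nonNegative (<⇒≤ 0<e)}} (≤-<-trans scaled gap)
  where
  open ≤-Reasoning
  instance
    e≥0 : NonNegative e
    e≥0 = nonNegative (<⇒≤ 0<e)
    A≥0 : NonNegative A
    A≥0 = nonNegative (<⇒≤ 0<A)
    A>0 : Positive A
    A>0 = positive 0<A
  x = s - cN * A
  upper : e * s ≤ e * (cN * A) + (A + A)
  upper = begin
    e * s ≤⟨ *-monoˡ-≤-nonNeg e h₃ ⟩
    e * I ≤⟨ h₁ ⟩
    e * (cM * A) + A ≡⟨ cong (_+ A) (*-assoc e cM A) ⟨
    e * cM * A + A ≤⟨ +-monoˡ-≤ A (*-monoʳ-≤-nonNeg A h₆) ⟩
    (e * cN + 1ℚ) * A + A ≡⟨ cong (_+ A) (trans (*-distribʳ-+ A (e * cN) 1ℚ) (cong₂ _+_ (*-assoc e cN A) (*-identityˡ A))) ⟩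
    e * (cN * A) + A + A ≡⟨ +-assoc (e * (cN * A)) A A ⟩
    e * (cN * A) + (A + A) ∎
  lower : e * (cN * A) ≤ e * s + (A + A)
  lower = begin
    e * (cN * A) ≤⟨ *-monoˡ-≤-nonNeg e (*-monoʳ-≤-nonNeg A h₅) ⟩
    e * (cM * A) ≤⟨ h₂ ⟩
    e * I + A ≤⟨ +-monoˡ-≤ A h₄ ⟩
    e * s + A + A ≡⟨ +-assoc (e * s) A A ⟩
    e * s + (A + A) ∎
  above : e * x ≤ A + A
  above = subst (_≤ A + A) (sym (trans (*-distribˡ-+ e s (- (cN * A))) (cong (_+_ (e * s)) (sym (neg-distribʳ-* e (cN * A))))))
    (p≤q+r⇒p-q≤r (e * s) (e * (cN * A)) (A + A) upper)
  below : e * (- x) ≤ A + A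
  below = subst (_≤ A + A) (sym (trans (cong (e *_) -x≡) (trans (*-distribˡ-+ e (cN * A) (- s)) (cong (_+_ (e * (cN * A))) (sym (neg-distribʳ-* e s))))))
    (p≤q+r⇒p-q≤r (e * (cN * A)) (e * s) (A + A) lower)
    where
    -x≡ : - x ≡ cN * A - s
    -x≡ = trans (neg-distrib-+ s (- (cN * A))) (trans (cong (_+_ (- s)) (neg-neg (cN * A))) (+-comm (- s) (cN * A)))
  scaled : e * ∣ x ∣ ≤ A + A
  scaled = go (∣p∣≡p∨∣p∣≡-p x)
    where
    go : ∣ x ∣ ≡ x ⊎ ∣ x ∣ ≡ - x → e * ∣ x ∣ ≤ A + A
    go (inj₁ eq) = subst (λ y → e * y ≤ A + A) (sym eq) above
    go (inj₂ eq) = subst (λ y → e * y ≤ A + A) (sym eq) below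
  gap : A + A < e * (ε * A)
  gap = begin-strict
    A + A ≡⟨ cong₂ _+_ (*-identityˡ A) (*-identityˡ A) ⟨
    1ℚ * A + 1ℚ * A ≡⟨ *-distribʳ-+ A 1ℚ 1ℚ ⟨
    (1ℚ + 1ℚ) * A <⟨ *-monoˡ-<-pos A {1ℚ + 1ℚ} {ι 4} (toℚ-mono-< {+ 2} {+ 4} (ℤ.+<+ (s≤s (s≤s (s≤s z≤n))))) ⟩
    ι 4 * A ≤⟨ *-monoʳ-≤-nonNeg A h₇ ⟩
    ε * e * A ≡⟨ trans (cong (_* A) (*-comm ε e)) (*-assoc e ε A) ⟩
    e * (ε * A) ∎

module _ (e q I A C : ℕ) (cM : ℚ) (density : cM * ι q ≡ ι C) (0<q : 0ℚ < ι q) where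
  private
    instance
      q>0 : Positive (ι q)
      q>0 = positive 0<q
    lhs : ι (e ℕ.* (q ℕ.* I)) ≡ ι q * (ι e * ι I)
    lhs = begin
      ι (e ℕ.* (q ℕ.* I)) ≡⟨ trans (ι-* e (q ℕ.* I)) (cong (ι e *_) (ι-* q I)) ⟩
      ι e * (ι q * ι I) ≡⟨ *-assoc (ι e) (ι q) (ι I) ⟨
      ι e * ι q * ι I ≡⟨ cong (_* ι I) (*-comm (ι e) (ι q)) ⟩
      ι q * ι e * ι I ≡⟨ *-assoc (ι q) (ι e) (ι I) ⟩
      ι q * (ι e * ι I) ∎
      where open ≡-Reasoning
    main : ι (e ℕ.* (A ℕ.* C)) ≡ ι q * (ι e * (cM * ι A))
    main = begin
      ι (e ℕ.* (A ℕ.* C)) ≡⟨ trans (ι-* e (A ℕ.* C)) (cong (ι e *_) (ι-* A C)) ⟩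
      ι e * (ι A * ι C) ≡⟨ cong (λ c → ι e * (ι A * c)) density ⟨
      ι e * (ι A * (cM * ι q)) ≡⟨ cong (ι e *_) (trans (sym (*-assoc (ι A) cM (ι q))) (cong (_* ι q) (*-comm (ι A) cM))) ⟩
      ι e * (cM * ι A * ι q) ≡⟨ *-assoc (ι e) (cM * ι A) (ι q) ⟨
      ι e * (cM * ι A) * ι q ≡⟨ *-comm (ι e * (cM * ι A)) (ι q) ⟩
      ι q * (ι e * (cM * ι A)) ∎
      where open ≡-Reasoning
    error : ι (A ℕ.* q) ≡ ι q * ι A
    error = trans (ι-* A q) (*-comm (ι A) (ι q))

  -- Division by `q` turns the count `C` over a period into the mean value `cM`.
  density-upper : e ℕ.* (q ℕ.* I) ≤ℕ e ℕ.* (A ℕ.* C) ℕ.+ A ℕ.* q → ι e * ι I ≤ ι e * (cM * ι A) + ι A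
  density-upper h = *-cancelˡ-≤-pos (ι q) (subst₂ _≤_ lhs
    (trans (ι-+ (e ℕ.* (A ℕ.* C)) (A ℕ.* q)) (trans (cong₂ _+_ main error) (sym (*-distribˡ-+ (ι q) (ι e * (cM * ι A)) (ι A)))))
    (ι-mono-≤ (e ℕ.* (q ℕ.* I)) (e ℕ.* (A ℕ.* C) ℕ.+ A ℕ.* q) h))

  density-lower : e ℕ.* (A ℕ.* C) ≤ℕ e ℕ.* (q ℕ.* I) ℕ.+ A ℕ.* q → ι e * (cM * ι A) ≤ ι e * ι I + ι A
  density-lower h = *-cancelˡ-≤-pos (ι q) (subst₂ _≤_ main
    (trans (ι-+ (e ℕ.* (q ℕ.* I)) (A ℕ.* q)) (trans (cong₂ _+_ lhs error) (sym (*-distribˡ-+ (ι q) (ι e * ι I) (ι A)))))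
    (ι-mono-≤ (e ℕ.* (A ℕ.* C)) (e ℕ.* (q ℕ.* I) ℕ.+ A ℕ.* q) h))

0<ι : ∀ n → 1 ≤ℕ n → 0ℚ < ι n
0<ι n h = toℚ-mono-< {+ 0} {+ n} (ℤ.+<+ h)

-- After `M` the product changes by at most `2/M`; with the factor 1/3 and `e ≤ M` this becomes at
-- most 2/3.
constantApprox-tail : ∀ m N → suc m ≤ℕ N → (constantApprox N ≤ constantApprox (suc m)) ×
  (∀ e → e ≤ℕ suc m → ι e * constantApprox (suc m) ≤ ι e * constantApprox N + 1ℚ)
constantApprox-tail m N M≤N = *-monoˡ-≤-nonNeg third P≥ , close
  where
  open ≤-Reasoning
  M = suc m
  k = N ℕ.∸ M
  third = + 1 / 3
  P = partialProduct M
  P′ = partialProduct N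
  δ = + 2 / M
  tail : (partialProduct N ≤ P) × (P + (+ 2 / suc (k ℕ.+ m)) ≤ partialProduct N + δ)
  tail = subst (λ j → (partialProduct j ≤ P) × (P + (+ 2 / suc (k ℕ.+ m)) ≤ partialProduct j + δ)) (ℕP.m∸n+n≡m M≤N) (partialProduct-tail m k)
  P≥ : P′ ≤ P
  P≥ = proj₁ tail
  P≤ : P ≤ P′ + δ
  P≤ = begin
    P ≡⟨ +-identityʳ P ⟨
    P + 0ℚ ≤⟨ +-monoʳ-≤ P (<⇒≤ (positive⁻¹ (+ 2 / suc (k ℕ.+ m)) {{normalize-pos 2 (suc (k ℕ.+ m))}})) ⟩
    P + (+ 2 / suc (k ℕ.+ m)) ≤⟨ proj₂ tail ⟩
    P′ + δ ∎
  close : ∀ e → e ≤ℕ M → ι e * (third * P) ≤ ι e * (third * P′) + 1ℚ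
  close e e≤M = begin
    ι e * (third * P) ≤⟨ *-monoˡ-≤-nonNeg (ι e) {{nonNegative (0≤ι e)}} (*-monoˡ-≤-nonNeg third P≤) ⟩
    ι e * (third * (P′ + δ)) ≡⟨ trans (cong (ι e *_) (*-distribˡ-+ third P′ δ)) (*-distribˡ-+ (ι e) (third * P′) (third * δ)) ⟩
    ι e * (third * P′) + ι e * (third * δ) ≤⟨ +-monoʳ-≤ (ι e * (third * P′)) small ⟩
    ι e * (third * P′) + 1ℚ ∎
    where
    0≤third*δ : 0ℚ ≤ third * δ
    0≤third*δ = <⇒≤ (positive⁻¹ (third * δ) {{pos*pos⇒pos third δ {{normalize-pos 2 M}}}})
    small : ι e * (third * δ) ≤ 1ℚ
    small = begin
      ι e * (third * δ) ≤⟨ *-monoʳ-≤-nonNeg (third * δ) {{nonNegative 0≤third*δ}} (ι-mono-≤ e M e≤M) ⟩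
      ι M * (third * δ) ≡⟨ trans (*-comm (ι M) (third * δ)) (*-assoc third δ (ι M)) ⟩
      third * (δ * ι M) ≡⟨ cong (third *_) (/-*-cancel (+ 2) M) ⟩
      third * ι 2 ≤⟨ toℚᵘ-cancel-≤ (*≤*′) ⟩
      1ℚ ∎
      where
      open import Data.Rational.Unnormalised as ℚᵘ using (*≤*)
      *≤*′ : toℚᵘ (third * ι 2) ℚᵘ.≤ toℚᵘ 1ℚ
      *≤*′ = *≤* (ℤ.+≤+ (s≤s (s≤s z≤n)))

private
  -- The numerator of a positive rational is at least 1, so its denominator is an integer not below
  -- `1/ε`.
  positive-scale : ∀ ε → 0ℚ < ε → ι 1 ≤ ε * ι (↧ₙ ε)
  positive-scale ε@(mkℚ _ _ _) 0<ε = subst (ι 1 ≤_) (sym eq) (toℚ-mono-≤ {+ 1} {↥ ε} 1≤)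
    where
    eq : ε * ι (↧ₙ ε) ≡ toℚ (↥ ε)
    eq = trans (cong (_* ι (↧ₙ ε)) (sym (↥p/↧p≡p ε))) (/-*-cancel (↥ ε) (↧ₙ ε))
    1≤ : + 1 ℤ.≤ ↥ ε
    1≤ = go (↥ ε) (ℤP.positive⁻¹ (↥ ε) {{positive 0<ε}})
      where
      go : ∀ z → + 0 ℤ.< z → + 1 ℤ.≤ z
      go (+ suc n) _ = ℤ.+≤+ (s≤s z≤n)
      go (+ zero) (ℤ.+<+ ())

theorem1p2 : ∀ (ε : ℚ) → 0ℚ < ε →
    ∃[ X₀ ] ∃[ N₀ ] (∀ (X : ℚ) → (+ X₀ / 1) ≤ X → ∀ (N : ℕ) → N₀ ≤ℕ N →
    ∣ (+ countSqfree X / 1) - constantApprox N * (+ countAll X / 1) ∣ < ε * (+ countAll X / 1))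
-- The summand 2 makes the ceiling `n` of `X` at least 2, so that `c′ ≥ 1`, besides `n ≥ n₀`. The
-- second witness is the sieving limit `M`, with which every later `N` is compared.
theorem1p2 ε 0<ε = suc (suc n₀) , suc M′ , conclude
  where
  E M′ c : ℕ
  E = ↧ₙ ε
  M′ = ℕ.pred (48 ℕ.* E)
  c = 18 ℕ.* 18 ℕ.* 18 ℕ.* 18 ℕ.* 128
  1≤E : 1 ≤ℕ E
  1≤E = s≤s z≤n
  M≡ : suc M′ ≡ 48 ℕ.* E
  M≡ = ℕP.suc-pred (48 ℕ.* E) {{ℕP.m*n≢0 48 E}}
  S : Sieve (suc M′)
  S = sieve (suc M′)
  open Sieve S
  n₀ : ℕ
  n₀ = proj₁ (estimates c ℕP.≤-refl E M′ 1≤E M≡ S)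

  module _ (X : ℚ) (X₀≤X : ι (suc (suc n₀)) ≤ X) (N : ℕ) (M≤N : suc M′ ≤ℕ N) where
    1≤X : ι 1 ≤ X
    1≤X = ≤-trans (ι-mono-≤ 1 (suc (suc n₀)) (s≤s z≤n)) X₀≤X

    module WithCeiling (c′ : ℕ) (⌈X⌉≡ : ℤ.∣ ceiling X ∣ ≡ suc c′) (X≤n : X ≤ ι (suc c′)) (c′<X : ι c′ < X) where
      n : ℕ
      n = suc c′
      0<X : 0ℚ < X
      0<X = ≤-<-trans (0≤ι c′) c′<X
      n-large : suc (suc n₀) ≤ℕ n
      n-large = ι-cancel-≤ (suc (suc n₀)) n (≤-trans X₀≤X X≤n)
      -- `X` is only known to lie between `c′` and `n = c′ + 1`. Bounding their ratio by 2 produces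
      -- the factors `8 = 2³` and `16 = 2⁴` in the lower bounds for the sides.
      n≤2c′ : n ≤ℕ 2 ℕ.* c′
      n≤2c′ = ℕP.≤-trans (ℕP.+-monoˡ-≤ c′ (ℕP.≤-pred (ℕP.≤-trans (s≤s (s≤s z≤n)) n-large))) (ℕP.≤-reflexive (cong (c′ ℕ.+_) (sym (ℕP.+-identityʳ c′))))
      upper = powers-≤ X n (<⇒≤ 0<X) X≤n
      lower = powers-> X c′ c′<X

      α-data : ∃[ α ] (α ≤ℕ n ℕ.* n ℕ.* n × ι α < X * X * X × X * X * X ≤ ι (suc α))
      α-data = largestBelow (X * X * X) (n ℕ.* n ℕ.* n) (≤-<-trans (0≤ι (c′ ℕ.* c′ ℕ.* c′)) (proj₁ lower)) (proj₁ upper)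
      β-data : ∃[ β ] (β ≤ℕ n ℕ.* n ℕ.* n ℕ.* n × ι β < X * X * X * X × X * X * X * X ≤ ι (suc β))
      β-data = largestBelow (X * X * X * X) (n ℕ.* n ℕ.* n ℕ.* n) (≤-<-trans (0≤ι (c′ ℕ.* c′ ℕ.* c′ ℕ.* c′)) (proj₂ lower)) (proj₂ upper)

      module WithBounds (α β : ℕ) (α≤ : α ≤ℕ n ℕ.* n ℕ.* n) (α-lo : ι α < X * X * X) (α-hi : X * X * X ≤ ι (suc α))
        (β≤ : β ≤ℕ n ℕ.* n ℕ.* n ℕ.* n) (β-lo : ι β < X * X * X * X) (β-hi : X * X * X * X ≤ ι (suc β)) where

        B≡ : boxBound X ≡ suc (n ℕ.* n ℕ.* n ℕ.* n)
        B≡ = cong (λ c → suc (c ℕ.* c ℕ.* c ℕ.* c)) ⌈X⌉≡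
        β≤B : β ≤ℕ boxBound X
        β≤B = ℕP.≤-trans (ℕP.≤-trans β≤ (ℕP.n≤1+n _)) (ℕP.≤-reflexive (sym B≡))
        α≤B : α ≤ℕ boxBound X
        α≤B = ℕP.≤-trans (ℕP.≤-trans α≤ (ℕP.≤-trans (ℕP.m≤m*n (n ℕ.* n ℕ.* n) n) (ℕP.n≤1+n _))) (ℕP.≤-reflexive (sym B≡))

        A s I : ℕ
        A = suc (α ℕ.+ α) ℕ.* suc (β ℕ.+ β)
        s = count₂ α β squarefreeInd
        I = count₂ α β ind

        α-large : n ℕ.* n ℕ.* n ≤ℕ 8 ℕ.* α
        α-large = ℕP.≤-trans (ℕP.*-mono-≤ (ℕP.*-mono-≤ n≤2c′ n≤2c′) n≤2c′) (ℕP.≤-trans (ℕP.≤-reflexive (cube c′))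
          (ℕP.*-monoʳ-≤ 8 (ℕP.≤-pred (ι-cancel-< (c′ ℕ.* c′ ℕ.* c′) (suc α) (<-≤-trans (proj₁ lower) α-hi)))))
          where
          cube : ∀ c → 2 ℕ.* c ℕ.* (2 ℕ.* c) ℕ.* (2 ℕ.* c) ≡ 8 ℕ.* (c ℕ.* c ℕ.* c)
          cube = ℕR.solve-∀
        β-large : n ℕ.* n ℕ.* (n ℕ.* n) ≤ℕ 16 ℕ.* β
        β-large = ℕP.≤-trans (ℕP.*-mono-≤ (ℕP.*-mono-≤ n≤2c′ n≤2c′) (ℕP.*-mono-≤ n≤2c′ n≤2c′)) (ℕP.≤-trans (ℕP.≤-reflexive (fourth c′))
          (ℕP.*-monoʳ-≤ 16 (ℕP.≤-pred (ι-cancel-< (c′ ℕ.* c′ ℕ.* c′ ℕ.* c′) (suc β) (<-≤-trans (proj₂ lower) β-hi)))))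
          where
          fourth : ∀ c → 2 ℕ.* c ℕ.* (2 ℕ.* c) ℕ.* (2 ℕ.* c ℕ.* (2 ℕ.* c)) ≡ 16 ℕ.* (c ℕ.* c ℕ.* c ℕ.* c)
          fourth = ℕR.solve-∀

        est : Estimates c ℕP.≤-refl E M′ 1≤E M≡ S α β
        est = proj₂ (estimates c ℕP.≤-refl E M′ 1≤E M≡ S) n (ℕP.≤-trans (ℕP.m≤n+m n₀ 2) n-large) α β α≤
          (ℕP.≤-trans β≤ (ℕP.≤-reflexive (ℕP.*-assoc (n ℕ.* n) n n))) α-large β-large

        e : ℕ
        e = 4 ℕ.* E
        q = Q ℕ.* Q
        0<q : 0ℚ < ι q
        0<q = 0<ι q (ℕ.>-nonZero⁻¹ q {{ℕP.m*n≢0 Q Q {{Q≢0}} {{Q≢0}}}})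
        e≤M : e ≤ℕ suc M′
        e≤M = ℕP.≤-trans (ℕP.*-monoˡ-≤ E (ℕP.m≤m+n 4 44)) (ℕP.≤-reflexive (sym M≡))
        tail = constantApprox-tail M′ N M≤N
        cM = constantApprox (suc M′)

        inℚ₄ : ι e * ι I ≤ ι e * ι s + ι A
        inℚ₄ = subst₂ _≤_ (ι-* e I) (trans (ι-+ (e ℕ.* s) A) (cong (_+ ι A) (ι-* e s))) (ι-mono-≤ (e ℕ.* I) (e ℕ.* s ℕ.+ A) (proj₂ (proj₂ (proj₂ est))))

        scale : ι 4 ≤ ε * ι e
        scale = subst₂ _≤_ (*-identityʳ (ι 4)) (trans (sym (*-assoc (ι 4) ε (ι E))) (trans (cong (_* ι E) (*-comm (ι 4) ε)) (trans (*-assoc ε (ι 4) (ι E)) (cong (ε *_) (sym (ι-* 4 E))))))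
          (*-monoˡ-≤-nonNeg (ι 4) (positive-scale ε 0<ε))

        result : ∣ ι s - constantApprox N * ι A ∣ < ε * ι A
        result = combine (ι e) (ι s) (ι I) (ι A) cM (constantApprox N) ε
          (0<ι e (ℕP.≤-trans (s≤s z≤n) (ℕP.*-monoʳ-≤ 4 1≤E))) (0<ι A (s≤s z≤n))
          (density-upper e q I A (Per₂ Q ind) cM density 0<q (proj₁ est))
          (density-lower e q I A (Per₂ Q ind) cM density 0<q (proj₁ (proj₂ est)))
          (ι-mono-≤ s I (proj₁ (proj₂ (proj₂ est)))) inℚ₄ (proj₁ tail) (proj₂ tail e e≤M) scale

        counts : ∣ ι (countSqfree X) - constantApprox N * ι (countAll X) ∣ < ε * ι (countAll X)
        counts = subst₂ (λ s A → ∣ ι s - constantApprox N * ι A ∣ < ε * ι A)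
          (sym (count-squarefree X (boxBound X) α β α≤B β≤B α-lo α-hi β-lo β-hi))
          (sym (count-all X (boxBound X) α β α≤B β≤B α-lo α-hi β-lo β-hi)) result

  conclude : ∀ X → ι (suc (suc n₀)) ≤ X → ∀ N → suc M′ ≤ℕ N →
    ∣ ι (countSqfree X) - constantApprox N * ι (countAll X) ∣ < ε * ι (countAll X)
  conclude X X₀≤X N M≤N =
    let (c′ , ⌈X⌉≡ , X≤n , c′<X) = ceilingℕ X (1≤X X X₀≤X N M≤N)
        module B = WithCeiling X X₀≤X N M≤N c′ ⌈X⌉≡ X≤n c′<X
        (α , α≤ , α-lo , α-hi) = B.α-data
        (β , β≤ , β-lo , β-hi) = B.β-data
    in B.WithBounds.counts α β α≤ α-lo α-hi β≤ β-lo β-hi
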